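{- Let $\ell\ge 3$ be an integer. If $\ell$ is not divisible by four, then $c(\ell)=1$.
   Context: For integers $n\ge \ell\ge 3$, let $C(n,\ell)$ denote the maximum number of directed cycles of length $\ell$ in an $n$-vertex tournament (a tournament is an orientation of a complete graph), and let $R(n,\ell)=\frac{(\ell-1)!}{2^{\ell}}\binom{n}{\ell}$, the expected number of directed cycles of length $\ell$ in the random $n$-vertex tournament (each edge oriented in each direction independently with probability $1/2$). Define $c(\ell)=\lim_{n\to\infty} C(n,\ell)/R(n,\ell)$. -}

module Defs where

open import Data.Bool using (Bool; true; false; not; _∧_; _xor_; if_then_else_)
open import Data.Nat using (ℕ; zero; suc; _*_; _∸_; _^_; _≤_; _⊔_; NonZero; _!)
open import Data.Nat.Properties using (m^n≢0)
open import Data.Nat.Combinatorics using (_C_)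
import Data.Nat.DivMod as ℕD
open import Data.Integer using (+_)
open import Data.Fin using (Fin)
open import Data.Bool.ListAction using (all; any)
import Data.Fin as F
open import Data.List using (List; []; _∷_; [_]; map; concatMap; filterᵇ; length; zip; _++_; foldr; allFin)
open import Data.Vec using (Vec; lookup; toList)
import Data.Vec as V
open import Data.Product using (_×_; _,_; ∃-syntax)
open import Relation.Nullary using (yes; no)
open import Relation.Nullary.Decidable using (⌊_⌋)
open import Data.Rational using (ℚ; 0ℚ; _/_; _÷_; _-_; ∣_∣; _<_; ≢-nonZero)
import Data.Rational as Q
open import Data.Rational.Properties using (_≟_)

allVecs : {A : Set} → (k : ℕ) → List A → List (Vec A k)
allVecs zero    xs = [ V.[] ]
allVecs (suc k) xs = concatMap (λ x → map (x V.∷_) (allVecs k xs)) xs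

-- a digraph (possibly with loops) on vertex set Fin n; A i j = true means arc i → j
Digraph : ℕ → Set
Digraph n = Fin n → Fin n → Bool

isTournament : {n : ℕ} → Digraph n → Bool
isTournament {n} A =
  all (λ i → all (λ j → if ⌊ i F.≟ j ⌋ then not (A i j) else (A i j xor A j i)) (allFin n)) (allFin n)

allDigraphs : (n : ℕ) → List (Digraph n)
allDigraphs n = map (λ M i j → lookup (lookup M i) j) (allVecs n (allVecs n (true ∷ false ∷ [])))

tournaments : (n : ℕ) → List (Digraph n)
tournaments n = filterᵇ isTournament (allDigraphs n)

distinct : {n : ℕ} → List (Fin n) → Bool
distinct []       = true
distinct (x ∷ xs) = not (any (λ y → ⌊ x F.≟ y ⌋) xs) ∧ distinct xs

cyclicPairs : {A : Set} → List A → List (A × A)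
cyclicPairs []       = []
cyclicPairs (x ∷ xs) = zip (x ∷ xs) (xs ++ [ x ])

isCycleSeq : {n : ℕ} → Digraph n → List (Fin n) → Bool
isCycleSeq A xs = distinct xs ∧ all (λ p → A (Data.Product.proj₁ p) (Data.Product.proj₂ p)) (cyclicPairs xs)

cycleSeqCount : {n : ℕ} → (ℓ : ℕ) → Digraph n → ℕ
cycleSeqCount {n} ℓ A = length (filterᵇ (λ v → isCycleSeq A (toList v)) (allVecs ℓ (allFin n)))

divℕ : ℕ → ℕ → ℕ
divℕ m zero    = 0
divℕ m (suc k) = m ℕD./ suc k

-- number of directed cycles of length ℓ: each cycle is traced by exactly ℓ sequences
-- (its ℓ rotations)
numCycles : {n : ℕ} → (ℓ : ℕ) → Digraph n → ℕ
numCycles ℓ A = divℕ (cycleSeqCount ℓ A) ℓ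

maxCycles : (n ℓ : ℕ) → ℕ
maxCycles n ℓ = foldr _⊔_ 0 (map (numCycles ℓ) (tournaments n))

R : (n ℓ : ℕ) → ℚ
R n ℓ = _/_ (+ ((ℓ ∸ 1) ! * (n C ℓ))) (2 ^ ℓ) {{m^n≢0 2 ℓ}}

-- p / q, with the junk value 0 when q = 0
safeDiv : ℚ → ℚ → ℚ
safeDiv p q with q ≟ 0ℚ
... | yes _   = 0ℚ
... | no q≢0  = _÷_ p q {{≢-nonZero q≢0}}

ConvergesTo : (ℕ → ℚ) → ℚ → Set
ConvergesTo f L = ∀ (ε : ℚ) → 0ℚ < ε → ∃[ N ] (∀ n → N ≤ n → ∣ f n - L ∣ < ε)

ratio : (ℓ : ℕ) → ℕ → ℚ
ratio ℓ n = safeDiv (+ (maxCycles n ℓ) / 1) (R n ℓ)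

{-# OPTIONS --safe #-}
module Submission where

-- Put M = 2A + I for the adjacency matrix A of a tournament on n vertices, so that M ≥ 0 and
-- M + Mᵀ = 2J.  Since 2^ℓ times the number of closed ℓ-walks of A is at most tr M^ℓ, the upper
-- bound follows from tr M^ℓ ≤ n^ℓ.  Let ρ be the Perron root of M.  Every other eigenvalue λ has
-- Re λ ≥ 0 and |λ| ≤ ρ, hence Re λ^ℓ ≤ ℓ ρ^(ℓ-1) Re λ when 4 ∤ ℓ, and the eigenvalues have sum n, so
-- tr M^ℓ ≤ ρ^ℓ + ℓ ρ^(ℓ-1) (n - ρ) ≤ n^ℓ by convexity.
--
-- Over the rationals eigenvalues are avoided as follows.  A small perturbation makes the Perron
-- vector rational, and compressing M to its orthogonal complement gives B with
-- B + Bᵀ = 2eeᵀ and B^k = O(ρ^k).  For C = B/r with r slightly larger than ρ, the form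
-- P = Σ_{k≤K} (C^k)ᵀ C^k satisfies both CᵀPC ≤ P and PC + CᵀP ≥ 0, so that C is simultaneously
-- a contraction and accretive for P; telescoping the P-adjoint then yields tr C^ℓ ≤ ℓ tr C.
--
-- For the lower bound, the expected number of cycles is affine in the probability of orienting any
-- single pair, so the uniformly random orientation can be rounded pair by pair without loss.

-- The condition on ℓ enters through parity alone. With `Q = P⁻¹`, the numbers
-- `g(a,b) = tr (P C^a Q (C^b)ᵀ)` equal `tr C^ℓ` at both ends of the antidiagonal a + b = ℓ, and the
-- sum of two neighbours lies between -τ and τ for τ = 2 tr C. An odd number of steps therefore
-- controls the sum of two values, an even number only their difference. For odd ℓ the whole
-- antidiagonal is used. For ℓ = 2q with q odd, half of it is used, together with
-- `tr C^(2q) ≤ g(q,q)`. For 4 | ℓ both routes have even length. The obstacle is that `B + Bᵀ ≥ 0`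
-- is known for the standard form, in which B need not be a contraction, while an arbitrary form
-- that makes B contractive may destroy accretivity. The sum of the conjugates by powers of B has
-- both properties because B commutes with its powers. The rational Perron vector and the enlarged
-- radius cost O(θ) with a constant independent of θ, so `tr M^ℓ ≤ n^ℓ` comes out exactly, for every
-- n. The only asymptotic losses are the gap between n^ℓ and the falling factorial and the rounding
-- in the division by ℓ.

module Spectral where

  open import Algebra.Bundles using (CommutativeRing)
  open import Data.Empty using (⊥-elim)
  open import Data.Fin using (Fin; zero; suc)
  open import Data.Fin.Properties using (all?; ¬∀⟶∃¬)
  import Data.Integer as ℤ
  import Data.Integer.Properties as ℤ
  import Data.Nat as ℕ
  open ℕ using (ℕ; zero; suc)
  open import Data.Nat.Coprimality as Coprime using (1-coprimeTo)
  import Data.Nat.Properties as ℕ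
  open import Data.Product using (_×_; _,_; proj₁; proj₂; ∃-syntax)
  open import Data.Rational hiding (_⊔_; _⊓_; floor)
  open import Data.Rational.Properties
  open import Data.Sum using (_⊎_; inj₁; inj₂)
  open import Data.Vec using (Vec; []; _∷_; lookup; tabulate; _++_)
  open import Data.Vec.Properties using (lookup∘tabulate; tabulate∘lookup; tabulate-cong)
  open import Level using (0ℓ)
  open import Relation.Binary.PropositionalEquality
  open import Relation.Nullary using (yes; no)
  open import Relation.Nullary.Decidable using (dec⇒maybe)
  open import Tactic.RingSolver using (solve-∀)
  open import Tactic.RingSolver.Core.AlmostCommutativeRing using (AlmostCommutativeRing; fromCommutativeRing)
  open CommutativeRing +-*-commutativeRing using (semiring)
  open import Algebra.Properties.Semiring.Exp semiring using (_^_)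
  open import Algebra.Properties.Semiring.Mult semiring using (×-homo-+; ×1-homo-*) renaming (_×_ to _•_)
  open import Algebra.Properties.Semiring.Sum semiring
    using (sum; sum-cong-≗; ∑-distrib-+; ∑-comm; *-distribˡ-sum; *-distribʳ-sum; sum-replicate-zero)

  ℚ-ring : AlmostCommutativeRing 0ℓ 0ℓ
  ℚ-ring = fromCommutativeRing +-*-commutativeRing (λ x → dec⇒maybe (0ℚ ≟ x))

  2ℚ : ℚ
  2ℚ = 1ℚ + 1ℚ

  -- Repeated addition makes `ι (suc n)` unfold to `1ℚ + ι n`, the form in which inductions on n
  -- reach the ring solver; `ι≡/1` links it to the fractions of the statement.
  ι : ℕ → ℚ
  ι n = n • 1ℚ

  -- Ordered-field arithmetic

  0≤1 : 0ℚ ≤ 1ℚ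
  0≤1 = nonNegative⁻¹ 1ℚ

  0<1 : 0ℚ < 1ℚ
  0<1 = positive⁻¹ 1ℚ

  0≤2 : 0ℚ ≤ 2ℚ
  0≤2 = nonNegative⁻¹ 2ℚ

  p+d≡q⇒p≤q : ∀ {p q d} → 0ℚ ≤ d → p + d ≡ q → p ≤ q
  p+d≡q⇒p≤q {p} {q} {d} 0≤d eq = subst₂ _≤_ (+-identityʳ p) eq (+-monoʳ-≤ p 0≤d)

  p≤q⇒0≤q-p : ∀ {p q} → p ≤ q → 0ℚ ≤ q - p
  p≤q⇒0≤q-p {p} {q} p≤q = subst (_≤ q - p) (+-inverseʳ p) (+-monoˡ-≤ (- p) p≤q)

  p<q⇒0<q-p : ∀ {p q} → p < q → 0ℚ < q - p
  p<q⇒0<q-p {p} {q} p<q = subst (_< q - p) (+-inverseʳ p) (+-monoˡ-< (- p) p<q)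

  0≤q-p⇒p≤q : ∀ {p q} → 0ℚ ≤ q - p → p ≤ q
  0≤q-p⇒p≤q {p} {q} h = p+d≡q⇒p≤q h (lemma p q)
    where
    lemma : ∀ p q → p + (q - p) ≡ q
    lemma = solve-∀ ℚ-ring

  0≤p+q : ∀ {p q} → 0ℚ ≤ p → 0ℚ ≤ q → 0ℚ ≤ p + q
  0≤p+q = +-mono-≤

  *-monoˡ-≤ : ∀ {r p q} → 0ℚ ≤ r → p ≤ q → r * p ≤ r * q
  *-monoˡ-≤ {r} 0≤r = *-monoˡ-≤-nonNeg r {{nonNegative 0≤r}}

  *-monoʳ-≤ : ∀ {r p q} → 0ℚ ≤ r → p ≤ q → p * r ≤ q * r
  *-monoʳ-≤ {r} 0≤r = *-monoʳ-≤-nonNeg r {{nonNegative 0≤r}}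

  *-mono-≤ : ∀ {p q r s} → 0ℚ ≤ p → p ≤ q → 0ℚ ≤ r → r ≤ s → p * r ≤ q * s
  *-mono-≤ 0≤p p≤q 0≤r r≤s = ≤-trans (*-monoˡ-≤ 0≤p r≤s) (*-monoʳ-≤ (≤-trans 0≤r r≤s) p≤q)

  0≤p*q : ∀ {p q} → 0ℚ ≤ p → 0ℚ ≤ q → 0ℚ ≤ p * q
  0≤p*q {p} {q} 0≤p 0≤q = subst (_≤ p * q) (*-zeroʳ p) (*-monoˡ-≤ 0≤p 0≤q)

  0<p*q : ∀ {p q} → 0ℚ < p → 0ℚ < q → 0ℚ < p * q
  0<p*q {p} {q} 0<p 0<q =
    positive⁻¹ (p * q) {{pos*pos⇒pos p {{positive 0<p}} q {{positive 0<q}}}}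

  *-cancelˡ-≤ : ∀ {r p q} → 0ℚ < r → r * p ≤ r * q → p ≤ q
  *-cancelˡ-≤ {r} 0<r = *-cancelˡ-≤-pos r {{positive 0<r}}

  *-cancelʳ-≤ : ∀ {r p q} → 0ℚ < r → p * r ≤ q * r → p ≤ q
  *-cancelʳ-≤ {r} 0<r = *-cancelʳ-≤-pos r {{positive 0<r}}

  0≤p² : ∀ p → 0ℚ ≤ p * p
  0≤p² p with ≤-total 0ℚ p
  ... | inj₁ 0≤p = 0≤p*q 0≤p 0≤p
  ... | inj₂ p≤0 = subst (0ℚ ≤_) (lemma p) (0≤p*q (neg-antimono-≤ p≤0) (neg-antimono-≤ p≤0))
    where
    lemma : ∀ p → (- p) * (- p) ≡ p * p
    lemma = solve-∀ ℚ-ring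

  inv : ∀ {p} → 0ℚ < p → ℚ
  inv {p} 0<p = 1/_ p {{>-nonZero 0<p}}

  *-inv : ∀ {p} (0<p : 0ℚ < p) → p * inv 0<p ≡ 1ℚ
  *-inv {p} 0<p = *-inverseʳ p {{>-nonZero 0<p}}

  *-inv-* : ∀ q {p} (0<p : 0ℚ < p) → q * inv 0<p * p ≡ q
  *-inv-* q {p} 0<p = begin
    q * inv 0<p * p      ≡⟨ *-assoc q (inv 0<p) p ⟩
    q * (inv 0<p * p)    ≡⟨ cong (q *_) (trans (*-comm (inv 0<p) p) (*-inv 0<p)) ⟩
    q * 1ℚ               ≡⟨ *-identityʳ q ⟩
    q                    ∎
    where open ≡-Reasoning

  0<inv : ∀ {p} (0<p : 0ℚ < p) → 0ℚ < inv 0<p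
  0<inv {p} 0<p = positive⁻¹ (inv 0<p) {{1/pos⇒pos p {{positive 0<p}}}}

  0≤inv : ∀ {p} (0<p : 0ℚ < p) → 0ℚ ≤ inv 0<p
  0≤inv 0<p = <⇒≤ (0<inv 0<p)

  0≤ι : ∀ n → 0ℚ ≤ ι n
  0≤ι zero    = ≤-refl
  0≤ι (suc n) = 0≤p+q 0≤1 (0≤ι n)

  0<ι : ∀ n → 0ℚ < ι (suc n)
  0<ι n = +-mono-<-≤ 0<1 (0≤ι n)

  ι-mono : ∀ {m n} → m ℕ.≤ n → ι m ≤ ι n
  ι-mono {n = n} ℕ.z≤n = 0≤ι n
  ι-mono (ℕ.s≤s m≤n)   = +-monoʳ-≤ 1ℚ (ι-mono m≤n)

  0≤^ : ∀ {p} → 0ℚ ≤ p → ∀ n → 0ℚ ≤ p ^ n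
  0≤^ 0≤p zero    = 0≤1
  0≤^ 0≤p (suc n) = 0≤p*q 0≤p (0≤^ 0≤p n)

  ^-mono-≤ : ∀ {p q} → 0ℚ ≤ p → p ≤ q → ∀ n → p ^ n ≤ q ^ n
  ^-mono-≤ 0≤p p≤q zero    = ≤-refl
  ^-mono-≤ 0≤p p≤q (suc n) = *-mono-≤ 0≤p p≤q (0≤^ 0≤p n) (^-mono-≤ 0≤p p≤q n)

  1^ : ∀ n → 1ℚ ^ n ≡ 1ℚ
  1^ zero    = refl
  1^ (suc n) = trans (*-identityˡ (1ℚ ^ n)) (1^ n)

  *-^ : ∀ p q n → (p * q) ^ n ≡ p ^ n * q ^ n
  *-^ p q zero    = refl
  *-^ p q (suc n) = trans (cong (p * q *_) (*-^ p q n)) (lemma p q (p ^ n) (q ^ n))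
    where
    lemma : ∀ p q x y → p * q * (x * y) ≡ p * x * (q * y)
    lemma = solve-∀ ℚ-ring

  -- Finite sums

  opaque
    ∑ : ∀ {n} → (Fin n → ℚ) → ℚ
    ∑ = sum

    ∑-suc : ∀ {n} (f : Fin (suc n) → ℚ) → ∑ f ≡ f zero + ∑ (λ i → f (suc i))
    ∑-suc f = refl

    ∑-cong : ∀ {n} {f g : Fin n → ℚ} → (∀ i → f i ≡ g i) → ∑ f ≡ ∑ g
    ∑-cong = sum-cong-≗

    ∑-+ : ∀ {n} (f g : Fin n → ℚ) → ∑ (λ i → f i + g i) ≡ ∑ f + ∑ g
    ∑-+ = ∑-distrib-+

    ∑-swap : ∀ {m n} (f : Fin m → Fin n → ℚ) → ∑ (λ i → ∑ (f i)) ≡ ∑ (λ j → ∑ λ i → f i j)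
    ∑-swap = ∑-comm

    *-∑ : ∀ {n} c (f : Fin n → ℚ) → c * ∑ f ≡ ∑ (λ i → c * f i)
    *-∑ = *-distribˡ-sum

    ∑-* : ∀ {n} c (f : Fin n → ℚ) → ∑ f * c ≡ ∑ (λ i → f i * c)
    ∑-* = *-distribʳ-sum

    ∑-mono-≤ : ∀ {n} {f g : Fin n → ℚ} → (∀ i → f i ≤ g i) → ∑ f ≤ ∑ g
    ∑-mono-≤ {zero}  f≤g = ≤-refl
    ∑-mono-≤ {suc n} f≤g = +-mono-≤ (f≤g zero) (∑-mono-≤ (λ i → f≤g (suc i)))

    0≤∑ : ∀ {n} {f : Fin n → ℚ} → (∀ i → 0ℚ ≤ f i) → 0ℚ ≤ ∑ f
    0≤∑ {zero}  0≤f = ≤-refl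
    0≤∑ {suc n} 0≤f = 0≤p+q (0≤f zero) (0≤∑ (λ i → 0≤f (suc i)))

    term≤∑ : ∀ {n} {f : Fin n → ℚ} → (∀ i → 0ℚ ≤ f i) → ∀ i → f i ≤ ∑ f
    term≤∑ {f = f} 0≤f zero =
      p+d≡q⇒p≤q (0≤∑ (λ i → 0≤f (suc i))) refl
    term≤∑ {f = f} 0≤f (suc i) =
      ≤-trans (term≤∑ (λ i → 0≤f (suc i)) i) (p+d≡q⇒p≤q (0≤f zero) (+-comm _ (f zero)))

    ∑-const : ∀ n c → ∑ {n} (λ _ → c) ≡ ι n * c
    ∑-const zero    c = sym (*-zeroˡ c)
    ∑-const (suc n) c = trans (cong (c +_) (∑-const n c)) (lemma c (ι n))
      where
      lemma : ∀ c m → c + m * c ≡ (1ℚ + m) * c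
      lemma = solve-∀ ℚ-ring

    ∑-zero : ∀ {n} {f : Fin n → ℚ} → (∀ i → f i ≡ 0ℚ) → ∑ f ≡ 0ℚ
    ∑-zero {n} f≡0 = trans (∑-cong f≡0) (sum-replicate-zero n)

  -- Rational matrices

  -- Vectors of vectors rather than functions, so that entrywise equal matrices are equal.
  Mat : ℕ → ℕ → Set
  Mat m n = Vec (Vec ℚ n) m

  infix 9 _⟨_,_⟩
  _⟨_,_⟩ : ∀ {m n} → Mat m n → Fin m → Fin n → ℚ
  A ⟨ i , j ⟩ = lookup (lookup A i) j

  mat : ∀ {m n} → (Fin m → Fin n → ℚ) → Mat m n
  mat f = tabulate λ i → tabulate (f i)

  mat-entry : ∀ {m n} (f : Fin m → Fin n → ℚ) i j → mat f ⟨ i , j ⟩ ≡ f i j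
  mat-entry f i j = trans (cong (λ r → lookup r j) (lookup∘tabulate _ i)) (lookup∘tabulate (f i) j)

  Mat-ext : ∀ {m n} {A B : Mat m n} → (∀ i j → A ⟨ i , j ⟩ ≡ B ⟨ i , j ⟩) → A ≡ B
  Mat-ext {A = A} {B} eq = begin
    A                                            ≡⟨ tabulate∘lookup A ⟨
    tabulate (lookup A)                          ≡⟨ tabulate-cong (λ i → row i) ⟩
    tabulate (lookup B)                          ≡⟨ tabulate∘lookup B ⟩
    B                                            ∎
    where
    open ≡-Reasoning
    row : ∀ i → lookup A i ≡ lookup B i
    row i = trans (sym (tabulate∘lookup _)) (trans (tabulate-cong (eq i)) (tabulate∘lookup _))

  infixl 7 _·_
  infixl 6 _⊕_
  infixr 8 _⊙_
  infix 10 _ᵀ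
  infixl 9 _^ᴹ_

  opaque
    _·_ : ∀ {m k n} → Mat m k → Mat k n → Mat m n
    A · B = mat λ i j → ∑ λ l → A ⟨ i , l ⟩ * B ⟨ l , j ⟩

    _⊕_ : ∀ {m n} → Mat m n → Mat m n → Mat m n
    A ⊕ B = mat λ i j → A ⟨ i , j ⟩ + B ⟨ i , j ⟩

    _⊙_ : ∀ {m n} → ℚ → Mat m n → Mat m n
    c ⊙ A = mat λ i j → c * A ⟨ i , j ⟩

    _ᵀ : ∀ {m n} → Mat m n → Mat n m
    A ᵀ = mat λ i j → A ⟨ j , i ⟩

    tr : ∀ {n} → Mat n n → ℚ
    tr A = ∑ λ i → A ⟨ i , i ⟩

    ·-entry : ∀ {m k n} (A : Mat m k) (B : Mat k n) i j →
              (A · B) ⟨ i , j ⟩ ≡ ∑ λ l → A ⟨ i , l ⟩ * B ⟨ l , j ⟩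
    ·-entry A B = mat-entry _

    ⊕-entry : ∀ {m n} (A B : Mat m n) i j → (A ⊕ B) ⟨ i , j ⟩ ≡ A ⟨ i , j ⟩ + B ⟨ i , j ⟩
    ⊕-entry A B = mat-entry _

    ⊙-entry : ∀ {m n} c (A : Mat m n) i j → (c ⊙ A) ⟨ i , j ⟩ ≡ c * A ⟨ i , j ⟩
    ⊙-entry c A = mat-entry _

    ᵀ-entry : ∀ {m n} (A : Mat m n) i j → (A ᵀ) ⟨ i , j ⟩ ≡ A ⟨ j , i ⟩
    ᵀ-entry A = mat-entry _

    tr-def : ∀ {n} (A : Mat n n) → tr A ≡ ∑ λ i → A ⟨ i , i ⟩
    tr-def A = refl

  opaque
    unfolding ∑

    δ : ∀ {n} → Fin n → Fin n → ℚ
    δ zero    zero    = 1ℚ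
    δ zero    (suc j) = 0ℚ
    δ (suc i) zero    = 0ℚ
    δ (suc i) (suc j) = δ i j

    δ-sym : ∀ {n} (i j : Fin n) → δ i j ≡ δ j i
    δ-sym zero    zero    = refl
    δ-sym zero    (suc j) = refl
    δ-sym (suc i) zero    = refl
    δ-sym (suc i) (suc j) = δ-sym i j

    δ-refl : ∀ {n} (i : Fin n) → δ i i ≡ 1ℚ
    δ-refl zero    = refl
    δ-refl (suc i) = δ-refl i

    ∑-δ : ∀ {n} (i : Fin n) (f : Fin n → ℚ) → ∑ (λ l → δ i l * f l) ≡ f i
    ∑-δ zero f =
      trans (cong₂ _+_ (*-identityˡ (f zero)) (∑-zero λ l → *-zeroˡ (f (suc l)))) (+-identityʳ _)
    ∑-δ (suc i) f =
      trans (cong₂ _+_ (*-zeroˡ (f zero)) (∑-δ i (λ l → f (suc l)))) (+-identityˡ _)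

  𝟙 : ∀ {n} → Mat n n
  𝟙 = mat δ

  𝟘 : ∀ {m n} → Mat m n
  𝟘 = mat λ _ _ → 0ℚ

  _^ᴹ_ : ∀ {n} → Mat n n → ℕ → Mat n n
  A ^ᴹ zero  = 𝟙
  A ^ᴹ suc k = A ^ᴹ k · A

  ·-identityˡ : ∀ {m n} (A : Mat m n) → 𝟙 · A ≡ A
  ·-identityˡ A = Mat-ext λ i j → begin
    (𝟙 · A) ⟨ i , j ⟩                        ≡⟨ ·-entry 𝟙 A i j ⟩
    ∑ (λ l → 𝟙 ⟨ i , l ⟩ * A ⟨ l , j ⟩)    ≡⟨ ∑-cong (λ l → cong (_* A ⟨ l , j ⟩) (mat-entry δ i l)) ⟩
    ∑ (λ l → δ i l * A ⟨ l , j ⟩)          ≡⟨ ∑-δ i _ ⟩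
    A ⟨ i , j ⟩                              ∎
    where open ≡-Reasoning

  ·-assoc : ∀ {m k l n} (A : Mat m k) (B : Mat k l) (C : Mat l n) → (A · B) · C ≡ A · (B · C)
  ·-assoc A B C = Mat-ext λ i j → begin
    ((A · B) · C) ⟨ i , j ⟩
      ≡⟨ ·-entry (A · B) C i j ⟩
    ∑ (λ l → (A · B) ⟨ i , l ⟩ * C ⟨ l , j ⟩)
      ≡⟨ ∑-cong (λ l → trans (cong (_* C ⟨ l , j ⟩) (·-entry A B i l)) (∑-* (C ⟨ l , j ⟩) _)) ⟩
    ∑ (λ l → ∑ λ k → A ⟨ i , k ⟩ * B ⟨ k , l ⟩ * C ⟨ l , j ⟩)
      ≡⟨ ∑-swap _ ⟩
    ∑ (λ k → ∑ λ l → A ⟨ i , k ⟩ * B ⟨ k , l ⟩ * C ⟨ l , j ⟩)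
      ≡⟨ ∑-cong (λ k → trans (∑-cong λ l → *-assoc (A ⟨ i , k ⟩) _ _) (sym (*-∑ (A ⟨ i , k ⟩) _))) ⟩
    ∑ (λ k → A ⟨ i , k ⟩ * ∑ λ l → B ⟨ k , l ⟩ * C ⟨ l , j ⟩)
      ≡⟨ ∑-cong (λ k → cong (A ⟨ i , k ⟩ *_) (sym (·-entry B C k j))) ⟩
    ∑ (λ k → A ⟨ i , k ⟩ * (B · C) ⟨ k , j ⟩)
      ≡⟨ ·-entry A (B · C) i j ⟨
    (A · (B · C)) ⟨ i , j ⟩ ∎
    where open ≡-Reasoning

  ·-distribˡ-⊕ : ∀ {m k n} (A : Mat m k) (B C : Mat k n) → A · (B ⊕ C) ≡ A · B ⊕ A · C
  ·-distribˡ-⊕ A B C = Mat-ext λ i j → begin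
    (A · (B ⊕ C)) ⟨ i , j ⟩
      ≡⟨ ·-entry A (B ⊕ C) i j ⟩
    ∑ (λ l → A ⟨ i , l ⟩ * (B ⊕ C) ⟨ l , j ⟩)
      ≡⟨ ∑-cong (λ l → trans (cong (A ⟨ i , l ⟩ *_) (⊕-entry B C l j)) (*-distribˡ-+ (A ⟨ i , l ⟩) _ _)) ⟩
    ∑ (λ l → A ⟨ i , l ⟩ * B ⟨ l , j ⟩ + A ⟨ i , l ⟩ * C ⟨ l , j ⟩)
      ≡⟨ ∑-+ (λ l → A ⟨ i , l ⟩ * B ⟨ l , j ⟩) _ ⟩
    _ ≡⟨ cong₂ _+_ (·-entry A B i j) (·-entry A C i j) ⟨
    (A · B) ⟨ i , j ⟩ + (A · C) ⟨ i , j ⟩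
      ≡⟨ ⊕-entry (A · B) (A · C) i j ⟨
    (A · B ⊕ A · C) ⟨ i , j ⟩ ∎
    where open ≡-Reasoning

  ⊙-·ʳ : ∀ {m k n} c (A : Mat m k) (B : Mat k n) → A · (c ⊙ B) ≡ c ⊙ (A · B)
  ⊙-·ʳ c A B = Mat-ext λ i j → begin
    (A · (c ⊙ B)) ⟨ i , j ⟩
      ≡⟨ ·-entry A (c ⊙ B) i j ⟩
    ∑ (λ l → A ⟨ i , l ⟩ * (c ⊙ B) ⟨ l , j ⟩)
      ≡⟨ ∑-cong (λ l → trans (cong (A ⟨ i , l ⟩ *_) (⊙-entry c B l j)) (lemma (A ⟨ i , l ⟩) c (B ⟨ l , j ⟩))) ⟩
    ∑ (λ l → c * (A ⟨ i , l ⟩ * B ⟨ l , j ⟩))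
      ≡⟨ *-∑ c _ ⟨
    c * ∑ (λ l → A ⟨ i , l ⟩ * B ⟨ l , j ⟩)
      ≡⟨ cong (c *_) (·-entry A B i j) ⟨
    c * (A · B) ⟨ i , j ⟩
      ≡⟨ ⊙-entry c (A · B) i j ⟨
    (c ⊙ (A · B)) ⟨ i , j ⟩ ∎
    where
    open ≡-Reasoning
    lemma : ∀ a c b → a * (c * b) ≡ c * (a * b)
    lemma = solve-∀ ℚ-ring

  ᵀ-· : ∀ {m k n} (A : Mat m k) (B : Mat k n) → (A · B) ᵀ ≡ B ᵀ · A ᵀ
  ᵀ-· A B = Mat-ext λ i j → begin
    ((A · B) ᵀ) ⟨ i , j ⟩
      ≡⟨ trans (ᵀ-entry (A · B) i j) (·-entry A B j i) ⟩
    ∑ (λ l → A ⟨ j , l ⟩ * B ⟨ l , i ⟩)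
      ≡⟨ ∑-cong (λ l → trans (*-comm (A ⟨ j , l ⟩) _) (sym (cong₂ _*_ (ᵀ-entry B i l) (ᵀ-entry A l j)))) ⟩
    ∑ (λ l → (B ᵀ) ⟨ i , l ⟩ * (A ᵀ) ⟨ l , j ⟩)
      ≡⟨ ·-entry (B ᵀ) (A ᵀ) i j ⟨
    (B ᵀ · A ᵀ) ⟨ i , j ⟩ ∎
    where open ≡-Reasoning

  ᵀ-⊕ : ∀ {m n} (A B : Mat m n) → (A ⊕ B) ᵀ ≡ A ᵀ ⊕ B ᵀ
  ᵀ-⊕ A B = Mat-ext λ i j →
    trans (trans (ᵀ-entry (A ⊕ B) i j) (⊕-entry A B j i))
          (sym (trans (⊕-entry (A ᵀ) (B ᵀ) i j) (cong₂ _+_ (ᵀ-entry A i j) (ᵀ-entry B i j))))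

  ᵀ-⊙ : ∀ {m n} c (A : Mat m n) → (c ⊙ A) ᵀ ≡ c ⊙ A ᵀ
  ᵀ-⊙ c A = Mat-ext λ i j →
    trans (trans (ᵀ-entry (c ⊙ A) i j) (⊙-entry c A j i))
          (sym (trans (⊙-entry c (A ᵀ) i j) (cong (c *_) (ᵀ-entry A i j))))

  ᵀ-involutive : ∀ {m n} (A : Mat m n) → A ᵀ ᵀ ≡ A
  ᵀ-involutive A = Mat-ext λ i j → trans (ᵀ-entry (A ᵀ) i j) (ᵀ-entry A j i)

  𝟙ᵀ : ∀ {n} → 𝟙 {n} ᵀ ≡ 𝟙
  𝟙ᵀ = Mat-ext λ i j → trans (ᵀ-entry 𝟙 i j)
    (trans (mat-entry δ j i) (trans (δ-sym j i) (sym (mat-entry δ i j))))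

  ᵀ-injective : ∀ {m n} {A B : Mat m n} → A ᵀ ≡ B ᵀ → A ≡ B
  ᵀ-injective {A = A} {B} eq = trans (sym (ᵀ-involutive A)) (trans (cong _ᵀ eq) (ᵀ-involutive B))

  ·-identityʳ : ∀ {m n} (A : Mat m n) → A · 𝟙 ≡ A
  ·-identityʳ A = ᵀ-injective
    (trans (ᵀ-· A 𝟙) (trans (cong (_· A ᵀ) 𝟙ᵀ) (·-identityˡ (A ᵀ))))

  ·-distribʳ-⊕ : ∀ {m k n} (A B : Mat m k) (C : Mat k n) → (A ⊕ B) · C ≡ A · C ⊕ B · C
  ·-distribʳ-⊕ A B C = ᵀ-injective (begin
    ((A ⊕ B) · C) ᵀ               ≡⟨ trans (ᵀ-· (A ⊕ B) C) (cong (C ᵀ ·_) (ᵀ-⊕ A B)) ⟩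
    C ᵀ · (A ᵀ ⊕ B ᵀ)             ≡⟨ ·-distribˡ-⊕ (C ᵀ) (A ᵀ) (B ᵀ) ⟩
    C ᵀ · A ᵀ ⊕ C ᵀ · B ᵀ         ≡⟨ cong₂ _⊕_ (ᵀ-· A C) (ᵀ-· B C) ⟨
    (A · C) ᵀ ⊕ (B · C) ᵀ         ≡⟨ ᵀ-⊕ (A · C) (B · C) ⟨
    (A · C ⊕ B · C) ᵀ             ∎)
    where open ≡-Reasoning

  ⊙-·ˡ : ∀ {m k n} c (A : Mat m k) (B : Mat k n) → (c ⊙ A) · B ≡ c ⊙ (A · B)
  ⊙-·ˡ c A B = ᵀ-injective (begin
    ((c ⊙ A) · B) ᵀ        ≡⟨ trans (ᵀ-· (c ⊙ A) B) (cong (B ᵀ ·_) (ᵀ-⊙ c A)) ⟩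
    B ᵀ · (c ⊙ A ᵀ)        ≡⟨ ⊙-·ʳ c (B ᵀ) (A ᵀ) ⟩
    c ⊙ (B ᵀ · A ᵀ)        ≡⟨ cong (c ⊙_) (ᵀ-· A B) ⟨
    c ⊙ (A · B) ᵀ          ≡⟨ ᵀ-⊙ c (A · B) ⟨
    (c ⊙ (A · B)) ᵀ        ∎)
    where open ≡-Reasoning

  ⊕-assoc : ∀ {m n} (A B C : Mat m n) → (A ⊕ B) ⊕ C ≡ A ⊕ (B ⊕ C)
  ⊕-assoc A B C = Mat-ext λ i j → begin
    ((A ⊕ B) ⊕ C) ⟨ i , j ⟩                           ≡⟨ trans (⊕-entry (A ⊕ B) C i j) (cong (_+ C ⟨ i , j ⟩) (⊕-entry A B i j)) ⟩
    A ⟨ i , j ⟩ + B ⟨ i , j ⟩ + C ⟨ i , j ⟩           ≡⟨ +-assoc (A ⟨ i , j ⟩) _ _ ⟩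
    A ⟨ i , j ⟩ + (B ⟨ i , j ⟩ + C ⟨ i , j ⟩)         ≡⟨ trans (⊕-entry A (B ⊕ C) i j) (cong (A ⟨ i , j ⟩ +_) (⊕-entry B C i j)) ⟨
    (A ⊕ (B ⊕ C)) ⟨ i , j ⟩                           ∎
    where open ≡-Reasoning

  ⊕-comm : ∀ {m n} (A B : Mat m n) → A ⊕ B ≡ B ⊕ A
  ⊕-comm A B = Mat-ext λ i j →
    trans (⊕-entry A B i j) (trans (+-comm (A ⟨ i , j ⟩) _) (sym (⊕-entry B A i j)))

  tr-ᵀ : ∀ {n} (A : Mat n n) → tr (A ᵀ) ≡ tr A
  tr-ᵀ A = trans (tr-def (A ᵀ)) (trans (∑-cong λ i → ᵀ-entry A i i) (sym (tr-def A)))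

  tr-⊕ : ∀ {n} (A B : Mat n n) → tr (A ⊕ B) ≡ tr A + tr B
  tr-⊕ A B = trans (tr-def (A ⊕ B)) (trans (∑-cong λ i → ⊕-entry A B i i)
    (trans (∑-+ (λ i → A ⟨ i , i ⟩) _) (sym (cong₂ _+_ (tr-def A) (tr-def B)))))

  tr-⊙ : ∀ {n} c (A : Mat n n) → tr (c ⊙ A) ≡ c * tr A
  tr-⊙ c A = trans (tr-def (c ⊙ A)) (trans (∑-cong λ i → ⊙-entry c A i i)
    (trans (sym (*-∑ c _)) (cong (c *_) (sym (tr-def A)))))

  tr-·-comm : ∀ {m n} (A : Mat m n) (B : Mat n m) → tr (A · B) ≡ tr (B · A)
  tr-·-comm A B = begin
    tr (A · B)
      ≡⟨ trans (tr-def (A · B)) (∑-cong λ i → ·-entry A B i i) ⟩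
    ∑ (λ i → ∑ λ l → A ⟨ i , l ⟩ * B ⟨ l , i ⟩)
      ≡⟨ ∑-swap _ ⟩
    ∑ (λ l → ∑ λ i → A ⟨ i , l ⟩ * B ⟨ l , i ⟩)
      ≡⟨ ∑-cong (λ l → ∑-cong λ i → *-comm (A ⟨ i , l ⟩) _) ⟩
    ∑ (λ l → ∑ λ i → B ⟨ l , i ⟩ * A ⟨ i , l ⟩)
      ≡⟨ trans (tr-def (B · A)) (∑-cong λ i → ·-entry B A i i) ⟨
    tr (B · A) ∎
    where open ≡-Reasoning

  -- The squared Frobenius norm. With rectangular arguments, `‖ A · X ‖²` evaluates the quadratic
  -- form `AᵀA` at all columns of X at once, so operator inequalities can be stated as inequalities
  -- for every X.
  ‖_‖² : ∀ {m n} → Mat m n → ℚ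
  ‖ A ‖² = tr (A ᵀ · A)

  ‖‖²-entries : ∀ {m n} (A : Mat m n) → ‖ A ‖² ≡ ∑ λ j → ∑ λ i → A ⟨ i , j ⟩ * A ⟨ i , j ⟩
  ‖‖²-entries A = trans (tr-def (A ᵀ · A)) (∑-cong λ j →
    trans (·-entry (A ᵀ) A j j) (∑-cong λ i → cong (_* A ⟨ i , j ⟩) (ᵀ-entry A j i)))

  0≤‖‖² : ∀ {m n} (A : Mat m n) → 0ℚ ≤ ‖ A ‖²
  0≤‖‖² A = subst (0ℚ ≤_) (sym (‖‖²-entries A)) (0≤∑ λ j → 0≤∑ λ i → 0≤p² (A ⟨ i , j ⟩))

  -- Gram matrices of stacked rows and the inversion of `𝟙 ⊕ YᵀY`

  opaque
    unfolding ∑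

    ∑-empty : (f : Fin 0 → ℚ) → ∑ f ≡ 0ℚ
    ∑-empty f = refl

    ∑-++ : ∀ {a} {X : Set a} {m n} (h : X → ℚ) (xs : Vec X m) (ys : Vec X n) →
           ∑ (λ l → h (lookup (xs ++ ys) l)) ≡ ∑ (λ l → h (lookup xs l)) + ∑ (λ l → h (lookup ys l))
    ∑-++ h []       ys = sym (+-identityˡ _)
    ∑-++ h (x ∷ xs) ys = trans (cong (h x +_) (∑-++ h xs ys)) (sym (+-assoc (h x) _ _))

  gram-entry : ∀ {m n} (A : Mat m n) i j →
               (A ᵀ · A) ⟨ i , j ⟩ ≡ ∑ λ l → A ⟨ l , i ⟩ * A ⟨ l , j ⟩
  gram-entry A i j = trans (·-entry (A ᵀ) A i j) (∑-cong λ l → cong (_* A ⟨ l , j ⟩) (ᵀ-entry A i l))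

  -- Stacking turns a sum of Gram matrices into a single Gram matrix. This is how the form P is kept
  -- as `Yᵀ · Y`, with its positivity visible.
  gram-++ : ∀ {a c n} (A : Mat a n) (C : Mat c n) → (A ++ C) ᵀ · (A ++ C) ≡ A ᵀ · A ⊕ C ᵀ · C
  gram-++ A C = Mat-ext λ i j → begin
    ((A ++ C) ᵀ · (A ++ C)) ⟨ i , j ⟩
      ≡⟨ gram-entry (A ++ C) i j ⟩
    ∑ (λ l → (A ++ C) ⟨ l , i ⟩ * (A ++ C) ⟨ l , j ⟩)
      ≡⟨ ∑-++ (λ r → lookup r i * lookup r j) A C ⟩
    ∑ (λ l → A ⟨ l , i ⟩ * A ⟨ l , j ⟩) + ∑ (λ l → C ⟨ l , i ⟩ * C ⟨ l , j ⟩)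
      ≡⟨ cong₂ _+_ (gram-entry A i j) (gram-entry C i j) ⟨
    (A ᵀ · A) ⟨ i , j ⟩ + (C ᵀ · C) ⟨ i , j ⟩
      ≡⟨ ⊕-entry (A ᵀ · A) (C ᵀ · C) i j ⟨
    (A ᵀ · A ⊕ C ᵀ · C) ⟨ i , j ⟩ ∎
    where open ≡-Reasoning

  gram-[] : ∀ {n} → [] ᵀ · [] ≡ 𝟘 {n} {n}
  gram-[] = Mat-ext λ i j → trans (gram-entry [] i j)
    (trans (∑-empty _) (sym (mat-entry (λ _ _ → 0ℚ) i j)))

  gram-· : ∀ {m k n} (Y : Mat m k) (B : Mat k n) → (Y · B) ᵀ · (Y · B) ≡ B ᵀ · (Y ᵀ · Y) · B
  gram-· Y B = begin
    (Y · B) ᵀ · (Y · B)         ≡⟨ cong (_· (Y · B)) (ᵀ-· Y B) ⟩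
    B ᵀ · Y ᵀ · (Y · B)         ≡⟨ ·-assoc (B ᵀ) (Y ᵀ) (Y · B) ⟩
    B ᵀ · (Y ᵀ · (Y · B))       ≡⟨ cong (B ᵀ ·_) (·-assoc (Y ᵀ) Y B) ⟨
    B ᵀ · (Y ᵀ · Y · B)         ≡⟨ ·-assoc (B ᵀ) (Y ᵀ · Y) B ⟨
    B ᵀ · (Y ᵀ · Y) · B         ∎
    where open ≡-Reasoning

  gram-sym : ∀ {m n} (Y : Mat m n) → (Y ᵀ · Y) ᵀ ≡ Y ᵀ · Y
  gram-sym Y = trans (ᵀ-· (Y ᵀ) Y) (cong (Y ᵀ ·_) (ᵀ-involutive Y))

  ⊕-identityʳ : ∀ {m n} (A : Mat m n) → A ⊕ 𝟘 ≡ A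
  ⊕-identityʳ A = Mat-ext λ i j → trans (⊕-entry A 𝟘 i j)
    (trans (cong (A ⟨ i , j ⟩ +_) (mat-entry (λ _ _ → 0ℚ) i j)) (+-identityʳ _))

  scalar-sandwich : ∀ {m n} (A : Mat m 1) (S : Mat 1 1) (C : Mat 1 n) →
                    A · (S · C) ≡ S ⟨ zero , zero ⟩ ⊙ (A · C)
  scalar-sandwich A S C = begin
    A · (S · C)             ≡⟨ cong (λ S → A · (S · C)) S≡s𝟙 ⟩
    A · ((s ⊙ 𝟙) · C)       ≡⟨ cong (A ·_) (trans (⊙-·ˡ s 𝟙 C) (cong (s ⊙_) (·-identityˡ C))) ⟩
    A · (s ⊙ C)             ≡⟨ ⊙-·ʳ s A C ⟩
    s ⊙ (A · C)             ∎
    where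
    open ≡-Reasoning
    s = S ⟨ zero , zero ⟩
    S≡s𝟙 : S ≡ s ⊙ 𝟙
    S≡s𝟙 = Mat-ext λ { zero zero → sym (trans (⊙-entry s 𝟙 zero zero)
      (trans (cong (s *_) (trans (mat-entry δ zero zero) (δ-refl {1} zero))) (*-identityʳ s))) }

  tr-1×1 : (S : Mat 1 1) → tr S ≡ S ⟨ zero , zero ⟩
  tr-1×1 S = trans (tr-def S) (trans (∑-suc (λ i → S ⟨ i , i ⟩))
    (trans (cong (S ⟨ zero , zero ⟩ +_) (∑-empty _)) (+-identityʳ _)))

  tr-form : ∀ {N n m} (Y : Mat N n) (X : Mat n m) →
            tr (X ᵀ · ((𝟙 ⊕ Y ᵀ · Y) · X)) ≡ ‖ X ‖² + ‖ Y · X ‖²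
  tr-form Y X = begin
    tr (X ᵀ · ((𝟙 ⊕ Y ᵀ · Y) · X))
      ≡⟨ cong (λ Z → tr (X ᵀ · Z)) (trans (·-distribʳ-⊕ 𝟙 (Y ᵀ · Y) X) (cong₂ _⊕_ (·-identityˡ X) (·-assoc (Y ᵀ) Y X))) ⟩
    tr (X ᵀ · (X ⊕ Y ᵀ · (Y · X)))
      ≡⟨ trans (cong tr (·-distribˡ-⊕ (X ᵀ) X _)) (tr-⊕ _ _) ⟩
    ‖ X ‖² + tr (X ᵀ · (Y ᵀ · (Y · X)))
      ≡⟨ cong (λ Z → ‖ X ‖² + tr Z) (trans (sym (·-assoc (X ᵀ) (Y ᵀ) (Y · X))) (cong (_· (Y · X)) (sym (ᵀ-· Y X)))) ⟩
    ‖ X ‖² + ‖ Y · X ‖² ∎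
    where open ≡-Reasoning

  -- Sherman–Morrison, adding the rows of Y one at a time.
  inverse : ∀ {N n} (Y : Mat N n) → ∃[ Q ] ((𝟙 ⊕ Y ᵀ · Y) · Q ≡ 𝟙 × Q ᵀ ≡ Q)
  inverse [] = 𝟙 , trans (·-identityʳ _) (trans (cong (𝟙 ⊕_) gram-[]) (⊕-identityʳ 𝟙)) , 𝟙ᵀ
  inverse {suc N} {n} (y ∷ Y) with inverse Y
  ... | Q , PQ≡𝟙 , Qᵀ≡Q = Q′ , inverts , symmetric
    where
    open ≡-Reasoning
    P : Mat n n
    P = 𝟙 ⊕ Y ᵀ · Y
    r : Mat 1 n
    r = y ∷ []
    u : Mat n 1
    u = Q · r ᵀ
    s c : ℚ
    s = (r · u) ⟨ zero , zero ⟩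
    Pu≡rᵀ : P · u ≡ r ᵀ
    Pu≡rᵀ = trans (sym (·-assoc P Q (r ᵀ))) (trans (cong (_· r ᵀ) PQ≡𝟙) (·-identityˡ (r ᵀ)))
    Pᵀ≡P : P ᵀ ≡ P
    Pᵀ≡P = trans (ᵀ-⊕ 𝟙 (Y ᵀ · Y)) (cong₂ _⊕_ 𝟙ᵀ (gram-sym Y))
    uᵀP≡r : u ᵀ · P ≡ r
    uᵀP≡r = ᵀ-injective (trans (ᵀ-· (u ᵀ) P) (trans (cong₂ _·_ Pᵀ≡P (ᵀ-involutive u)) Pu≡rᵀ))
    -- Since `r = uᵀP`, the scalar `s = r · u` is the positive form P evaluated at u. Hence the
    -- Sherman-Morrison denominator `1ℚ + s` is positive.
    s≡ : s ≡ ‖ u ‖² + ‖ Y · u ‖²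
    s≡ = begin
      s                      ≡⟨ tr-1×1 (r · u) ⟨
      tr (r · u)             ≡⟨ cong (λ r → tr (r · u)) uᵀP≡r ⟨
      tr (u ᵀ · P · u)       ≡⟨ cong tr (·-assoc (u ᵀ) P u) ⟩
      tr (u ᵀ · (P · u))     ≡⟨ tr-form Y u ⟩
      ‖ u ‖² + ‖ Y · u ‖²    ∎
    0<1+s : 0ℚ < 1ℚ + s
    0<1+s = +-mono-<-≤ 0<1 (subst (0ℚ ≤_) (sym s≡) (0≤p+q (0≤‖‖² u) (0≤‖‖² (Y · u))))
    c = - inv 0<1+s
    Q′ : Mat n n
    Q′ = Q ⊕ c ⊙ (u · u ᵀ)
    rQ≡uᵀ : r · Q ≡ u ᵀ
    rQ≡uᵀ = sym (trans (ᵀ-· Q (r ᵀ)) (cong₂ _·_ (ᵀ-involutive r) Qᵀ≡Q))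
    W : Mat n n
    W = r ᵀ · u ᵀ
    PQ′ : P · Q′ ≡ 𝟙 ⊕ c ⊙ W
    PQ′ = trans (·-distribˡ-⊕ P Q _) (cong₂ _⊕_ PQ≡𝟙
      (trans (⊙-·ʳ c P (u · u ᵀ)) (cong (c ⊙_) (trans (sym (·-assoc P u (u ᵀ))) (cong (_· u ᵀ) Pu≡rᵀ)))))
    rQ′ : r ᵀ · r · Q′ ≡ W ⊕ c ⊙ (s ⊙ W)
    rQ′ = begin
      r ᵀ · r · Q′
        ≡⟨ trans (·-assoc (r ᵀ) r Q′) (cong (r ᵀ ·_) (·-distribˡ-⊕ r Q _)) ⟩
      r ᵀ · (r · Q ⊕ r · (c ⊙ (u · u ᵀ)))
        ≡⟨ ·-distribˡ-⊕ (r ᵀ) (r · Q) _ ⟩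
      r ᵀ · (r · Q) ⊕ r ᵀ · (r · (c ⊙ (u · u ᵀ)))
        ≡⟨ cong₂ _⊕_ (cong (r ᵀ ·_) rQ≡uᵀ)
             (trans (cong (r ᵀ ·_) (⊙-·ʳ c r (u · u ᵀ))) (⊙-·ʳ c (r ᵀ) _)) ⟩
      W ⊕ c ⊙ (r ᵀ · (r · (u · u ᵀ)))
        ≡⟨ cong (λ Z → W ⊕ c ⊙ Z) (trans (cong (r ᵀ ·_) (sym (·-assoc r u (u ᵀ)))) (scalar-sandwich (r ᵀ) (r · u) (u ᵀ))) ⟩
      W ⊕ c ⊙ (s ⊙ W) ∎
    cancel : ∀ e w s c i → (1ℚ + s) * i ≡ 1ℚ → c ≡ - i → e + c * w + (w + c * (s * w)) ≡ e
    cancel e w s c i eq refl = trans (rearrange e w s i) (trans (cong (λ k → e + (1ℚ - k) * w) eq) (simp e w))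
      where
      rearrange : ∀ e w s i → e + - i * w + (w + - i * (s * w)) ≡ e + (1ℚ - (1ℚ + s) * i) * w
      rearrange = solve-∀ ℚ-ring
      simp : ∀ e w → e + (1ℚ - 1ℚ) * w ≡ e
      simp = solve-∀ ℚ-ring
    inverts : (𝟙 ⊕ (y ∷ Y) ᵀ · (y ∷ Y)) · Q′ ≡ 𝟙
    inverts = begin
      (𝟙 ⊕ (y ∷ Y) ᵀ · (y ∷ Y)) · Q′
        ≡⟨ cong (λ Z → (𝟙 ⊕ Z) · Q′) (trans (gram-++ r Y) (⊕-comm _ _)) ⟩
      (𝟙 ⊕ (Y ᵀ · Y ⊕ r ᵀ · r)) · Q′
        ≡⟨ cong (_· Q′) (sym (⊕-assoc 𝟙 (Y ᵀ · Y) (r ᵀ · r))) ⟩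
      (P ⊕ r ᵀ · r) · Q′
        ≡⟨ trans (·-distribʳ-⊕ P (r ᵀ · r) Q′) (cong₂ _⊕_ PQ′ rQ′) ⟩
      (𝟙 ⊕ c ⊙ W) ⊕ (W ⊕ c ⊙ (s ⊙ W))
        ≡⟨ Mat-ext (λ i j → trans
             (trans (⊕-entry _ _ i j) (cong₂ _+_
               (trans (⊕-entry _ _ i j) (cong (𝟙 ⟨ i , j ⟩ +_) (⊙-entry c W i j)))
               (trans (⊕-entry _ _ i j) (cong (W ⟨ i , j ⟩ +_)
                 (trans (⊙-entry c _ i j) (cong (c *_) (⊙-entry s W i j)))))))
             (cancel (𝟙 ⟨ i , j ⟩) (W ⟨ i , j ⟩) s c (inv 0<1+s) (*-inv 0<1+s) refl)) ⟩
      𝟙 ∎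
    symmetric : Q′ ᵀ ≡ Q′
    symmetric = trans (ᵀ-⊕ Q _) (cong₂ _⊕_ Qᵀ≡Q (trans (ᵀ-⊙ c (u · u ᵀ))
      (cong (c ⊙_) (trans (ᵀ-· u (u ᵀ)) (cong (_· u ᵀ) (ᵀ-involutive u))))))

  -- Orbits of a matrix: truncated Stein and Lyapunov equations

  ⊕-interchange : ∀ {m n} (A B C D : Mat m n) → (A ⊕ B) ⊕ (C ⊕ D) ≡ (A ⊕ C) ⊕ (B ⊕ D)
  ⊕-interchange A B C D = Mat-ext λ i j → begin
    ((A ⊕ B) ⊕ (C ⊕ D)) ⟨ i , j ⟩
      ≡⟨ trans (⊕-entry _ _ i j) (cong₂ _+_ (⊕-entry A B i j) (⊕-entry C D i j)) ⟩
    (A ⟨ i , j ⟩ + B ⟨ i , j ⟩) + (C ⟨ i , j ⟩ + D ⟨ i , j ⟩)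
      ≡⟨ lemma (A ⟨ i , j ⟩) (B ⟨ i , j ⟩) (C ⟨ i , j ⟩) (D ⟨ i , j ⟩) ⟩
    (A ⟨ i , j ⟩ + C ⟨ i , j ⟩) + (B ⟨ i , j ⟩ + D ⟨ i , j ⟩)
      ≡⟨ trans (⊕-entry _ _ i j) (cong₂ _+_ (⊕-entry A C i j) (⊕-entry B D i j)) ⟨
    ((A ⊕ C) ⊕ (B ⊕ D)) ⟨ i , j ⟩ ∎
    where
    open ≡-Reasoning
    lemma : ∀ a b c d → (a + b) + (c + d) ≡ (a + c) + (b + d)
    lemma = solve-∀ ℚ-ring

  ⊙-⊕ : ∀ {m n} c (A B : Mat m n) → c ⊙ (A ⊕ B) ≡ c ⊙ A ⊕ c ⊙ B
  ⊙-⊕ c A B = Mat-ext λ i j →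
    trans (trans (⊙-entry c _ i j) (trans (cong (c *_) (⊕-entry A B i j)) (*-distribˡ-+ c _ _)))
          (sym (trans (⊕-entry _ _ i j) (cong₂ _+_ (⊙-entry c A i j) (⊙-entry c B i j))))

  ⊙-𝟘 : ∀ {m n} c → c ⊙ 𝟘 ≡ 𝟘 {m} {n}
  ⊙-𝟘 c = Mat-ext λ i j → trans (⊙-entry c 𝟘 i j)
    (trans (cong (c *_) (mat-entry _ i j)) (trans (*-zeroʳ c) (sym (mat-entry _ i j))))

  𝟘-· : ∀ {m k n} (A : Mat k n) → 𝟘 {m} · A ≡ 𝟘
  𝟘-· A = Mat-ext λ i j → trans (·-entry 𝟘 A i j)
    (trans (∑-zero λ l → trans (cong (_* A ⟨ l , j ⟩) (mat-entry _ i l)) (*-zeroˡ (A ⟨ l , j ⟩))) (sym (mat-entry _ i j)))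

  ·-𝟘 : ∀ {m k n} (A : Mat m k) → A · 𝟘 {k} {n} ≡ 𝟘
  ·-𝟘 A = Mat-ext λ i j → trans (·-entry A 𝟘 i j)
    (trans (∑-zero λ l → trans (cong (A ⟨ i , l ⟩ *_) (mat-entry _ l j)) (*-zeroʳ (A ⟨ i , l ⟩))) (sym (mat-entry _ i j)))

  ^ᴹ-+ : ∀ {n} (A : Mat n n) a b → A ^ᴹ (b ℕ.+ a) ≡ A ^ᴹ a · A ^ᴹ b
  ^ᴹ-+ A a zero    = sym (·-identityʳ _)
  ^ᴹ-+ A a (suc b) = trans (cong (_· A) (^ᴹ-+ A a b)) (·-assoc _ _ _)

  -- The sign ε = ±1 gives both the upper and the lower bound on the Frobenius product.
  inner-bound : ∀ {m n} ε → ε * ε ≡ 1ℚ → (S T : Mat m n) →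
                2ℚ * (ε * tr (S ᵀ · T)) ≤ ‖ S ‖² + ‖ T ‖²
  inner-bound ε ε²≡1 S T = subst₂ _≤_ (sym lhs) (sym rhs)
    (∑-mono-≤ λ j → ∑-mono-≤ λ i → pointwise (S ⟨ i , j ⟩) (T ⟨ i , j ⟩))
    where
    open ≡-Reasoning
    pointwise : ∀ s t → 2ℚ * ε * (s * t) ≤ s * s + t * t
    pointwise s t = p+d≡q⇒p≤q (0≤p² (s - ε * t))
      (trans (expand s t ε) (trans (cong (λ k → s * s + k * (t * t)) ε²≡1) (cong (s * s +_) (*-identityˡ (t * t)))))
      where
      expand : ∀ s t ε → (1ℚ + 1ℚ) * ε * (s * t) + (s - ε * t) * (s - ε * t) ≡ s * s + ε * ε * (t * t)
      expand = solve-∀ ℚ-ring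
    lhs : 2ℚ * (ε * tr (S ᵀ · T)) ≡ ∑ λ j → ∑ λ i → 2ℚ * ε * (S ⟨ i , j ⟩ * T ⟨ i , j ⟩)
    lhs = begin
      2ℚ * (ε * tr (S ᵀ · T))
        ≡⟨ *-assoc 2ℚ ε _ ⟨
      2ℚ * ε * tr (S ᵀ · T)
        ≡⟨ cong (2ℚ * ε *_) (trans (tr-def (S ᵀ · T)) (∑-cong λ j →
             trans (·-entry (S ᵀ) T j j) (∑-cong λ i → cong (_* T ⟨ i , j ⟩) (ᵀ-entry S j i)))) ⟩
      2ℚ * ε * ∑ (λ j → ∑ λ i → S ⟨ i , j ⟩ * T ⟨ i , j ⟩)
        ≡⟨ trans (*-∑ (2ℚ * ε) _) (∑-cong λ j → *-∑ (2ℚ * ε) _) ⟩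
      ∑ (λ j → ∑ λ i → 2ℚ * ε * (S ⟨ i , j ⟩ * T ⟨ i , j ⟩)) ∎
    rhs : ‖ S ‖² + ‖ T ‖² ≡ ∑ λ j → ∑ λ i → S ⟨ i , j ⟩ * S ⟨ i , j ⟩ + T ⟨ i , j ⟩ * T ⟨ i , j ⟩
    rhs = begin
      ‖ S ‖² + ‖ T ‖²
        ≡⟨ cong₂ _+_ (‖‖²-entries S) (‖‖²-entries T) ⟩
      _ ≡⟨ ∑-+ (λ j → ∑ λ i → S ⟨ i , j ⟩ * S ⟨ i , j ⟩) (λ j → ∑ λ i → T ⟨ i , j ⟩ * T ⟨ i , j ⟩) ⟨
      _ ≡⟨ ∑-cong (λ j → ∑-+ (λ i → S ⟨ i , j ⟩ * S ⟨ i , j ⟩) (λ i → T ⟨ i , j ⟩ * T ⟨ i , j ⟩)) ⟨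
      _ ∎

  -- The observability matrix with row blocks F, FB, ..., FB^(K-1). Its Gram matrix is the sum of
  -- `(B^k)ᵀ Fᵀ F B^k` over k < K.
  orbit : ∀ {m n} → Mat m n → Mat n n → (K : ℕ) → Mat (K ℕ.* m) n
  orbit F B zero    = []
  orbit F B (suc K) = F ++ orbit F B K · B

  gram-orbit-suc : ∀ {m n} (F : Mat m n) (B : Mat n n) K → let Y = orbit F B in
    Y (suc K) ᵀ · Y (suc K) ≡ F ᵀ · F ⊕ B ᵀ · (Y K ᵀ · Y K) · B
  gram-orbit-suc F B K = trans (gram-++ F (orbit F B K · B)) (cong (F ᵀ · F ⊕_) (gram-· (orbit F B K) B))

  -- Both sides are the sum of `(B^k)ᵀ B^k` over k ≤ K, once with the first and once with the last
  -- term split off.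
  stein : ∀ {n} (B : Mat n n) K → let Y = orbit 𝟙 B K in
          𝟙 ᵀ · 𝟙 ⊕ (Y · B) ᵀ · (Y · B) ≡ Y ᵀ · Y ⊕ (B ^ᴹ K) ᵀ · B ^ᴹ K
  stein B zero = begin
    𝟙 ᵀ · 𝟙 ⊕ ([] · B) ᵀ · ([] · B)   ≡⟨ cong (λ Z → 𝟙 ᵀ · 𝟙 ⊕ Z ᵀ · Z) (Mat-ext {A = [] · B} {[]} λ ()) ⟩
    𝟙 ᵀ · 𝟙 ⊕ [] ᵀ · []               ≡⟨ ⊕-comm _ _ ⟩
    [] ᵀ · [] ⊕ 𝟙 ᵀ · 𝟙               ∎
    where open ≡-Reasoning
  stein B (suc K) = begin
    𝟙 ᵀ · 𝟙 ⊕ (Y′ · B) ᵀ · (Y′ · B)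
      ≡⟨ cong (𝟙 ᵀ · 𝟙 ⊕_) (trans (gram-· Y′ B) (cong (λ Z → B ᵀ · Z · B) (trans (gram-++ 𝟙 (Y · B)) (stein B K)))) ⟩
    𝟙 ᵀ · 𝟙 ⊕ B ᵀ · (Y ᵀ · Y ⊕ (B ^ᴹ K) ᵀ · B ^ᴹ K) · B
      ≡⟨ cong (𝟙 ᵀ · 𝟙 ⊕_) (trans (cong (_· B) (·-distribˡ-⊕ (B ᵀ) _ _)) (·-distribʳ-⊕ _ _ B)) ⟩
    𝟙 ᵀ · 𝟙 ⊕ (B ᵀ · (Y ᵀ · Y) · B ⊕ B ᵀ · ((B ^ᴹ K) ᵀ · B ^ᴹ K) · B)
      ≡⟨ ⊕-assoc _ _ _ ⟨
    𝟙 ᵀ · 𝟙 ⊕ B ᵀ · (Y ᵀ · Y) · B ⊕ B ᵀ · ((B ^ᴹ K) ᵀ · B ^ᴹ K) · B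
      ≡⟨ cong₂ _⊕_ (gram-orbit-suc 𝟙 B K) (gram-· (B ^ᴹ K) B) ⟨
    Y′ ᵀ · Y′ ⊕ (B ^ᴹ suc K) ᵀ · B ^ᴹ suc K ∎
    where
    open ≡-Reasoning
    Y  = orbit 𝟙 B K
    Y′ = orbit 𝟙 B (suc K)

  -- B commutes with B^k, so each summand `(B^k)ᵀ B^k` contributes `(B^k)ᵀ (B ⊕ Bᵀ) B^k`.
  -- Accretivity for the standard form thus passes to every truncated sum.
  lyapunov : ∀ {m n} (B : Mat n n) (e : Mat m n) c → B ⊕ B ᵀ ≡ c ⊙ (e ᵀ · e) → ∀ K →
             let Y = orbit 𝟙 B K ; V = orbit e B K in
             (Y ᵀ · Y) · B ⊕ B ᵀ · (Y ᵀ · Y) ≡ c ⊙ (V ᵀ · V)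
  lyapunov B e c eq zero = begin
    [] ᵀ · [] · B ⊕ B ᵀ · ([] ᵀ · [])     ≡⟨ cong (λ Z → Z · B ⊕ B ᵀ · Z) gram-[] ⟩
    𝟘 · B ⊕ B ᵀ · 𝟘                       ≡⟨ cong₂ _⊕_ (𝟘-· B) (·-𝟘 (B ᵀ)) ⟩
    𝟘 ⊕ 𝟘                                 ≡⟨ ⊕-identityʳ 𝟘 ⟩
    𝟘                                     ≡⟨ trans (cong (c ⊙_) gram-[]) (⊙-𝟘 c) ⟨
    c ⊙ ([] ᵀ · [])                       ∎
    where open ≡-Reasoning
  lyapunov {n = n} B e c eq (suc K) = begin
    Y′ ᵀ · Y′ · B ⊕ B ᵀ · (Y′ ᵀ · Y′)
      ≡⟨ cong (λ Z → Z · B ⊕ B ᵀ · Z) (trans (gram-orbit-suc 𝟙 B K) (cong (_⊕ B ᵀ · P · B) (trans (cong (_· 𝟙) 𝟙ᵀ) (·-identityʳ 𝟙)))) ⟩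
    (𝟙 ⊕ B ᵀ · P · B) · B ⊕ B ᵀ · (𝟙 ⊕ B ᵀ · P · B)
      ≡⟨ cong₂ _⊕_ (trans (·-distribʳ-⊕ 𝟙 _ B) (cong₂ _⊕_ (·-identityˡ B) left))
                   (trans (·-distribˡ-⊕ (B ᵀ) 𝟙 _) (cong₂ _⊕_ (·-identityʳ (B ᵀ)) right)) ⟩
    (B ⊕ B ᵀ · (P · B) · B) ⊕ (B ᵀ ⊕ B ᵀ · (B ᵀ · P) · B)
      ≡⟨ ⊕-interchange B _ (B ᵀ) _ ⟩
    (B ⊕ B ᵀ) ⊕ (B ᵀ · (P · B) · B ⊕ B ᵀ · (B ᵀ · P) · B)
      ≡⟨ cong₂ _⊕_ eq (trans (sym (·-distribʳ-⊕ _ _ B)) (cong (_· B) (trans (sym (·-distribˡ-⊕ (B ᵀ) _ _)) (cong (B ᵀ ·_) (lyapunov B e c eq K))))) ⟩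
    c ⊙ (e ᵀ · e) ⊕ B ᵀ · (c ⊙ (V ᵀ · V)) · B
      ≡⟨ cong (c ⊙ (e ᵀ · e) ⊕_) (trans (cong (_· B) (⊙-·ʳ c (B ᵀ) _)) (⊙-·ˡ c _ B)) ⟩
    c ⊙ (e ᵀ · e) ⊕ c ⊙ (B ᵀ · (V ᵀ · V) · B)
      ≡⟨ trans (cong (c ⊙_) (gram-orbit-suc e B K)) (⊙-⊕ c _ _) ⟨
    c ⊙ (V′ ᵀ · V′) ∎
    where
    open ≡-Reasoning
    Y′ = orbit 𝟙 B (suc K)
    V  = orbit e B K
    V′ = orbit e B (suc K)
    P : Mat n n
    P  = orbit 𝟙 B K ᵀ · orbit 𝟙 B K
    left : B ᵀ · P · B · B ≡ B ᵀ · (P · B) · B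
    left = cong (_· B) (·-assoc (B ᵀ) P B)
    right : B ᵀ · (B ᵀ · P · B) ≡ B ᵀ · (B ᵀ · P) · B
    right = sym (·-assoc (B ᵀ) (B ᵀ · P) B)

  -- Telescoping along antidiagonals and traces of powers

  0<2 : 0ℚ < 2ℚ
  0<2 = positive⁻¹ 2ℚ

  module _ (g : ℕ → ℕ → ℚ) (τ : ℚ)
           (upper : ∀ a b → g (suc a) b + g a (suc b) ≤ τ)
           (lower : ∀ a b → - τ ≤ g (suc a) b + g a (suc b)) where

    -- Two consecutive neighbour sums share their middle term. Subtracting the lower bound for one
    -- from the upper bound for the other cancels it, so a move by two positions costs 2τ.
    antidiagonal-even : ∀ m a b → g (m ℕ.+ m ℕ.+ a) b ≤ g a (m ℕ.+ m ℕ.+ b) + ι (m ℕ.+ m) * τ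
    antidiagonal-even zero a b = ≤-reflexive (sym (trans (cong (g a b +_) (*-zeroˡ τ)) (+-identityʳ _)))
    antidiagonal-even (suc m) a b = begin
      g (suc m ℕ.+ suc m ℕ.+ a) b
        ≡⟨ cong (λ k → g k b) (shift m a) ⟩
      g (suc (suc (m ℕ.+ m ℕ.+ a))) b
        ≤⟨ 0≤q-p⇒p≤q (subst (0ℚ ≤_) (rearr x y z τ) (0≤p+q (p≤q⇒0≤q-p (upper (suc k) b)) (p≤q⇒0≤q-p (lower k (suc b))))) ⟩
      g (m ℕ.+ m ℕ.+ a) (suc (suc b)) + (τ + τ)
        ≤⟨ +-monoˡ-≤ (τ + τ) (antidiagonal-even m a (suc (suc b))) ⟩
      g a (m ℕ.+ m ℕ.+ suc (suc b)) + ι (m ℕ.+ m) * τ + (τ + τ)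
        ≡⟨ cong (λ k → g a k + ι (m ℕ.+ m) * τ + (τ + τ)) (trans (ℕ.+-suc (m ℕ.+ m) (suc b)) (trans (cong suc (ℕ.+-suc (m ℕ.+ m) b)) (sym (shift m b)))) ⟩
      g a (suc m ℕ.+ suc m ℕ.+ b) + ι (m ℕ.+ m) * τ + (τ + τ)
        ≡⟨ collect (g a (suc m ℕ.+ suc m ℕ.+ b)) (ι (m ℕ.+ m)) τ ⟩
      g a (suc m ℕ.+ suc m ℕ.+ b) + ι (suc (suc (m ℕ.+ m))) * τ
        ≡⟨ cong (λ k → g a (suc m ℕ.+ suc m ℕ.+ b) + ι (suc k) * τ) (sym (ℕ.+-suc m m)) ⟩
      g a (suc m ℕ.+ suc m ℕ.+ b) + ι (suc m ℕ.+ suc m) * τ ∎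
      where
      open ≤-Reasoning
      k = m ℕ.+ m ℕ.+ a
      x = g (suc (suc k)) b
      y = g (suc k) (suc b)
      z = g k (suc (suc b))
      shift : ∀ m a → suc m ℕ.+ suc m ℕ.+ a ≡ suc (suc (m ℕ.+ m ℕ.+ a))
      shift m a = cong (λ k → suc (k ℕ.+ a)) (ℕ.+-suc m m)
      rearr : ∀ x y z τ → (τ - (x + y)) + ((y + z) - (- τ)) ≡ (z + (τ + τ)) - x
      rearr = solve-∀ ℚ-ring
      collect : ∀ w i τ → w + i * τ + (τ + τ) ≡ w + (1ℚ + (1ℚ + i)) * τ
      collect = solve-∀ ℚ-ring

    -- After an even number of steps one neighbour sum is left over, and it joins the two ends with
    -- a plus sign. This sign is what odd parity buys.
    antidiagonal-odd : ∀ m a → let q = suc (m ℕ.+ m) in g (q ℕ.+ a) 0 + g a q ≤ ι q * τ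
    antidiagonal-odd m a = begin
      g (suc (m ℕ.+ m ℕ.+ a)) 0 + z
        ≡⟨ cong (λ k → g k 0 + z) (sym (ℕ.+-suc (m ℕ.+ m) a)) ⟩
      g (m ℕ.+ m ℕ.+ suc a) 0 + z
        ≤⟨ +-monoˡ-≤ z (antidiagonal-even m (suc a) 0) ⟩
      g (suc a) (m ℕ.+ m ℕ.+ 0) + t * τ + z
        ≡⟨ cong (λ k → g (suc a) k + t * τ + z) (ℕ.+-identityʳ (m ℕ.+ m)) ⟩
      g (suc a) (m ℕ.+ m) + t * τ + z
        ≡⟨ rearr (g (suc a) (m ℕ.+ m)) t τ z ⟩
      (g (suc a) (m ℕ.+ m) + z) + t * τ
        ≤⟨ +-monoˡ-≤ (t * τ) (upper a (m ℕ.+ m)) ⟩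
      τ + t * τ
        ≡⟨ collect t τ ⟩
      ι (suc (m ℕ.+ m)) * τ ∎
      where
      open ≤-Reasoning
      z = g a (suc (m ℕ.+ m))
      t = ι (m ℕ.+ m)
      rearr : ∀ x t τ z → x + t * τ + z ≡ (x + z) + t * τ
      rearr = solve-∀ ℚ-ring
      collect : ∀ t τ → τ + t * τ ≡ (1ℚ + t) * τ
      collect = solve-∀ ℚ-ring

  -- The form P = YᵀY = Σ_{k≤K} (Bᵏ)ᵀBᵏ makes B contractive (stein) and accretive (lyapunov) at once.
  -- With Q = P⁻¹, the traces g(a,b) = tr (P Bᵃ Q (Bᵇ)ᵀ) satisfy g(a+1,b) + g(a,b+1) = c⟨Bᵃx, Bᵇx⟩_P,
  -- which is at most 2 tr B in absolute value.
  module Contraction {n m : ℕ} (B : Mat n n) (e : Mat m n) (c : ℚ) (0≤c : 0ℚ ≤ c)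
                     (hermitian : B ⊕ B ᵀ ≡ c ⊙ (e ᵀ · e)) (K : ℕ)
                     (contracts : ∀ {k} (X : Mat n k) → ‖ B ^ᴹ suc K · X ‖² ≤ ‖ X ‖²) where

    private
      Y = orbit 𝟙 B (suc K)
      V = orbit e B (suc K)

      P : Mat n n
      P = Y ᵀ · Y

      -- The k = 0 term of the sum supplies the identity that brings P into the shape treated by
      -- `inverse`.
      P≡ : P ≡ 𝟙 ⊕ (orbit 𝟙 B K · B) ᵀ · (orbit 𝟙 B K · B)
      P≡ = trans (gram-++ 𝟙 (orbit 𝟙 B K · B)) (cong (_⊕ (orbit 𝟙 B K · B) ᵀ · (orbit 𝟙 B K · B)) (trans (cong (_· 𝟙) 𝟙ᵀ) (·-identityʳ 𝟙)))

      Q : Mat n n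
      Q = proj₁ (inverse (orbit 𝟙 B K · B))

      Qᵀ≡Q : Q ᵀ ≡ Q
      Qᵀ≡Q = proj₂ (proj₂ (inverse (orbit 𝟙 B K · B)))

      PQ≡𝟙 : P · Q ≡ 𝟙
      PQ≡𝟙 = trans (cong (_· Q) P≡) (proj₁ (proj₂ (inverse (orbit 𝟙 B K · B))))

      QP≡𝟙 : Q · P ≡ 𝟙
      QP≡𝟙 = ᵀ-injective (trans (ᵀ-· Q P) (trans (cong₂ _·_ (gram-sym Y) Qᵀ≡Q) (trans PQ≡𝟙 (sym 𝟙ᵀ))))

      QP· : ∀ {k} (A : Mat n k) → Q · (P · A) ≡ A
      QP· A = trans (sym (·-assoc Q P A)) (trans (cong (_· A) QP≡𝟙) (·-identityˡ A))

      ·PQ : ∀ {k} (A : Mat k n) → A · P · Q ≡ A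
      ·PQ A = trans (·-assoc A P Q) (trans (cong (A ·_) PQ≡𝟙) (·-identityʳ A))

      X : Mat n (suc K ℕ.* m)
      X = Q · V ᵀ

      -- The Lyapunov identity multiplied by `Q = P⁻¹` on both sides. In this dual form the Gram
      -- matrix `X · Xᵀ` fits between the powers of B in `g`.
      covariance : B · Q ⊕ Q · B ᵀ ≡ c ⊙ (X · X ᵀ)
      covariance = begin
        B · Q ⊕ Q · B ᵀ
          ≡⟨ cong₂ _⊕_ (cong (_· Q) (QP· B)) (trans (cong (_· Q) (sym (·-assoc Q (B ᵀ) P))) (·PQ (Q · B ᵀ))) ⟨
        Q · (P · B) · Q ⊕ Q · (B ᵀ · P) · Q
          ≡⟨ trans (sym (·-distribʳ-⊕ _ _ Q)) (cong (_· Q) (sym (·-distribˡ-⊕ Q _ _))) ⟩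
        Q · (P · B ⊕ B ᵀ · P) · Q
          ≡⟨ cong (λ Z → Q · Z · Q) (lyapunov B e c hermitian (suc K)) ⟩
        Q · (c ⊙ (V ᵀ · V)) · Q
          ≡⟨ trans (cong (_· Q) (⊙-·ʳ c Q _)) (⊙-·ˡ c _ Q) ⟩
        c ⊙ (Q · (V ᵀ · V) · Q)
          ≡⟨ cong (c ⊙_) (trans (cong (_· Q) (sym (·-assoc Q (V ᵀ) V))) (·-assoc X V Q)) ⟩
        c ⊙ (X · (V · Q))
          ≡⟨ cong (λ Z → c ⊙ (X · Z)) (trans (ᵀ-· Q (V ᵀ)) (cong₂ _·_ (ᵀ-involutive V) Qᵀ≡Q)) ⟨
        c ⊙ (X · X ᵀ) ∎
        where open ≡-Reasoning

      g : ℕ → ℕ → ℚ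
      g a b = tr (P · B ^ᴹ a · Q · (B ^ᴹ b) ᵀ)

      ⟪_,_⟫ : ℕ → ℕ → ℚ
      ⟪ a , b ⟫ = tr ((Y · (B ^ᴹ b · X)) ᵀ · (Y · (B ^ᴹ a · X)))

      g-step : ∀ a b → g (suc a) b + g a (suc b) ≡ c * ⟪ a , b ⟫
      g-step a b = begin
        g (suc a) b + g a (suc b)
          ≡⟨ cong₂ (λ S T → tr S + tr T)
               (cong (_· Bᵇ ᵀ) (trans (cong (_· Q) (sym (·-assoc P Bᵃ B))) (·-assoc (P · Bᵃ) B Q)))
               (trans (cong (P · Bᵃ · Q ·_) (ᵀ-· Bᵇ B)) (trans (sym (·-assoc _ (B ᵀ) (Bᵇ ᵀ))) (cong (_· Bᵇ ᵀ) (·-assoc (P · Bᵃ) Q (B ᵀ))))) ⟩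
        tr (P · Bᵃ · (B · Q) · Bᵇ ᵀ) + tr (P · Bᵃ · (Q · B ᵀ) · Bᵇ ᵀ)
          ≡⟨ trans (sym (tr-⊕ _ _)) (cong tr (trans (sym (·-distribʳ-⊕ _ _ (Bᵇ ᵀ))) (cong (_· Bᵇ ᵀ) (sym (·-distribˡ-⊕ (P · Bᵃ) _ _))))) ⟩
        tr (P · Bᵃ · (B · Q ⊕ Q · B ᵀ) · Bᵇ ᵀ)
          ≡⟨ cong (λ Z → tr (P · Bᵃ · Z · Bᵇ ᵀ)) covariance ⟩
        tr (P · Bᵃ · (c ⊙ (X · X ᵀ)) · Bᵇ ᵀ)
          ≡⟨ trans (cong tr (trans (cong (_· Bᵇ ᵀ) (⊙-·ʳ c _ _)) (⊙-·ˡ c _ _))) (tr-⊙ c _) ⟩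
        c * tr (P · Bᵃ · (X · X ᵀ) · Bᵇ ᵀ)
          ≡⟨ cong (λ Z → c * tr Z) (trans (cong (_· Bᵇ ᵀ) (sym (·-assoc (P · Bᵃ) X (X ᵀ)))) (·-assoc _ (X ᵀ) (Bᵇ ᵀ))) ⟩
        c * tr (P · Bᵃ · X · (X ᵀ · Bᵇ ᵀ))
          ≡⟨ cong (c *_) (tr-·-comm _ (X ᵀ · Bᵇ ᵀ)) ⟩
        c * tr (X ᵀ · Bᵇ ᵀ · (P · Bᵃ · X))
          ≡⟨ cong₂ (λ S T → c * tr (S · T)) (sym (ᵀ-· Bᵇ X))
               (trans (·-assoc P Bᵃ X) (·-assoc (Y ᵀ) Y (Bᵃ · X))) ⟩
        c * tr ((Bᵇ · X) ᵀ · (Y ᵀ · (Y · (Bᵃ · X))))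
          ≡⟨ cong (λ Z → c * tr Z) (trans (sym (·-assoc _ (Y ᵀ) _)) (cong (_· (Y · (Bᵃ · X))) (sym (ᵀ-· Y (Bᵇ · X))))) ⟩
        c * ⟪ a , b ⟫ ∎
        where
        open ≡-Reasoning
        Bᵃ = B ^ᴹ a
        Bᵇ = B ^ᴹ b

      form : ∀ {k l} (A : Mat k n) (Z : Mat n l) → ‖ A · Z ‖² ≡ tr (Z ᵀ · (A ᵀ · A) · Z)
      form A Z = cong tr (gram-· A Z)

      form-⊕ : ∀ {l} (S T : Mat n n) (Z : Mat n l) →
               tr (Z ᵀ · (S ⊕ T) · Z) ≡ tr (Z ᵀ · S · Z) + tr (Z ᵀ · T · Z)
      form-⊕ S T Z = trans (cong tr (trans (cong (_· Z) (·-distribˡ-⊕ (Z ᵀ) S T)) (·-distribʳ-⊕ _ _ Z))) (tr-⊕ _ _)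

      -- By `stein`, passing from Z to `B · Z` loses the term `‖ Z ‖²` and gains the term
      -- `‖ B ^ᴹ suc K · Z ‖²`. The hypothesis `contracts` says that the gain is no larger, so the
      -- finite truncation already contracts exactly.
      contraction : ∀ {l} (Z : Mat n l) → ‖ Y · (B · Z) ‖² ≤ ‖ Y · Z ‖²
      contraction Z = 0≤q-p⇒p≤q (subst (0ℚ ≤_) (lemma ‖ Z ‖² ‖ Y · (B · Z) ‖² ‖ Y · Z ‖² ‖ B ^ᴹ suc K · Z ‖² balance) (p≤q⇒0≤q-p (contracts Z)))
        where
        open ≡-Reasoning
        balance : ‖ Z ‖² + ‖ Y · (B · Z) ‖² ≡ ‖ Y · Z ‖² + ‖ B ^ᴹ suc K · Z ‖²
        balance = begin
          ‖ Z ‖² + ‖ Y · (B · Z) ‖²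
            ≡⟨ cong₂ (λ S T → ‖ S ‖² + ‖ T ‖²) (sym (·-identityˡ Z)) (sym (·-assoc Y B Z)) ⟩
          ‖ 𝟙 · Z ‖² + ‖ Y · B · Z ‖²
            ≡⟨ cong₂ _+_ (form 𝟙 Z) (form (Y · B) Z) ⟩
          _ ≡⟨ form-⊕ (𝟙 ᵀ · 𝟙) _ Z ⟨
          tr (Z ᵀ · (𝟙 ᵀ · 𝟙 ⊕ (Y · B) ᵀ · (Y · B)) · Z)
            ≡⟨ cong (λ S → tr (Z ᵀ · S · Z)) (stein B (suc K)) ⟩
          tr (Z ᵀ · (Y ᵀ · Y ⊕ (B ^ᴹ suc K) ᵀ · B ^ᴹ suc K) · Z)
            ≡⟨ form-⊕ (Y ᵀ · Y) _ Z ⟩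
          _ ≡⟨ cong₂ _+_ (form Y Z) (form (B ^ᴹ suc K) Z) ⟨
          ‖ Y · Z ‖² + ‖ B ^ᴹ suc K · Z ‖² ∎
        lemma : ∀ z b y k → z + b ≡ y + k → z - k ≡ y - b
        lemma z b y k eq = trans (l₁ z b k) (trans (cong (λ t → t - b - k) eq) (l₂ y b k))
          where
          l₁ : ∀ z b k → z - k ≡ z + b - b - k
          l₁ = solve-∀ ℚ-ring
          l₂ : ∀ y b k → y + k - b - k ≡ y - b
          l₂ = solve-∀ ℚ-ring

      power-contraction : ∀ a {l} (Z : Mat n l) → ‖ Y · (B ^ᴹ a · Z) ‖² ≤ ‖ Y · Z ‖²
      power-contraction zero    Z = ≤-reflexive (cong (λ Z → ‖ Y · Z ‖²) (·-identityˡ Z))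
      power-contraction (suc a) Z = ≤-trans
        (≤-reflexive (cong (λ Z → ‖ Y · Z ‖²) (·-assoc (B ^ᴹ a) B Z)))
        (≤-trans (power-contraction a (B · Z)) (contraction Z))

      g-zeroʳ : ∀ a → g a 0 ≡ tr (B ^ᴹ a)
      g-zeroʳ a = begin
        tr (P · B ^ᴹ a · Q · 𝟙 ᵀ)    ≡⟨ cong tr (trans (cong (P · B ^ᴹ a · Q ·_) 𝟙ᵀ) (·-identityʳ _)) ⟩
        tr (P · B ^ᴹ a · Q)          ≡⟨ tr-·-comm _ Q ⟩
        tr (Q · (P · B ^ᴹ a))        ≡⟨ cong tr (QP· (B ^ᴹ a)) ⟩
        tr (B ^ᴹ a)                  ∎
        where open ≡-Reasoning

      g-zeroˡ : ∀ b → g 0 b ≡ tr (B ^ᴹ b)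
      g-zeroˡ b = begin
        tr (P · 𝟙 · Q · (B ^ᴹ b) ᵀ)  ≡⟨ cong (λ Z → tr (Z · Q · (B ^ᴹ b) ᵀ)) (·-identityʳ P) ⟩
        tr (P · Q · (B ^ᴹ b) ᵀ)      ≡⟨ cong tr (trans (cong (_· (B ^ᴹ b) ᵀ) PQ≡𝟙) (·-identityˡ _)) ⟩
        tr ((B ^ᴹ b) ᵀ)              ≡⟨ tr-ᵀ (B ^ᴹ b) ⟩
        tr (B ^ᴹ b)                  ∎
        where open ≡-Reasoning

      tr-B^1 : tr (B ^ᴹ 1) ≡ tr B
      tr-B^1 = cong tr (·-identityˡ B)

      -- The case a = b = 0 of `g-step`, where both values of `g` are `tr B`. It converts norm
      -- bounds into multiples of the trace.
      total : c * ‖ Y · X ‖² ≡ 2ℚ * tr B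
      total = begin
        c * ‖ Y · X ‖²        ≡⟨ cong (λ Z → c * ‖ Y · Z ‖²) (·-identityˡ X) ⟨
        c * ⟪ 0 , 0 ⟫         ≡⟨ g-step 0 0 ⟨
        g 1 0 + g 0 1         ≡⟨ cong₂ _+_ (trans (g-zeroʳ 1) tr-B^1) (trans (g-zeroˡ 1) tr-B^1) ⟩
        tr B + tr B           ≡⟨ lemma (tr B) ⟩
        2ℚ * tr B             ∎
        where
        open ≡-Reasoning
        lemma : ∀ t → t + t ≡ (1ℚ + 1ℚ) * t
        lemma = solve-∀ ℚ-ring

      -- The inner product of `B^a X` and `B^b X` for P is at most the mean of their squared norms.
      -- Powers of B do not increase these, and `total` evaluates what remains.
      signed-bound : ∀ ε → ε * ε ≡ 1ℚ → ∀ a b → ε * (g (suc a) b + g a (suc b)) ≤ 2ℚ * tr B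
      signed-bound ε ε²≡1 a b = *-cancelˡ-≤ 0<2 (begin
        2ℚ * (ε * (g (suc a) b + g a (suc b)))
          ≡⟨ cong (λ t → 2ℚ * (ε * t)) (g-step a b) ⟩
        2ℚ * (ε * (c * ⟪ a , b ⟫))
          ≡⟨ rearr ε c ⟪ a , b ⟫ ⟩
        c * (2ℚ * (ε * ⟪ a , b ⟫))
          ≤⟨ *-monoˡ-≤ 0≤c (inner-bound ε ε²≡1 (Y · (B ^ᴹ b · X)) (Y · (B ^ᴹ a · X))) ⟩
        c * (‖ Y · (B ^ᴹ b · X) ‖² + ‖ Y · (B ^ᴹ a · X) ‖²)
          ≤⟨ *-monoˡ-≤ 0≤c (+-mono-≤ (power-contraction b X) (power-contraction a X)) ⟩
        c * (‖ Y · X ‖² + ‖ Y · X ‖²)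
          ≡⟨ double c ‖ Y · X ‖² ⟩
        2ℚ * (c * ‖ Y · X ‖²)
          ≡⟨ cong (2ℚ *_) total ⟩
        2ℚ * (2ℚ * tr B) ∎)
        where
        open ≤-Reasoning
        rearr : ∀ ε c t → (1ℚ + 1ℚ) * (ε * (c * t)) ≡ c * ((1ℚ + 1ℚ) * (ε * t))
        rearr = solve-∀ ℚ-ring
        double : ∀ c t → c * (t + t) ≡ (1ℚ + 1ℚ) * (c * t)
        double = solve-∀ ℚ-ring

      upper : ∀ a b → g (suc a) b + g a (suc b) ≤ 2ℚ * tr B
      upper a b = subst (_≤ 2ℚ * tr B) (*-identityˡ _) (signed-bound 1ℚ refl a b)

      lower : ∀ a b → - (2ℚ * tr B) ≤ g (suc a) b + g a (suc b)
      lower a b = subst (- (2ℚ * tr B) ≤_) (lemma (g (suc a) b + g a (suc b)))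
        (neg-antimono-≤ (signed-bound (- 1ℚ) refl a b))
        where
        lemma : ∀ t → - (- 1ℚ * t) ≡ t
        lemma = solve-∀ ℚ-ring

      0≤trB : 0ℚ ≤ tr B
      0≤trB = *-cancelˡ-≤ 0<2 (subst₂ _≤_ (sym (*-zeroʳ 2ℚ)) total (0≤p*q 0≤c (0≤‖‖² (Y · X))))

      -- ‖Y(AQ − QAᵀ)Yᵀ‖² ≥ 0 for A = B^q.
      diagonal : ∀ q → tr (B ^ᴹ (q ℕ.+ q)) ≤ g q q
      diagonal q = *-cancelˡ-≤ 0<2 (0≤q-p⇒p≤q (subst (0ℚ ≤_) expand (0≤‖‖² (Y · D · Y ᵀ))))
        where
        open ≡-Reasoning
        A = B ^ᴹ q
        G = P · A · Q
        D F : Mat n n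
        D = A · Q ⊕ (- 1ℚ) ⊙ (Q · A ᵀ)
        F = G ⊕ (- 1ℚ) ⊙ A ᵀ
        AQᵀ : (A · Q) ᵀ ≡ Q · A ᵀ
        AQᵀ = trans (ᵀ-· A Q) (cong (_· A ᵀ) Qᵀ≡Q)
        Dᵀ≡ : D ᵀ ≡ (- 1ℚ) ⊙ D
        Dᵀ≡ = Mat-ext λ i j → let x = (A · Q) ⟨ j , i ⟩ ; x′ = (A · Q) ⟨ i , j ⟩ in begin
          (D ᵀ) ⟨ i , j ⟩             ≡⟨ trans (ᵀ-entry D i j) (entry j i) ⟩
          x + (- 1ℚ) * x′             ≡⟨ lemma x x′ ⟩
          (- 1ℚ) * (x′ + (- 1ℚ) * x)  ≡⟨ trans (⊙-entry (- 1ℚ) D i j) (cong (- 1ℚ *_) (entry i j)) ⟨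
          ((- 1ℚ) ⊙ D) ⟨ i , j ⟩      ∎
          where
          entry : ∀ i j → D ⟨ i , j ⟩ ≡ (A · Q) ⟨ i , j ⟩ + (- 1ℚ) * (A · Q) ⟨ j , i ⟩
          entry i j = trans (⊕-entry _ _ i j) (cong ((A · Q) ⟨ i , j ⟩ +_)
            (trans (⊙-entry _ _ i j) (cong (- 1ℚ *_) (trans (cong (_⟨ i , j ⟩) (sym AQᵀ)) (ᵀ-entry (A · Q) i j)))))
          lemma : ∀ x x′ → x + (- 1ℚ) * x′ ≡ (- 1ℚ) * (x′ + (- 1ℚ) * x)
          lemma = solve-∀ ℚ-ring
        PD≡F : P · D ≡ F
        PD≡F = trans (·-distribˡ-⊕ P _ _) (cong₂ _⊕_ (sym (·-assoc P A Q))
          (trans (⊙-·ʳ (- 1ℚ) P _) (cong ((- 1ℚ) ⊙_) (trans (sym (·-assoc P Q (A ᵀ))) (trans (cong (_· A ᵀ) PQ≡𝟙) (·-identityˡ _))))))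
        -- D is skew and `P · D = F`, so cyclicity of the trace turns the squared norm into minus
        -- the trace of a square. Expanding it leaves only `tr (A · A)` and `g q q`.
        norm : ‖ Y · D · Y ᵀ ‖² ≡ - tr (F · F)
        norm = begin
          tr ((Y · D · Y ᵀ) ᵀ · (Y · D · Y ᵀ))
            ≡⟨ cong (λ Z → tr (Z · (Y · D · Y ᵀ))) (trans (ᵀ-· (Y · D) (Y ᵀ)) (cong₂ _·_ (ᵀ-involutive Y) (ᵀ-· Y D))) ⟩
          tr (Y · (D ᵀ · Y ᵀ) · (Y · D · Y ᵀ))
            ≡⟨ cong tr (sym (·-assoc _ (Y · D) (Y ᵀ))) ⟩
          tr (Y · (D ᵀ · Y ᵀ) · (Y · D) · Y ᵀ)
            ≡⟨ tr-·-comm _ (Y ᵀ) ⟩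
          tr (Y ᵀ · (Y · (D ᵀ · Y ᵀ) · (Y · D)))
            ≡⟨ cong tr (trans (cong (Y ᵀ ·_) (trans (·-assoc Y _ _) (cong (Y ·_) (trans (·-assoc (D ᵀ) _ _)
                 (cong (D ᵀ ·_) (sym (·-assoc (Y ᵀ) Y D))))))) (sym (·-assoc (Y ᵀ) Y _))) ⟩
          tr (P · (D ᵀ · (P · D)))
            ≡⟨ cong₂ (λ S T → tr (P · (S · T))) Dᵀ≡ PD≡F ⟩
          tr (P · ((- 1ℚ) ⊙ D · F))
            ≡⟨ cong tr (trans (cong (P ·_) (⊙-·ˡ (- 1ℚ) D F)) (⊙-·ʳ (- 1ℚ) P _)) ⟩
          tr ((- 1ℚ) ⊙ (P · (D · F)))
            ≡⟨ cong (λ Z → tr ((- 1ℚ) ⊙ Z)) (trans (sym (·-assoc P D F)) (cong (_· F) PD≡F)) ⟩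
          tr ((- 1ℚ) ⊙ (F · F))
            ≡⟨ tr-⊙ (- 1ℚ) (F · F) ⟩
          - 1ℚ * tr (F · F)
            ≡⟨ lemma (tr (F · F)) ⟩
          - tr (F · F) ∎
          where
          lemma : ∀ t → - 1ℚ * t ≡ - t
          lemma = solve-∀ ℚ-ring
        trGG : tr (G · G) ≡ tr (A · A)
        trGG = begin
          tr (P · A · Q · (P · A · Q))   ≡⟨ cong tr (trans (·-assoc (P · A) Q _) (cong (P · A ·_) (trans (cong (Q ·_) (·-assoc P A Q)) (QP· (A · Q))))) ⟩
          tr (P · A · (A · Q))           ≡⟨ cong tr (trans (sym (·-assoc (P · A) A Q)) (cong (_· Q) (·-assoc P A A))) ⟩
          tr (P · (A · A) · Q)           ≡⟨ tr-·-comm _ Q ⟩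
          tr (Q · (P · (A · A)))         ≡⟨ cong tr (QP· (A · A)) ⟩
          tr (A · A)                     ∎
        trAᵀAᵀ : tr (A ᵀ · A ᵀ) ≡ tr (A · A)
        trAᵀAᵀ = trans (cong tr (sym (ᵀ-· A A))) (tr-ᵀ (A · A))
        trFF : tr (F · F) ≡ tr (A · A) + (- 1ℚ) * g q q + (- 1ℚ) * (g q q + (- 1ℚ) * tr (A · A))
        trFF = begin
          tr (F · F)
            ≡⟨ trans (cong tr (·-distribʳ-⊕ G _ F)) (tr-⊕ _ _) ⟩
          tr (G · F) + tr ((- 1ℚ) ⊙ A ᵀ · F)
            ≡⟨ cong₂ _+_ (right G) (trans (trans (cong tr (⊙-·ˡ (- 1ℚ) (A ᵀ) F)) (tr-⊙ _ _)) (cong (- 1ℚ *_) (right (A ᵀ)))) ⟩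
          tr (G · G) + (- 1ℚ) * g q q + (- 1ℚ) * (tr (A ᵀ · G) + (- 1ℚ) * tr (A ᵀ · A ᵀ))
            ≡⟨ cong₂ (λ x y → x + (- 1ℚ) * g q q + (- 1ℚ) * y) trGG (cong₂ (λ x y → x + (- 1ℚ) * y) (tr-·-comm (A ᵀ) G) trAᵀAᵀ) ⟩
          tr (A · A) + (- 1ℚ) * g q q + (- 1ℚ) * (g q q + (- 1ℚ) * tr (A · A)) ∎
          where
          right : ∀ Z → tr (Z · F) ≡ tr (Z · G) + (- 1ℚ) * tr (Z · A ᵀ)
          right Z = trans (cong tr (·-distribˡ-⊕ Z G _)) (trans (tr-⊕ _ _)
            (cong (tr (Z · G) +_) (trans (cong tr (⊙-·ʳ (- 1ℚ) Z (A ᵀ))) (tr-⊙ _ _))))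
        expand : ‖ Y · D · Y ᵀ ‖² ≡ 2ℚ * g q q - 2ℚ * tr (B ^ᴹ (q ℕ.+ q))
        expand = trans norm (trans (cong -_ trFF) (trans (lemma (g q q) (tr (A · A)))
          (cong (λ Z → 2ℚ * g q q - 2ℚ * tr Z) (sym (^ᴹ-+ B q q)))))
          where
          lemma : ∀ x t → - (t + (- 1ℚ) * x + (- 1ℚ) * (x + (- 1ℚ) * t)) ≡ (1ℚ + 1ℚ) * x - (1ℚ + 1ℚ) * t
          lemma = solve-∀ ℚ-ring

      halve : ∀ {x y t} k → x + y ≤ k * (2ℚ * t) → x ≤ y → x ≤ k * t
      halve {x} {y} {t} k x+y≤ x≤y = *-cancelˡ-≤ 0<2 (begin
        2ℚ * x           ≡⟨ double x ⟩
        x + x            ≤⟨ +-monoʳ-≤ x x≤y ⟩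
        x + y            ≤⟨ x+y≤ ⟩
        k * (2ℚ * t)     ≡⟨ rearr k t ⟩
        2ℚ * (k * t)     ∎)
        where
        open ≤-Reasoning
        double : ∀ x → (1ℚ + 1ℚ) * x ≡ x + x
        double = solve-∀ ℚ-ring
        rearr : ∀ k t → k * ((1ℚ + 1ℚ) * t) ≡ (1ℚ + 1ℚ) * (k * t)
        rearr = solve-∀ ℚ-ring

    -- The antidiagonal from (q,0) to (0,q) has an odd number of steps, and both of its ends carry
    -- the value `tr (B ^ᴹ q)`.
    tr-odd-power : ∀ m → let q = suc (m ℕ.+ m) in tr (B ^ᴹ q) ≤ ι q * tr B
    tr-odd-power m = halve (ι q) (subst₂ (λ x y → x + y ≤ ι q * (2ℚ * tr B))
      (trans (cong (λ k → g k 0) (ℕ.+-identityʳ q)) (g-zeroʳ q)) (g-zeroˡ q)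
      (antidiagonal-odd g _ upper lower m 0)) ≤-refl
      where q = suc (m ℕ.+ m)

    -- The whole antidiagonal has even length, so it is followed only halfway, from (2q,0) to (q,q),
    -- which is an odd number of steps. There `diagonal` replaces `g q q` by the smaller
    -- `tr (B ^ᴹ (q ℕ.+ q))`.
    tr-twice-odd-power : ∀ m → let q = suc (m ℕ.+ m) in tr (B ^ᴹ (q ℕ.+ q)) ≤ ι (q ℕ.+ q) * tr B
    tr-twice-odd-power m = ≤-trans
      (halve (ι q) (subst (λ x → x + g q q ≤ ι q * (2ℚ * tr B)) (g-zeroʳ (q ℕ.+ q))
        (antidiagonal-odd g _ upper lower m q)) (diagonal q))
      -- Half an antidiagonal gives the factor q; it is relaxed to 2q so that both cases read tr B^ℓ
      -- ≤ ℓ tr B.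
      (*-monoʳ-≤ 0≤trB (ι-mono (ℕ.m≤m+n q q)))
      where q = suc (m ℕ.+ m)

  -- Cauchy-Schwarz, Bernoulli and Archimedean estimates

  NotFourfold : ℕ → Set
  NotFourfold ℓ = ∃[ m ] (let q = suc (m ℕ.+ m) in (ℓ ≡ q ⊎ ℓ ≡ q ℕ.+ q))

  -- Cauchy-Schwarz against the constant vector, obtained by summing 2ab ≤ a² + b² over all pairs of
  -- entries.
  ∑²≤n∑² : ∀ {n} (y : Fin n → ℚ) → ∑ y * ∑ y ≤ ι n * ∑ (λ j → y j * y j)
  ∑²≤n∑² {n} y = *-cancelˡ-≤ 0<2 (subst₂ _≤_ (sym lhs) (sym rhs)
    (∑-mono-≤ λ i → ∑-mono-≤ λ j → am-gm (y i) (y j)))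
    where
    open ≡-Reasoning
    am-gm : ∀ a b → 2ℚ * (a * b) ≤ a * a + b * b
    am-gm a b = p+d≡q⇒p≤q (0≤p² (a - b)) (lemma a b)
      where
      lemma : ∀ a b → (1ℚ + 1ℚ) * (a * b) + (a - b) * (a - b) ≡ a * a + b * b
      lemma = solve-∀ ℚ-ring
    T = ∑ (λ j → y j * y j)
    lhs : 2ℚ * (∑ y * ∑ y) ≡ ∑ λ i → ∑ λ j → 2ℚ * (y i * y j)
    lhs = begin
      2ℚ * (∑ y * ∑ y)                          ≡⟨ cong (2ℚ *_) (trans (∑-* (∑ y) y) (∑-cong λ i → *-∑ (y i) y)) ⟩
      2ℚ * ∑ (λ i → ∑ λ j → y i * y j)          ≡⟨ trans (*-∑ 2ℚ _) (∑-cong λ i → *-∑ 2ℚ _) ⟩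
      ∑ (λ i → ∑ λ j → 2ℚ * (y i * y j))        ∎
    rhs : 2ℚ * (ι n * T) ≡ ∑ λ i → ∑ λ j → y i * y i + y j * y j
    rhs = begin
      2ℚ * (ι n * T)
        ≡⟨ double (ι n) T ⟩
      ι n * T + ι n * T
        ≡⟨ cong₂ _+_ (trans (*-∑ (ι n) _) (∑-cong λ i → sym (∑-const n (y i * y i)))) (sym (∑-const n T)) ⟩
      ∑ (λ i → ∑ {n} λ j → y i * y i) + ∑ {n} (λ i → ∑ λ j → y j * y j)
        ≡⟨ ∑-+ _ _ ⟨
      ∑ (λ i → ∑ {n} (λ j → y i * y i) + ∑ λ j → y j * y j)
        ≡⟨ ∑-cong (λ i → ∑-+ (λ j → y i * y i) (λ j → y j * y j)) ⟨
      ∑ (λ i → ∑ λ j → y i * y i + y j * y j) ∎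
      where
      double : ∀ n t → (1ℚ + 1ℚ) * (n * t) ≡ n * t + n * t
      double = solve-∀ ℚ-ring

  -- Entries of absolute value at most 1/n give a Frobenius norm, and hence an operator norm, of at
  -- most 1. The hypothesis is squared to stay free of absolute values and division.
  small-entries⇒contraction : ∀ {n k} (A : Mat (suc n) (suc n)) →
    (∀ i j → ι (suc n) * ι (suc n) * (A ⟨ i , j ⟩ * A ⟨ i , j ⟩) ≤ 1ℚ) →
    (X : Mat (suc n) k) → ‖ A · X ‖² ≤ ‖ X ‖²
  small-entries⇒contraction {n} A small X = begin
    ‖ A · X ‖²
      ≡⟨ ‖‖²-entries (A · X) ⟩
    ∑ (λ k → ∑ λ i → (A · X) ⟨ i , k ⟩ * (A · X) ⟨ i , k ⟩)
      ≤⟨ ∑-mono-≤ (λ k → ∑-mono-≤ λ i → ≤-trans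
           (≤-reflexive (cong₂ _*_ (·-entry A X i k) (·-entry A X i k)))
           (≤-trans (∑²≤n∑² (λ j → A ⟨ i , j ⟩ * X ⟨ j , k ⟩)) (≤-reflexive (*-∑ N _)))) ⟩
    ∑ (λ k → ∑ λ i → ∑ λ j → N * (A ⟨ i , j ⟩ * X ⟨ j , k ⟩ * (A ⟨ i , j ⟩ * X ⟨ j , k ⟩)))
      ≡⟨ ∑-cong (λ k → trans (∑-swap _) (∑-cong λ j → trans
           (∑-cong λ i → rearr N (A ⟨ i , j ⟩) (X ⟨ j , k ⟩)) (sym (∑-* (X ⟨ j , k ⟩ * X ⟨ j , k ⟩) _)))) ⟩
    ∑ (λ k → ∑ λ j → ∑ (λ i → N * (A ⟨ i , j ⟩ * A ⟨ i , j ⟩)) * (X ⟨ j , k ⟩ * X ⟨ j , k ⟩))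
      ≤⟨ ∑-mono-≤ (λ k → ∑-mono-≤ λ j → ≤-trans (*-monoʳ-≤ (0≤p² (X ⟨ j , k ⟩)) (column j)) (≤-reflexive (*-identityˡ _))) ⟩
    ∑ (λ k → ∑ λ j → X ⟨ j , k ⟩ * X ⟨ j , k ⟩)
      ≡⟨ ‖‖²-entries X ⟨
    ‖ X ‖² ∎
    where
    open ≤-Reasoning
    N = ι (suc n)
    rearr : ∀ N a x → N * (a * x * (a * x)) ≡ N * (a * a) * (x * x)
    rearr = solve-∀ ℚ-ring
    column : ∀ j → ∑ (λ i → N * (A ⟨ i , j ⟩ * A ⟨ i , j ⟩)) ≤ 1ℚ
    column j = *-cancelˡ-≤ (0<ι n) (begin
      N * ∑ (λ i → N * (A ⟨ i , j ⟩ * A ⟨ i , j ⟩))    ≡⟨ *-∑ N _ ⟩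
      ∑ (λ i → N * (N * (A ⟨ i , j ⟩ * A ⟨ i , j ⟩)))  ≤⟨ ∑-mono-≤ (λ i → ≤-trans (≤-reflexive (sym (*-assoc N N _))) (small i j)) ⟩
      ∑ {suc n} (λ _ → 1ℚ)                             ≡⟨ ∑-const (suc n) 1ℚ ⟩
      N * 1ℚ                                           ∎)

  sq-mono : ∀ {x y} → - y ≤ x → x ≤ y → x * x ≤ y * y
  sq-mono {x} {y} -y≤x x≤y = 0≤q-p⇒p≤q (subst (0ℚ ≤_) (lemma x y)
    (0≤p*q (p≤q⇒0≤q-p x≤y) (p≤q⇒0≤q-p -y≤x)))
    where
    lemma : ∀ x y → (y - x) * (x - (- y)) ≡ y * y - x * x
    lemma = solve-∀ ℚ-ring

  positive-minimum : ∀ {n} (f : Fin n → ℚ) → (∀ i → 0ℚ < f i) → ∃[ β ] (0ℚ < β × (∀ i → β ≤ f i))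
  positive-minimum {zero}  f 0<f = 1ℚ , 0<1 , λ ()
  positive-minimum {suc n} f 0<f with positive-minimum (λ i → f (suc i)) (λ i → 0<f (suc i))
  ... | β , 0<β , β≤ with ≤-total β (f zero)
  ...   | inj₁ β≤f₀ = β , 0<β , λ { zero → β≤f₀ ; (suc i) → β≤ i }
  ...   | inj₂ f₀≤β = f zero , 0<f zero , λ { zero → ≤-refl ; (suc i) → ≤-trans f₀≤β (β≤ i) }

  bernoulli : ∀ {x} → 0ℚ ≤ x → ∀ K → 1ℚ + ι K * x ≤ (1ℚ + x) ^ K
  bernoulli {x} 0≤x zero    = ≤-reflexive (trans (cong (1ℚ +_) (*-zeroˡ x)) (+-identityʳ 1ℚ))
  bernoulli {x} 0≤x (suc K) = ≤-trans
    (p+d≡q⇒p≤q (0≤p*q (0≤p*q (0≤ι K) 0≤x) 0≤x) (lemma x (ι K)))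
    (*-monoˡ-≤ (0≤p+q 0≤1 0≤x) (bernoulli 0≤x K))
    where
    lemma : ∀ x k → 1ℚ + (1ℚ + k) * x + k * x * x ≡ (1ℚ + x) * (1ℚ + k * x)
    lemma = solve-∀ ℚ-ring

  ι-+ : ∀ m n → ι (m ℕ.+ n) ≡ ι m + ι n
  ι-+ m n = ×-homo-+ 1ℚ m n

  ι-* : ∀ m n → ι (m ℕ.* n) ≡ ι m * ι n
  ι-* = ×1-homo-*

  ⊙-⊙ : ∀ {m n} c d (A : Mat m n) → c ⊙ (d ⊙ A) ≡ (c * d) ⊙ A
  ⊙-⊙ c d A = Mat-ext λ i j → trans (trans (⊙-entry c _ i j) (cong (c *_) (⊙-entry d A i j)))
    (trans (sym (*-assoc c d _)) (sym (⊙-entry (c * d) A i j)))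

  ⊙-^ᴹ : ∀ {n} c (A : Mat n n) k → (c ⊙ A) ^ᴹ k ≡ (c ^ k) ⊙ A ^ᴹ k
  ⊙-^ᴹ c A zero = Mat-ext λ i j → sym (trans (⊙-entry 1ℚ 𝟙 i j) (*-identityˡ _))
  ⊙-^ᴹ c A (suc k) = begin
    (c ⊙ A) ^ᴹ k · (c ⊙ A)          ≡⟨ cong (_· (c ⊙ A)) (⊙-^ᴹ c A k) ⟩
    ((c ^ k) ⊙ A ^ᴹ k) · (c ⊙ A)      ≡⟨ trans (⊙-·ʳ c _ A) (cong (c ⊙_) (⊙-·ˡ (c ^ k) (A ^ᴹ k) A)) ⟩
    c ⊙ ((c ^ k) ⊙ (A ^ᴹ k · A))      ≡⟨ ⊙-⊙ c (c ^ k) _ ⟩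
    (c ^ suc k) ⊙ A ^ᴹ suc k          ∎
    where open ≡-Reasoning

  ι≡/1 : ∀ n → ι n ≡ ℤ.+ n / 1
  ι≡/1 zero    = refl
  ι≡/1 (suc n) = begin
    1ℚ + ι n                                ≡⟨ cong (1ℚ +_) (trans (ι≡/1 n) (normalize-coprime n-coprime-1)) ⟩
    1ℚ + mkℚ (ℤ.+ n) 0 n-coprime-1            ≡⟨ cong (_/ 1) (cong (ℤ._+_ (ℤ.+ 1)) (ℤ.*-identityʳ (ℤ.+ n))) ⟩
    ℤ.+ suc n / 1                             ∎
    where
    open ≡-Reasoning
    n-coprime-1 = Coprime.sym (1-coprimeTo n)

  archimedean : ∀ p → ∃[ n ] (p ≤ ι n)
  -- The denominator is at least 1, so the absolute value of the numerator is already large enough.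
  archimedean p@(mkℚ z d _) = ℤ.∣ z ∣ , subst (p ≤_)
    (trans (sym (normalize-coprime z-coprime-1)) (sym (ι≡/1 ℤ.∣ z ∣)))
    (*≤* (ℤ.≤-trans (ℤ.≤-reflexive (ℤ.*-identityʳ z)) (ℤ.≤-trans (z≤∣z∣ z) (ℤ.≤-trans (ℤ.+≤+ (ℕ.m≤m*n ℤ.∣ z ∣ (suc d))) (ℤ.≤-reflexive (ℤ.pos-* ℤ.∣ z ∣ (suc d)))))))
    where
    z-coprime-1 = Coprime.sym (1-coprimeTo ℤ.∣ z ∣)
    z≤∣z∣ : ∀ z → z ℤ.≤ ℤ.+ ℤ.∣ z ∣
    z≤∣z∣ (ℤ.+ n)      = ℤ.≤-refl
    z≤∣z∣ ℤ.-[1+ n ] = ℤ.-≤+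

  -- Nonnegative matrices and deflation of the Perron eigenvector

  NonNeg : ∀ {m n} → Mat m n → Set
  NonNeg A = ∀ i j → 0ℚ ≤ A ⟨ i , j ⟩

  NonNeg-· : ∀ {m k n} {A : Mat m k} {B : Mat k n} → NonNeg A → NonNeg B → NonNeg (A · B)
  NonNeg-· {A = A} {B} 0≤A 0≤B i j =
    subst (0ℚ ≤_) (sym (·-entry A B i j)) (0≤∑ λ l → 0≤p*q (0≤A i l) (0≤B l j))

  opaque
    unfolding δ
    0≤δ : ∀ {n} (i j : Fin n) → 0ℚ ≤ δ i j
    0≤δ zero    zero    = 0≤1
    0≤δ zero    (suc j) = ≤-refl
    0≤δ (suc i) zero    = ≤-refl
    0≤δ (suc i) (suc j) = 0≤δ i j

  NonNeg-𝟙 : ∀ {n} → NonNeg (𝟙 {n})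
  NonNeg-𝟙 i j = subst (0ℚ ≤_) (sym (mat-entry δ i j)) (0≤δ i j)

  NonNeg-^ᴹ : ∀ {n} {A : Mat n n} → NonNeg A → ∀ k → NonNeg (A ^ᴹ k)
  NonNeg-^ᴹ 0≤A zero    = NonNeg-𝟙
  NonNeg-^ᴹ 0≤A (suc k) = NonNeg-· (NonNeg-^ᴹ 0≤A k) 0≤A

  scalar-entry : ∀ c → (c ⊙ 𝟙 {1}) ⟨ zero , zero ⟩ ≡ c
  scalar-entry c = trans (⊙-entry c 𝟙 zero zero)
    (trans (cong (c *_) (trans (mat-entry {1} {1} δ zero zero) (δ-refl {1} zero))) (*-identityʳ c))

  ∑-one : (f : Fin 1 → ℚ) → ∑ f ≡ f zero
  ∑-one f = trans (∑-suc f) (trans (cong (f zero +_) (∑-empty _)) (+-identityʳ _))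

  module Rayleigh {n : ℕ} (v : Fin (suc n) → ℚ) (0<v : ∀ i → 0ℚ < v i) where

    0≤v : ∀ i → 0ℚ ≤ v i
    0≤v i = <⇒≤ (0<v i)

    σ N : ℚ
    σ = ∑ v
    N = ∑ λ i → v i * v i

    0<σ : 0ℚ < σ
    0<σ = <-≤-trans (0<v zero) (term≤∑ 0≤v zero)

    0<N : 0ℚ < N
    0<N = <-≤-trans (0<p*q (0<v zero) (0<v zero)) (term≤∑ (λ i → 0≤p² (v i)) zero)

    -- If M + Mᵀ = 2J, the skew part drops out of vᵀMv, which equals vᵀJv = σ². Hence σ²/|v|² is the
    -- only possible eigenvalue for v, and it is rational as soon as v is.
    N⁻¹ ρ : ℚ
    N⁻¹ = inv 0<N
    ρ = σ * σ * N⁻¹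

    0<ρ : 0ℚ < ρ
    0<ρ = 0<p*q (0<p*q 0<σ 0<σ) (0<inv 0<N)

    0≤ρ : 0ℚ ≤ ρ
    0≤ρ = <⇒≤ 0<ρ

    ρN≡σ² : ρ * N ≡ σ * σ
    ρN≡σ² = *-inv-* (σ * σ) 0<N

    ρ≤n : ρ ≤ ι (suc n)
    ρ≤n = *-cancelʳ-≤ 0<N (subst (_≤ ι (suc n) * N) (sym ρN≡σ²) (∑²≤n∑² v))

    col : Mat (suc n) 1
    col = mat λ i _ → v i

  -- M − v wᵀ is the compression of M to the orthogonal complement of its eigenvector v.
  module Deflation {n : ℕ} (v : Fin (suc n) → ℚ) (0<v : ∀ i → 0ℚ < v i) (M : Mat (suc n) (suc n))
                   (0≤M : NonNeg M) (pairs : ∀ i j → M ⟨ i , j ⟩ + M ⟨ j , i ⟩ ≡ 2ℚ)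
                   (eigen : ∀ i → ∑ (λ j → M ⟨ i , j ⟩ * v j) ≡ Rayleigh.ρ v 0<v * v i) where

    open Rayleigh v 0<v

    private
      -- This is the row vᵀM/|v|², because vᵀM = 2σ(1,...,1) - (Mv)ᵀ and Mv = ρv. Hence B below is
      -- ΠM for the orthogonal projection Π off v, and Bv = 0 makes it equal to ΠMΠ.
      wᶠ : Fin (suc n) → ℚ
      wᶠ j = (2ℚ * σ - ρ * v j) * N⁻¹

      w : Mat 1 (suc n)
      w = mat λ _ j → wᶠ j

      -- The projection of the all-ones vector to the complement of v, so that 2eeᵀ is the
      -- compression of 2J.
      eᶠ : Fin (suc n) → ℚ
      eᶠ j = 1ℚ - σ * N⁻¹ * v j

      e : Mat 1 (suc n)
      e = mat λ _ j → eᶠ j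

      B : Mat (suc n) (suc n)
      B = M ⊕ (- 1ℚ) ⊙ (col · w)

      M·col : M · col ≡ ρ ⊙ col
      M·col = Mat-ext λ i j → begin
        (M · col) ⟨ i , j ⟩                    ≡⟨ ·-entry M col i j ⟩
        ∑ (λ l → M ⟨ i , l ⟩ * col ⟨ l , j ⟩)  ≡⟨ ∑-cong (λ l → cong (M ⟨ i , l ⟩ *_) (mat-entry (λ i _ → v i) l j)) ⟩
        ∑ (λ l → M ⟨ i , l ⟩ * v l)            ≡⟨ eigen i ⟩
        ρ * v i                                ≡⟨ trans (⊙-entry ρ col i j) (cong (ρ *_) (mat-entry (λ i _ → v i) i j)) ⟨
        (ρ ⊙ col) ⟨ i , j ⟩                    ∎
        where open ≡-Reasoning

      M^·col : ∀ k → M ^ᴹ k · col ≡ (ρ ^ k) ⊙ col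
      M^·col zero    = trans (·-identityˡ col) (Mat-ext λ i j → sym (trans (⊙-entry 1ℚ col i j) (*-identityˡ _)))
      M^·col (suc k) = begin
        M ^ᴹ k · M · col            ≡⟨ trans (·-assoc _ M col) (cong (M ^ᴹ k ·_) M·col) ⟩
        M ^ᴹ k · (ρ ⊙ col)          ≡⟨ trans (⊙-·ʳ ρ _ col) (cong (ρ ⊙_) (M^·col k)) ⟩
        ρ ⊙ ((ρ ^ k) ⊙ col)         ≡⟨ ⊙-⊙ ρ (ρ ^ k) col ⟩
        (ρ ^ suc k) ⊙ col           ∎
        where open ≡-Reasoning

      w·col : w · col ≡ ρ ⊙ 𝟙
      w·col = Mat-ext λ { zero zero → begin
        (w · col) ⟨ zero , zero ⟩
          ≡⟨ ·-entry w col zero zero ⟩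
        ∑ (λ l → w ⟨ zero , l ⟩ * col ⟨ l , zero ⟩)
          ≡⟨ ∑-cong (λ l → trans (cong₂ _*_ (mat-entry {1} (λ _ j → wᶠ j) zero l) (mat-entry {n = 1} (λ i _ → v i) l zero)) (expand σ ρ (v l) N⁻¹)) ⟩
        ∑ (λ l → N⁻¹ * (2ℚ * σ) * v l + - (N⁻¹ * ρ) * (v l * v l))
          ≡⟨ trans (∑-+ _ _) (sym (cong₂ _+_ (*-∑ (N⁻¹ * (2ℚ * σ)) v) (*-∑ (- (N⁻¹ * ρ)) (λ l → v l * v l)))) ⟩
        N⁻¹ * (2ℚ * σ) * σ + - (N⁻¹ * ρ) * N
          ≡⟨ collect σ ρ N N⁻¹ ⟩
        N⁻¹ * ((1ℚ + 1ℚ) * (σ * σ) - ρ * N)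
          ≡⟨ cong (λ t → N⁻¹ * ((1ℚ + 1ℚ) * (σ * σ) - t)) ρN≡σ² ⟩
        N⁻¹ * ((1ℚ + 1ℚ) * (σ * σ) - σ * σ)
          ≡⟨ final (σ * σ) N⁻¹ ⟩
        ρ
          ≡⟨ scalar-entry ρ ⟨
        (ρ ⊙ 𝟙) ⟨ zero , zero ⟩ ∎ }
        where
        open ≡-Reasoning
        expand : ∀ σ ρ x i → ((1ℚ + 1ℚ) * σ - ρ * x) * i * x ≡ i * ((1ℚ + 1ℚ) * σ) * x + - (i * ρ) * (x * x)
        expand = solve-∀ ℚ-ring
        collect : ∀ σ ρ N i → i * ((1ℚ + 1ℚ) * σ) * σ + - (i * ρ) * N ≡ i * ((1ℚ + 1ℚ) * (σ * σ) - ρ * N)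
        collect = solve-∀ ℚ-ring
        final : ∀ s i → i * ((1ℚ + 1ℚ) * s - s) ≡ s * i
        final = solve-∀ ℚ-ring

      wM^·col : ∀ k → w · M ^ᴹ k · col ≡ (ρ ^ suc k) ⊙ 𝟙
      wM^·col k = begin
        w · M ^ᴹ k · col          ≡⟨ trans (·-assoc w _ col) (cong (w ·_) (M^·col k)) ⟩
        w · ((ρ ^ k) ⊙ col)       ≡⟨ trans (⊙-·ʳ (ρ ^ k) w col) (cong ((ρ ^ k) ⊙_) w·col) ⟩
        (ρ ^ k) ⊙ (ρ ⊙ 𝟙)         ≡⟨ trans (⊙-⊙ (ρ ^ k) ρ 𝟙) (cong (_⊙ 𝟙) (*-comm (ρ ^ k) ρ)) ⟩
        (ρ ^ suc k) ⊙ 𝟙           ∎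
        where open ≡-Reasoning

      -- With Π the projection off v, ΠMv = 0 gives (ΠM)^k = ΠM^k: the corrections do not compound,
      -- and each power differs from that of M by rank one.
      B^ : ∀ k → B ^ᴹ suc k ≡ M ^ᴹ suc k ⊕ (- 1ℚ) ⊙ (col · (w · M ^ᴹ k))
      B^ zero = trans (·-identityˡ B) (cong₂ (λ S T → S ⊕ (- 1ℚ) ⊙ (col · T)) (sym (·-identityˡ M)) (sym (·-identityʳ w)))
      B^ (suc k) = begin
        B ^ᴹ suc k · B
          ≡⟨ cong (_· B) (B^ k) ⟩
        (Mᵏ ⊕ (- 1ℚ) ⊙ (col · wₖ)) · B
          ≡⟨ trans (·-distribʳ-⊕ Mᵏ _ B) (cong₂ _⊕_ left (trans (⊙-·ˡ (- 1ℚ) _ B) (cong ((- 1ℚ) ⊙_) right))) ⟩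
        (Mᵏ · M ⊕ (- 1ℚ) ⊙ (p ⊙ Z)) ⊕ (- 1ℚ) ⊙ (col · (wₖ · M) ⊕ (- 1ℚ) ⊙ (p ⊙ Z))
          ≡⟨ Mat-ext (λ i j → trans
               (trans (⊕-entry _ _ i j) (cong₂ _+_ (minus i j) (trans (⊙-entry _ _ i j) (cong (- 1ℚ *_) (minus i j)))))
               (trans (cancel ((Mᵏ · M) ⟨ i , j ⟩) ((col · (wₖ · M)) ⟨ i , j ⟩) ((p ⊙ Z) ⟨ i , j ⟩)) (sym (minus i j)))) ⟩
        Mᵏ · M ⊕ (- 1ℚ) ⊙ (col · (wₖ · M))
          ≡⟨ cong (λ T → Mᵏ · M ⊕ (- 1ℚ) ⊙ (col · T)) (·-assoc w (M ^ᴹ k) M) ⟩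
        Mᵏ · M ⊕ (- 1ℚ) ⊙ (col · (w · Mᵏ)) ∎
        where
        open ≡-Reasoning
        Mᵏ = M ^ᴹ suc k
        wₖ = w · M ^ᴹ k
        Z = col · w
        p = ρ ^ suc k
        minus : ∀ {m n} {S T : Mat m n} i j → (S ⊕ (- 1ℚ) ⊙ T) ⟨ i , j ⟩ ≡ S ⟨ i , j ⟩ + - 1ℚ * T ⟨ i , j ⟩
        minus {S = S} {T} i j = trans (⊕-entry S _ i j) (cong (S ⟨ i , j ⟩ +_) (⊙-entry _ T i j))
        cancel : ∀ x y z → x + - 1ℚ * z + - 1ℚ * (y + - 1ℚ * z) ≡ x + - 1ℚ * y
        cancel = solve-∀ ℚ-ring
        left : Mᵏ · B ≡ Mᵏ · M ⊕ (- 1ℚ) ⊙ (p ⊙ Z)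
        left = trans (·-distribˡ-⊕ Mᵏ M _) (cong (Mᵏ · M ⊕_) (trans (⊙-·ʳ (- 1ℚ) Mᵏ _) (cong ((- 1ℚ) ⊙_)
          (trans (sym (·-assoc Mᵏ col w)) (trans (cong (_· w) (M^·col (suc k))) (⊙-·ˡ p col w))))))
        right : col · wₖ · B ≡ col · (wₖ · M) ⊕ (- 1ℚ) ⊙ (p ⊙ Z)
        right = begin
          col · wₖ · B
            ≡⟨ trans (·-assoc col wₖ B) (cong (col ·_) (·-distribˡ-⊕ wₖ M _)) ⟩
          col · (wₖ · M ⊕ wₖ · ((- 1ℚ) ⊙ (col · w)))
            ≡⟨ trans (·-distribˡ-⊕ col _ _) (cong (λ T → col · (wₖ · M) ⊕ col · T) (⊙-·ʳ (- 1ℚ) wₖ (col · w))) ⟩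
          col · (wₖ · M) ⊕ col · ((- 1ℚ) ⊙ (wₖ · (col · w)))
            ≡⟨ cong (col · (wₖ · M) ⊕_) (trans (⊙-·ʳ (- 1ℚ) col _) (cong ((- 1ℚ) ⊙_) (begin
                 col · (wₖ · (col · w))    ≡⟨ cong (col ·_) (sym (·-assoc wₖ col w)) ⟩
                 col · (wₖ · col · w)      ≡⟨ cong (λ T → col · (T · w)) (wM^·col k) ⟩
                 col · (p ⊙ 𝟙 · w)         ≡⟨ cong (col ·_) (trans (⊙-·ˡ p 𝟙 w) (cong (p ⊙_) (·-identityˡ w))) ⟩
                 col · (p ⊙ w)             ≡⟨ ⊙-·ʳ p col w ⟩
                 p ⊙ Z                     ∎))) ⟩
          col · (wₖ · M) ⊕ (- 1ℚ) ⊙ (p ⊙ Z) ∎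

      -- By cyclicity the rank-one correction has trace wM^k v = ρ^(k+1), so deflation removes
      -- precisely the contribution of the eigenvalue ρ.
      tr-B^ : ∀ k → tr (B ^ᴹ suc k) ≡ tr (M ^ᴹ suc k) - ρ ^ suc k
      tr-B^ k = begin
        tr (B ^ᴹ suc k)
          ≡⟨ trans (cong tr (B^ k)) (trans (tr-⊕ _ _) (cong (tr (M ^ᴹ suc k) +_) (tr-⊙ (- 1ℚ) _))) ⟩
        tr (M ^ᴹ suc k) + - 1ℚ * tr (col · (w · M ^ᴹ k))
          ≡⟨ cong (λ t → tr (M ^ᴹ suc k) + - 1ℚ * t) (trans (tr-·-comm col _) (trans (cong tr (wM^·col k)) (tr-1×1 _))) ⟩
        tr (M ^ᴹ suc k) + - 1ℚ * ((ρ ^ suc k) ⊙ 𝟙) ⟨ zero , zero ⟩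
          ≡⟨ cong (λ t → tr (M ^ᴹ suc k) + - 1ℚ * t) (scalar-entry (ρ ^ suc k)) ⟩
        tr (M ^ᴹ suc k) + - 1ℚ * ρ ^ suc k
          ≡⟨ lemma (tr (M ^ᴹ suc k)) (ρ ^ suc k) ⟩
        tr (M ^ᴹ suc k) - ρ ^ suc k ∎
        where
        open ≡-Reasoning
        lemma : ∀ x y → x + - 1ℚ * y ≡ x - y
        lemma = solve-∀ ℚ-ring

      tr-M : tr M ≡ ι (suc n)
      tr-M = begin
        tr M                                ≡⟨ tr-def M ⟩
        ∑ (λ i → M ⟨ i , i ⟩)               ≡⟨ ∑-cong (λ i → half (M ⟨ i , i ⟩) (pairs i i)) ⟩
        ∑ {suc n} (λ i → 1ℚ)                ≡⟨ trans (∑-const (suc n) 1ℚ) (*-identityʳ _) ⟩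
        ι (suc n)                           ∎
        where
        open ≡-Reasoning
        half : ∀ x → x + x ≡ 2ℚ → x ≡ 1ℚ
        half x eq = trans (l x) (cong (½ *_) eq)
          where
          l : ∀ x → x ≡ ½ * (x + x)
          l x = sym (trans (cong (½ *_) (double x)) (trans (sym (*-assoc ½ 2ℚ x)) (*-identityˡ x)))
            where
            double : ∀ x → x + x ≡ (1ℚ + 1ℚ) * x
            double = solve-∀ ℚ-ring

      tr-B : tr B ≡ ι (suc n) - ρ
      tr-B = trans (cong tr (sym (·-identityˡ B))) (trans (tr-B^ 0)
        (cong₂ (λ x y → x - y) (trans (cong tr (·-identityˡ M)) tr-M) (*-identityʳ ρ)))

      0≤w : NonNeg w
      0≤w i j = subst (0ℚ ≤_) (sym (mat-entry {1} (λ _ j → wᶠ j) i j))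
        (0≤p*q (subst (0ℚ ≤_) column (0≤∑ λ l → 0≤p*q (0≤v l) (0≤M l j))) (0≤inv 0<N))
        where
        open ≡-Reasoning
        entry : ∀ l → v l * M ⟨ l , j ⟩ ≡ 2ℚ * v l + - 1ℚ * (M ⟨ j , l ⟩ * v l)
        entry l = trans (e₁ (v l) (M ⟨ l , j ⟩) (M ⟨ j , l ⟩)) (cong (λ t → t * v l + - 1ℚ * (M ⟨ j , l ⟩ * v l)) (pairs l j))
          where
          e₁ : ∀ x a b → x * a ≡ (a + b) * x + - 1ℚ * (b * x)
          e₁ = solve-∀ ℚ-ring
        column : ∑ (λ l → v l * M ⟨ l , j ⟩) ≡ 2ℚ * σ - ρ * v j
        column = begin
          ∑ (λ l → v l * M ⟨ l , j ⟩)
            ≡⟨ trans (∑-cong entry) (∑-+ _ _) ⟩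
          ∑ (λ l → 2ℚ * v l) + ∑ (λ l → - 1ℚ * (M ⟨ j , l ⟩ * v l))
            ≡⟨ cong₂ _+_ (*-∑ 2ℚ v) (*-∑ (- 1ℚ) _) ⟨
          2ℚ * σ + - 1ℚ * ∑ (λ l → M ⟨ j , l ⟩ * v l)
            ≡⟨ cong (λ t → 2ℚ * σ + - 1ℚ * t) (eigen j) ⟩
          2ℚ * σ + - 1ℚ * (ρ * v j)
            ≡⟨ e₂ (2ℚ * σ) (ρ * v j) ⟩
          2ℚ * σ - ρ * v j ∎
          where
          e₂ : ∀ x y → x + - 1ℚ * y ≡ x - y
          e₂ = solve-∀ ℚ-ring

      hermitian : B ⊕ B ᵀ ≡ 2ℚ ⊙ (e ᵀ · e)
      hermitian = Mat-ext λ i j → begin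
        (B ⊕ B ᵀ) ⟨ i , j ⟩
          ≡⟨ trans (⊕-entry B (B ᵀ) i j) (cong₂ _+_ (entryB i j) (trans (ᵀ-entry B i j) (entryB j i))) ⟩
        (M ⟨ i , j ⟩ + - 1ℚ * (v i * wᶠ j)) + (M ⟨ j , i ⟩ + - 1ℚ * (v j * wᶠ i))
          ≡⟨ expand (M ⟨ i , j ⟩) (M ⟨ j , i ⟩) (v i) (v j) σ ρ N⁻¹ ⟩
        (M ⟨ i , j ⟩ + M ⟨ j , i ⟩) - (1ℚ + 1ℚ) * (σ * N⁻¹ * (v i + v j)) + (1ℚ + 1ℚ) * (ρ * N⁻¹ * (v i * v j))
          ≡⟨ cong (λ t → t - (1ℚ + 1ℚ) * (σ * N⁻¹ * (v i + v j)) + (1ℚ + 1ℚ) * (ρ * N⁻¹ * (v i * v j))) (pairs i j) ⟩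
        (1ℚ + 1ℚ) - (1ℚ + 1ℚ) * (σ * N⁻¹ * (v i + v j)) + (1ℚ + 1ℚ) * (σ * σ * N⁻¹ * N⁻¹ * (v i * v j))
          ≡⟨ factor (v i) (v j) σ N⁻¹ ⟩
        2ℚ * (eᶠ i * eᶠ j)
          ≡⟨ trans (⊙-entry 2ℚ _ i j) (cong (2ℚ *_) (trans (gram-entry e i j) (trans (∑-one _)
               (cong₂ _*_ (mat-entry {1} (λ _ j → eᶠ j) zero i) (mat-entry {1} (λ _ j → eᶠ j) zero j))))) ⟨
        (2ℚ ⊙ (e ᵀ · e)) ⟨ i , j ⟩ ∎
        where
        open ≡-Reasoning
        entryB : ∀ i j → B ⟨ i , j ⟩ ≡ M ⟨ i , j ⟩ + - 1ℚ * (v i * wᶠ j)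
        entryB i j = trans (⊕-entry M _ i j) (cong (M ⟨ i , j ⟩ +_) (trans (⊙-entry _ _ i j) (cong (- 1ℚ *_)
          (trans (·-entry col w i j) (trans (∑-one _)
            (cong₂ _*_ (mat-entry {n = 1} (λ i _ → v i) i zero) (mat-entry {1} (λ _ j → wᶠ j) zero j)))))))
        expand : ∀ a b x y σ ρ i → (a + - 1ℚ * (x * (((1ℚ + 1ℚ) * σ - ρ * y) * i))) + (b + - 1ℚ * (y * (((1ℚ + 1ℚ) * σ - ρ * x) * i)))
               ≡ (a + b) - (1ℚ + 1ℚ) * (σ * i * (x + y)) + (1ℚ + 1ℚ) * (ρ * i * (x * y))
        expand = solve-∀ ℚ-ring
        factor : ∀ x y σ i → (1ℚ + 1ℚ) - (1ℚ + 1ℚ) * (σ * i * (x + y)) + (1ℚ + 1ℚ) * (σ * σ * i * i * (x * y))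
               ≡ (1ℚ + 1ℚ) * ((1ℚ - σ * i * x) * (1ℚ - σ * i * y))
        factor = solve-∀ ℚ-ring

      weighted≤ : ∀ {m} {A : Mat m (suc n)} → NonNeg A → ∀ i j → A ⟨ i , j ⟩ * v j ≤ (A · col) ⟨ i , zero ⟩
      weighted≤ {A = A} 0≤A i j = subst (A ⟨ i , j ⟩ * v j ≤_)
        (trans (∑-cong λ l → cong (A ⟨ i , l ⟩ *_) (sym (mat-entry {n = 1} (λ i _ → v i) l zero))) (sym (·-entry A col i zero)))
        (term≤∑ (λ l → 0≤p*q (0≤A i l) (0≤v l)) j)

      -- By `B^`, x is a difference of two numbers that both lie between 0 and y: a single
      -- nonnegative term of M^(k+1) v, or of wM^k v, is at most the whole sum, which the
      -- eigenvector equation evaluates.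
      entry-bound : ∀ k i j → let x = (B ^ᴹ suc k) ⟨ i , j ⟩ * v j ; y = ρ ^ suc k * v i in x * x ≤ y * y
      entry-bound k i j = subst (λ x → x * x ≤ y * y) (sym x≡) (sq-mono lo hi)
        where
        y = ρ ^ suc k * v i
        a = (M ^ᴹ suc k) ⟨ i , j ⟩ * v j
        b = (w · M ^ᴹ k) ⟨ zero , j ⟩ * v j
        0≤M^ = NonNeg-^ᴹ 0≤M
        0≤a : 0ℚ ≤ a
        0≤a = 0≤p*q (0≤M^ (suc k) i j) (0≤v j)
        0≤b : 0ℚ ≤ b
        0≤b = 0≤p*q (NonNeg-· 0≤w (0≤M^ k) zero j) (0≤v j)
        a≤y : a ≤ y
        a≤y = subst (a ≤_) (trans (cong (_⟨ i , zero ⟩) (M^·col (suc k))) (trans (⊙-entry _ col i zero) (cong (ρ ^ suc k *_) (mat-entry {n = 1} (λ i _ → v i) i zero))))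
          (weighted≤ (0≤M^ (suc k)) i j)
        b≤ : b ≤ ρ ^ suc k
        b≤ = subst (b ≤_) (trans (cong (_⟨ zero , zero ⟩) (wM^·col k)) (scalar-entry (ρ ^ suc k)))
          (weighted≤ (NonNeg-· 0≤w (0≤M^ k)) zero j)
        vb≤y : v i * b ≤ y
        vb≤y = ≤-trans (*-monoˡ-≤ (0≤v i) b≤) (≤-reflexive (*-comm (v i) _))
        x≡ : (B ^ᴹ suc k) ⟨ i , j ⟩ * v j ≡ a - v i * b
        x≡ = trans (cong (_* v j) (trans (cong (_⟨ i , j ⟩) (B^ k)) (trans (⊕-entry _ _ i j) (cong ((M ^ᴹ suc k) ⟨ i , j ⟩ +_)
               (trans (⊙-entry _ _ i j) (cong (- 1ℚ *_) (trans (·-entry col _ i j) (trans (∑-one _)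
                 (cong (_* (w · M ^ᴹ k) ⟨ zero , j ⟩) (mat-entry {n = 1} (λ i _ → v i) i zero))))))))))
             (lemma ((M ^ᴹ suc k) ⟨ i , j ⟩) (v i) ((w · M ^ᴹ k) ⟨ zero , j ⟩) (v j))
          where
          lemma : ∀ m x u y → (m + - 1ℚ * (x * u)) * y ≡ m * y - x * (u * y)
          lemma = solve-∀ ℚ-ring
        hi : a - v i * b ≤ y
        hi = ≤-trans (p+d≡q⇒p≤q (0≤p*q (0≤v i) 0≤b) (l a (v i * b))) a≤y
          where
          l : ∀ a b → a - b + b ≡ a
          l = solve-∀ ℚ-ring
        lo : - y ≤ a - v i * b
        lo = ≤-trans (neg-antimono-≤ vb≤y) (p+d≡q⇒p≤q 0≤a (l a (v i * b)))
          where
          l : ∀ a b → - b + a ≡ a - b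
          l = solve-∀ ℚ-ring

    module _ (ε : ℚ) (0<ε : 0ℚ < ε) where

      r : ℚ
      r = ρ * (1ℚ + ε)

      private
        0<1+ε : 0ℚ < 1ℚ + ε
        0<1+ε = +-mono-< 0<1 0<ε

        0<r : 0ℚ < r
        0<r = 0<p*q 0<ρ 0<1+ε

        s : ℚ
        s = inv 0<r

        β = proj₁ (positive-minimum v 0<v)
        0<β : 0ℚ < β
        0<β = proj₁ (proj₂ (positive-minimum v 0<v))
        β≤ : ∀ i → β ≤ v i
        β≤ = proj₂ (proj₂ (positive-minimum v 0<v))

        0<εβ : 0ℚ < ε * β
        0<εβ = 0<p*q 0<ε 0<β

        K : ℕ
        -- Bernoulli gives (1+ε)^(K+1) > Kε, and all entries of v lie between β and σ. Taking K at
        -- least nσ/(εβ) lets the geometric growth absorb both the factor n and the ratio of two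
        -- entries of v.
        K = proj₁ (archimedean (ι (suc n) * σ * inv 0<εβ))

        nσ≤Kεβ : ι (suc n) * σ ≤ ι K * (ε * β)
        nσ≤Kεβ = subst (_≤ ι K * (ε * β))
          (*-inv-* (ι (suc n) * σ) 0<εβ)
          (*-monoʳ-≤ (<⇒≤ 0<εβ) (proj₂ (archimedean (ι (suc n) * σ * inv 0<εβ))))

        growth : ∀ i j → ι (suc n) * v i ≤ (1ℚ + ε) ^ suc K * v j
        growth i j = begin
          ι (suc n) * v i                 ≤⟨ *-monoˡ-≤ (0≤ι (suc n)) (term≤∑ 0≤v i) ⟩
          ι (suc n) * σ                   ≤⟨ nσ≤Kεβ ⟩
          ι K * (ε * β)                   ≤⟨ *-monoʳ-≤ (<⇒≤ 0<εβ) (ι-mono (ℕ.n≤1+n K)) ⟩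
          ι (suc K) * (ε * β)             ≡⟨ *-assoc (ι (suc K)) ε β ⟨
          ι (suc K) * ε * β               ≤⟨ *-monoʳ-≤ (<⇒≤ 0<β) (≤-trans (p+d≡q⇒p≤q {ι (suc K) * ε} 0≤1 (+-comm (ι (suc K) * ε) 1ℚ)) (bernoulli (<⇒≤ 0<ε) (suc K))) ⟩
          (1ℚ + ε) ^ suc K * β            ≤⟨ *-monoˡ-≤ (0≤^ (<⇒≤ 0<1+ε) (suc K)) (β≤ j) ⟩
          (1ℚ + ε) ^ suc K * v j          ∎
          where open ≤-Reasoning

        C : Mat (suc n) (suc n)
        C = s ⊙ B

        small : ∀ i j → ι (suc n) * ι (suc n) * ((C ^ᴹ suc K) ⟨ i , j ⟩ * (C ^ᴹ suc K) ⟨ i , j ⟩) ≤ 1ℚ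
        small i j = *-cancelʳ-≤ (0<p*q (0<v j) (0<v j)) (begin
          ν * ν * (x * x) * (v j * v j)
            ≡⟨ cong (λ x → ν * ν * (x * x) * (v j * v j)) (trans (cong (_⟨ i , j ⟩) (⊙-^ᴹ s B (suc K))) (⊙-entry _ _ i j)) ⟩
          ν * ν * (s ^ suc K * b * (s ^ suc K * b)) * (v j * v j)
            ≡⟨ l₁ ν (s ^ suc K) b (v j) ⟩
          ν * ν * (s ^ suc K * s ^ suc K) * (b * v j * (b * v j))
            ≤⟨ *-monoˡ-≤ (0≤p*q (0≤p² ν) (0≤p² (s ^ suc K))) (entry-bound K i j) ⟩
          ν * ν * (s ^ suc K * s ^ suc K) * (ρ ^ suc K * v i * (ρ ^ suc K * v i))
            ≡⟨ l₂ ν (s ^ suc K) (ρ ^ suc K) (v i) ⟩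
          s ^ suc K * ρ ^ suc K * (s ^ suc K * ρ ^ suc K) * (ν * v i * (ν * v i))
            ≤⟨ *-monoˡ-≤ (0≤p² (s ^ suc K * ρ ^ suc K)) (*-mono-≤ (0≤p*q (0≤ι (suc n)) (0≤v i)) (growth i j) (0≤p*q (0≤ι (suc n)) (0≤v i)) (growth i j)) ⟩
          s ^ suc K * ρ ^ suc K * (s ^ suc K * ρ ^ suc K) * (g * v j * (g * v j))
            ≡⟨ l₃ (s ^ suc K) (ρ ^ suc K) g (v j) ⟩
          (s ^ suc K * (ρ ^ suc K * g)) * (s ^ suc K * (ρ ^ suc K * g)) * (v j * v j)
            ≡⟨ cong (λ t → t * t * (v j * v j)) unit ⟩
          1ℚ * 1ℚ * (v j * v j)
            ≡⟨ cong (_* (v j * v j)) (*-identityˡ 1ℚ) ⟩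
          1ℚ * (v j * v j) ∎)
          where
          open ≤-Reasoning
          ν = ι (suc n)
          x = (C ^ᴹ suc K) ⟨ i , j ⟩
          b = (B ^ᴹ suc K) ⟨ i , j ⟩
          g = (1ℚ + ε) ^ suc K
          unit : s ^ suc K * (ρ ^ suc K * g) ≡ 1ℚ
          unit = trans (cong (s ^ suc K *_) (sym (*-^ ρ (1ℚ + ε) (suc K)))) (trans (sym (*-^ s r (suc K)))
            (trans (cong (_^ suc K) (trans (*-comm s r) (*-inv 0<r))) (1^ (suc K))))
          l₁ : ∀ n s b y → n * n * (s * b * (s * b)) * (y * y) ≡ n * n * (s * s) * (b * y * (b * y))
          l₁ = solve-∀ ℚ-ring
          l₂ : ∀ n s p x → n * n * (s * s) * (p * x * (p * x)) ≡ s * p * (s * p) * (n * x * (n * x))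
          l₂ = solve-∀ ℚ-ring
          l₃ : ∀ s p g y → s * p * (s * p) * (g * y * (g * y)) ≡ (s * (p * g)) * (s * (p * g)) * (y * y)
          l₃ = solve-∀ ℚ-ring

        hermitianC : C ⊕ C ᵀ ≡ (s * 2ℚ) ⊙ (e ᵀ · e)
        hermitianC = trans (cong (C ⊕_) (ᵀ-⊙ s B)) (trans (sym (⊙-⊕ s B (B ᵀ))) (trans (cong (s ⊙_) hermitian) (⊙-⊙ s 2ℚ _)))

        open Contraction C e (s * 2ℚ) (0≤p*q (0≤inv 0<r) 0≤2) hermitianC K (small-entries⇒contraction (C ^ᴹ suc K) small)

        tr-C^ : ∀ {ℓ} → NotFourfold ℓ → tr (C ^ᴹ ℓ) ≤ ι ℓ * tr C
        tr-C^ (m , inj₁ refl) = tr-odd-power m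
        tr-C^ (m , inj₂ refl) = tr-twice-odd-power m

      -- Undoing the scaling by r turns tr C^ℓ ≤ ℓ tr C into tr B^ℓ ≤ ℓ r^(ℓ-1) tr B. The diagonal
      -- of M consists of ones, whence tr B = n - ρ.
      tr-power-bound : ∀ k → NotFourfold (suc k) →
        tr (M ^ᴹ suc k) ≤ ρ ^ suc k + ι (suc k) * (r ^ k * (ι (suc n) - ρ))
      tr-power-bound k nf = 0≤q-p⇒p≤q (subst (0ℚ ≤_) (l₀ (tr (M ^ᴹ suc k)) (ρ ^ suc k) _)
        (p≤q⇒0≤q-p (subst₂ _≤_ (tr-B^ k) (cong (λ t → ι (suc k) * (r ^ k * t)) tr-B) bound)))
        where
        l₀ : ∀ t p x → x - (t - p) ≡ p + x - t
        l₀ = solve-∀ ℚ-ring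
        0<^ : ∀ k → 0ℚ < r ^ k
        0<^ zero    = 0<1
        0<^ (suc k) = 0<p*q 0<r (0<^ k)
        unscale : ∀ k x → r ^ k * (s ^ k * x) ≡ x
        unscale k x = trans (sym (*-assoc (r ^ k) (s ^ k) x)) (trans (cong (_* x) (trans (sym (*-^ r s k)) (trans (cong (_^ k) (*-inv 0<r)) (1^ k)))) (*-identityˡ x))
        bound : tr (B ^ᴹ suc k) ≤ ι (suc k) * (r ^ k * tr B)
        bound = begin
          tr (B ^ᴹ suc k)
            ≡⟨ unscale (suc k) _ ⟨
          r ^ suc k * (s ^ suc k * tr (B ^ᴹ suc k))
            ≡⟨ cong (r ^ suc k *_) (trans (sym (tr-⊙ (s ^ suc k) _)) (cong tr (sym (⊙-^ᴹ s B (suc k))))) ⟩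
          r ^ suc k * tr (C ^ᴹ suc k)
            ≤⟨ *-monoˡ-≤ (<⇒≤ (0<^ (suc k))) (tr-C^ nf) ⟩
          r ^ suc k * (ι (suc k) * tr C)
            ≡⟨ cong (λ t → r ^ suc k * (ι (suc k) * t)) (tr-⊙ s B) ⟩
          r ^ suc k * (ι (suc k) * (s * tr B))
            ≡⟨ l₁ r (r ^ k) (ι (suc k)) s (tr B) ⟩
          ι (suc k) * (r ^ k * (r * s * tr B))
            ≡⟨ cong (λ t → ι (suc k) * (r ^ k * t)) (trans (cong (_* tr B) (*-inv 0<r)) (*-identityˡ _)) ⟩
          ι (suc k) * (r ^ k * tr B) ∎
          where
          open ≤-Reasoning
          l₁ : ∀ r p i s t → r * p * (i * (s * t)) ≡ i * (p * (r * s * t))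
          l₁ = solve-∀ ℚ-ring

  -- Rational Perron vectors

  4ℚ : ℚ
  4ℚ = 2ℚ * 2ℚ

  infixr 8 _◂_
  _◂_ : ∀ {n} → (Fin n → Fin n → ℚ) → (Fin n → ℚ) → Fin n → ℚ
  (A ◂ v) i = ∑ λ j → A i j * v j

  -- Collatz–Wielandt iteration: while some ratio (Av)ᵢ/vᵢ exceeds the lower bound m by η,
  -- replacing v by Av raises the lower bound by a fixed amount, and m ≤ 2n throughout.
  module Perron {n : ℕ} (A : Fin (suc n) → Fin (suc n) → ℚ) (α : ℚ) (0<α : 0ℚ < α)
                (α≤A : ∀ i j → α ≤ A i j) (A≤2 : ∀ i j → A i j ≤ 2ℚ) (η : ℚ) (0<η : 0ℚ < η) where

    private
      0≤α = <⇒≤ 0<α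
      ν = ι (suc n)

      0<4ν : 0ℚ < 4ℚ * ν
      0<4ν = 0<p*q (0<p*q 0<2 0<2) (0<ι n)

      -- If row i exceeds the bound by η, then w = Av - mv is nonnegative with wᵢ at least ηαs, so
      -- every entry of Aw is at least α²ηs. Every entry of Av is at most 2∑v and hence at most 4νs;
      -- γ is the ratio of these two bounds.
      γ : ℚ
      γ = α * α * η * inv 0<4ν

      0<γ : 0ℚ < γ
      0<γ = 0<p*q (0<p*q (0<p*q 0<α 0<α) 0<η) (0<inv 0<4ν)

      γ-eq : γ * (4ℚ * ν) ≡ α * α * η
      γ-eq = *-inv-* (α * α * η) 0<4ν

      -- The scale s keeps the entries of v within the fixed ratio 2/α of each other, whatever the
      -- number of iterations. This makes the gain γ uniform.
      record State (m : ℚ) : Set where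
        field
          v     : Fin (suc n) → ℚ
          s     : ℚ
          0<s   : 0ℚ < s
          αs≤v  : ∀ i → α * s ≤ v i
          v≤2s  : ∀ i → v i ≤ 2ℚ * s
          below : ∀ i → m * v i ≤ (A ◂ v) i

        0<v : ∀ i → 0ℚ < v i
        0<v i = <-≤-trans (0<p*q 0<α 0<s) (αs≤v i)

        0≤v : ∀ i → 0ℚ ≤ v i
        0≤v i = <⇒≤ (0<v i)

        0<∑v : 0ℚ < ∑ v
        0<∑v = <-≤-trans (0<v zero) (term≤∑ 0≤v zero)

        A◂v≤ : ∀ i → (A ◂ v) i ≤ 2ℚ * ∑ v
        A◂v≤ i = ≤-trans (∑-mono-≤ λ j → *-monoʳ-≤ (0≤v j) (A≤2 i j)) (≤-reflexive (sym (*-∑ 2ℚ v)))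

        ≤A◂v : ∀ i → α * ∑ v ≤ (A ◂ v) i
        ≤A◂v i = ≤-trans (≤-reflexive (*-∑ α v)) (∑-mono-≤ λ j → *-monoʳ-≤ (0≤v j) (α≤A i j))

        m≤2ν : m ≤ 2ℚ * ν
        m≤2ν = *-cancelʳ-≤ 0<∑v (begin
          m * ∑ v                      ≡⟨ *-∑ m v ⟩
          ∑ (λ i → m * v i)            ≤⟨ ∑-mono-≤ (λ i → ≤-trans (below i) (A◂v≤ i)) ⟩
          ∑ {suc n} (λ i → 2ℚ * ∑ v)   ≡⟨ ∑-const (suc n) (2ℚ * ∑ v) ⟩
          ν * (2ℚ * ∑ v)               ≡⟨ l ν (∑ v) ⟩
          2ℚ * ν * ∑ v                 ∎)
          where
          open ≤-Reasoning
          l : ∀ ν s → ν * ((1ℚ + 1ℚ) * s) ≡ (1ℚ + 1ℚ) * ν * s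
          l = solve-∀ ℚ-ring

      ◂-linear : ∀ c (v : Fin (suc n) → ℚ) i →
                 (A ◂ (λ j → (A ◂ v) j - c * v j)) i ≡ (A ◂ (A ◂ v)) i - c * (A ◂ v) i
      ◂-linear c v i = begin
        ∑ (λ j → A i j * ((A ◂ v) j - c * v j))
          ≡⟨ trans (∑-cong λ j → l (A i j) ((A ◂ v) j) c (v j)) (∑-+ _ _) ⟩
        (A ◂ (A ◂ v)) i + ∑ (λ j → - c * (A i j * v j))
          ≡⟨ cong ((A ◂ (A ◂ v)) i +_) (trans (sym (*-∑ (- c) _)) (sym (neg-distribˡ-* c _))) ⟩
        (A ◂ (A ◂ v)) i - c * (A ◂ v) i ∎
        where
        open ≡-Reasoning
        l : ∀ a x c y → a * (x - c * y) ≡ a * x + - c * (a * y)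
        l = solve-∀ ℚ-ring

      step : ∀ {m} (S : State m) → let open State S in
             ∀ i → (m + η) * v i ≤ (A ◂ v) i → State (m + γ)
      step {m} S i above = record
        { v = A ◂ v ; s = ∑ v ; 0<s = 0<∑v ; αs≤v = ≤A◂v ; v≤2s = A◂v≤ ; below = raised }
        where
        open State S
        w : Fin (suc n) → ℚ
        w j = (A ◂ v) j - m * v j
        0≤w : ∀ j → 0ℚ ≤ w j
        0≤w j = p≤q⇒0≤q-p (below j)
        ηαs≤wᵢ : η * (α * s) ≤ w i
        ηαs≤wᵢ = ≤-trans (*-monoˡ-≤ (<⇒≤ 0<η) (αs≤v i)) (0≤q-p⇒p≤q (subst (0ℚ ≤_) (l ((A ◂ v) i) m η (v i)) (p≤q⇒0≤q-p above)))
          where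
          l : ∀ x m η y → x - (m + η) * y ≡ x - m * y - η * y
          l = solve-∀ ℚ-ring
        gain : ∀ l → γ * (A ◂ v) l ≤ (A ◂ w) l
        gain l = begin
          γ * (A ◂ v) l                   ≤⟨ *-monoˡ-≤ (<⇒≤ 0<γ) (A◂v≤ l) ⟩
          γ * (2ℚ * ∑ v)                  ≤⟨ *-monoˡ-≤ (<⇒≤ 0<γ) (*-monoˡ-≤ 0≤2 (≤-trans (∑-mono-≤ v≤2s) (≤-reflexive (∑-const (suc n) (2ℚ * s))))) ⟩
          γ * (2ℚ * (ν * (2ℚ * s)))       ≡⟨ l₁ γ ν s ⟩
          γ * (4ℚ * ν) * s                ≡⟨ cong (_* s) γ-eq ⟩
          α * α * η * s                   ≡⟨ l₂ α η s ⟩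
          α * (η * (α * s))               ≤⟨ *-mono-≤ 0≤α (α≤A l i) (0≤p*q (<⇒≤ 0<η) (<⇒≤ (0<p*q 0<α 0<s))) ηαs≤wᵢ ⟩
          A l i * w i                     ≤⟨ term≤∑ (λ j → 0≤p*q (≤-trans 0≤α (α≤A l j)) (0≤w j)) i ⟩
          (A ◂ w) l                       ∎
          where
          open ≤-Reasoning
          l₁ : ∀ γ ν s → γ * ((1ℚ + 1ℚ) * (ν * ((1ℚ + 1ℚ) * s))) ≡ γ * ((1ℚ + 1ℚ) * (1ℚ + 1ℚ) * ν) * s
          l₁ = solve-∀ ℚ-ring
          l₂ : ∀ α η s → α * α * η * s ≡ α * (η * (α * s))
          l₂ = solve-∀ ℚ-ring
        raised : ∀ l → (m + γ) * (A ◂ v) l ≤ (A ◂ (A ◂ v)) l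
        raised l = 0≤q-p⇒p≤q (subst (0ℚ ≤_) (l₃ ((A ◂ (A ◂ v)) l) m γ ((A ◂ v) l))
          (p≤q⇒0≤q-p (≤-trans (gain l) (≤-reflexive (◂-linear m v l)))))
          where
          l₃ : ∀ x m γ y → x - m * y - γ * y ≡ x - (m + γ) * y
          l₃ = solve-∀ ℚ-ring

    Approximate : Set
    Approximate = ∃[ v ] ∃[ m ] ((∀ i → 0ℚ < v i) ×
      (∀ i → m * v i ≤ (A ◂ v) i) × (∀ i → (A ◂ v) i ≤ (m + η) * v i))

    private
      -- The counter k bounds the remaining iterations. When it is exhausted, the invariant
      -- contradicts `m≤2ν`.
      search : ∀ k m → State m → 2ℚ * ν < m + ι k * γ → Approximate
      search zero m S big = ⊥-elim (<-irrefl refl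
        (<-≤-trans big (≤-trans (≤-reflexive (trans (cong (m +_) (*-zeroˡ γ)) (+-identityʳ m))) (State.m≤2ν S))))
      search (suc k) m S big with all? (λ i → (A ◂ State.v S) i ≤? (m + η) * State.v S i)
      ... | yes above = State.v S , m , State.0<v S , State.below S , above
      ... | no ¬above with ¬∀⟶∃¬ _ _ (λ i → (A ◂ State.v S) i ≤? (m + η) * State.v S i) ¬above
      ...   | i , ≰ = search k (m + γ) (step S i (<⇒≤ (≰⇒> ≰))) (subst (2ℚ * ν <_) (l m (ι k) γ) big)
        where
        l : ∀ m k γ → m + (1ℚ + k) * γ ≡ m + γ + k * γ
        l = solve-∀ ℚ-ring

      initial : State 0ℚ
      initial = record
        { v = A ◂ (λ _ → 1ℚ) ; s = ν ; 0<s = 0<ι n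
        ; αs≤v = λ i → ≤-trans (≤-reflexive (trans (*-comm α ν) (sym (∑-const (suc n) α))))
            (∑-mono-≤ λ j → ≤-trans (α≤A i j) (≤-reflexive (sym (*-identityʳ _))))
        ; v≤2s = λ i → ≤-trans (∑-mono-≤ λ j → ≤-trans (≤-reflexive (*-identityʳ _)) (A≤2 i j))
            (≤-reflexive (trans (∑-const (suc n) 2ℚ) (*-comm ν 2ℚ)))
        ; below = λ i → ≤-trans (≤-reflexive (*-zeroˡ ((A ◂ (λ _ → 1ℚ)) i)))
            (0≤∑ λ j → 0≤p*q (0≤A i j) (0≤∑ λ l → 0≤p*q (0≤A j l) 0≤1))
        }
        where
        0≤A : ∀ i j → 0ℚ ≤ A i j
        0≤A i j = ≤-trans 0≤α (α≤A i j)

    approximate : Approximate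
    approximate = search (suc k) 0ℚ initial (begin-strict
      2ℚ * ν                        ≡⟨ *-inv-* (2ℚ * ν) 0<γ ⟨
      2ℚ * ν * inv 0<γ * γ          ≤⟨ *-monoʳ-≤ (<⇒≤ 0<γ) (proj₂ bound) ⟩
      ι k * γ                       ≡⟨ +-identityˡ _ ⟨
      0ℚ + ι k * γ                  <⟨ +-monoˡ-< (ι k * γ) 0<γ ⟩
      γ + ι k * γ                   ≡⟨ l γ (ι k) ⟩
      0ℚ + (1ℚ + ι k) * γ           ∎)
      where
      open ≤-Reasoning
      bound = archimedean (2ℚ * ν * inv 0<γ)
      k = proj₁ bound
      l : ∀ γ k → γ + k * γ ≡ 0ℚ + (1ℚ + k) * γ
      l = solve-∀ ℚ-ring

  -- Adding the skew matrix (v dᵀ − d vᵀ)/|v|², with d the defect Av − ρv ⊥ v, turns the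
  -- approximate eigenvector v into an exact one.
  module Perturb {n : ℕ} (A : Fin (suc n) → Fin (suc n) → ℚ) (pairs : ∀ i j → A i j + A j i ≡ 2ℚ)
                 (v : Fin (suc n) → ℚ) (0<v : ∀ i → 0ℚ < v i) (m η : ℚ) (0≤η : 0ℚ ≤ η)
                 (below : ∀ i → m * v i ≤ (A ◂ v) i) (above : ∀ i → (A ◂ v) i ≤ (m + η) * v i) where

    open Rayleigh v 0<v

    private
      d : Fin (suc n) → ℚ
      d i = (A ◂ v) i - ρ * v i

      T : ℚ
      T = ∑ λ i → v i * (A ◂ v) i

      -- Pairing (i,j) with (j,i) leaves only the symmetric part of A, which is J.
      T≡σ² : T ≡ σ * σ
      T≡σ² = *-cancelˡ-≡ (begin
        2ℚ * T
          ≡⟨ double T ⟩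
        T + T
          ≡⟨ cong₂ _+_ T-expand (trans T-expand (∑-swap _)) ⟩
        ∑ (λ i → ∑ λ j → v i * (A i j * v j)) + ∑ (λ i → ∑ λ j → v j * (A j i * v i))
          ≡⟨ trans (sym (∑-+ _ _)) (∑-cong λ i → sym (∑-+ _ _)) ⟩
        ∑ (λ i → ∑ λ j → v i * (A i j * v j) + v j * (A j i * v i))
          ≡⟨ ∑-cong (λ i → ∑-cong λ j → trans (collect (v i) (A i j) (v j) (A j i)) (cong (_* (v i * v j)) (pairs i j))) ⟩
        ∑ (λ i → ∑ λ j → 2ℚ * (v i * v j))
          ≡⟨ trans (∑-cong λ i → sym (*-∑ 2ℚ _)) (sym (*-∑ 2ℚ _)) ⟩
        2ℚ * ∑ (λ i → ∑ λ j → v i * v j)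
          ≡⟨ cong (2ℚ *_) (trans (∑-* σ v) (∑-cong λ i → *-∑ (v i) v)) ⟨
        2ℚ * (σ * σ) ∎)
        where
        open ≡-Reasoning
        *-cancelˡ-≡ : ∀ {x y} → 2ℚ * x ≡ 2ℚ * y → x ≡ y
        *-cancelˡ-≡ eq = ≤-antisym (*-cancelˡ-≤ 0<2 (≤-reflexive eq)) (*-cancelˡ-≤ 0<2 (≤-reflexive (sym eq)))
        T-expand : T ≡ ∑ λ i → ∑ λ j → v i * (A i j * v j)
        T-expand = ∑-cong λ i → *-∑ (v i) _
        double : ∀ t → (1ℚ + 1ℚ) * t ≡ t + t
        double = solve-∀ ℚ-ring
        collect : ∀ x a y b → x * (a * y) + y * (b * x) ≡ (a + b) * (x * y)
        collect = solve-∀ ℚ-ring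

      T≡ρN : T ≡ ρ * N
      T≡ρN = trans T≡σ² (sym ρN≡σ²)

      -- Since T = ρN, ρ is the mean of the ratios (Av)ᵢ/vᵢ with weights vᵢ², so it lies between the
      -- Collatz-Wielandt bounds m and m + η. This makes the defect d at most ηv in absolute value.
      m≤ρ : m ≤ ρ
      m≤ρ = *-cancelʳ-≤ 0<N (subst₂ _≤_
        (sym (*-∑ m _)) T≡ρN (∑-mono-≤ λ i → ≤-trans (≤-reflexive (l m (v i))) (*-monoˡ-≤ (0≤v i) (below i))))
        where
        l : ∀ m x → m * (x * x) ≡ x * (m * x)
        l = solve-∀ ℚ-ring

      ρ≤m+η : ρ ≤ m + η
      ρ≤m+η = *-cancelʳ-≤ 0<N (subst₂ _≤_
        T≡ρN (sym (*-∑ (m + η) _)) (∑-mono-≤ λ i → ≤-trans (*-monoˡ-≤ (0≤v i) (above i)) (≤-reflexive (l (m + η) (v i)))))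
        where
        l : ∀ m x → x * (m * x) ≡ m * (x * x)
        l = solve-∀ ℚ-ring

      d≤ : ∀ i → d i ≤ η * v i
      d≤ i = 0≤q-p⇒p≤q (subst (0ℚ ≤_) (l ((A ◂ v) i) m η ρ (v i))
        (0≤p+q (p≤q⇒0≤q-p (above i)) (0≤p*q (p≤q⇒0≤q-p m≤ρ) (0≤v i))))
        where
        l : ∀ x m η ρ y → (m + η) * y - x + (ρ - m) * y ≡ η * y - (x - ρ * y)
        l = solve-∀ ℚ-ring

      ≤d : ∀ i → - (η * v i) ≤ d i
      ≤d i = 0≤q-p⇒p≤q (subst (0ℚ ≤_) (l ((A ◂ v) i) m η ρ (v i))
        (0≤p+q (p≤q⇒0≤q-p (below i)) (0≤p*q (p≤q⇒0≤q-p ρ≤m+η) (0≤v i))))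
        where
        l : ∀ x m η ρ y → x - m * y + (m + η - ρ) * y ≡ x - ρ * y - (- (η * y))
        l = solve-∀ ℚ-ring

      d⊥v : ∑ (λ j → d j * v j) ≡ 0ℚ
      d⊥v = begin
        ∑ (λ j → d j * v j)                                   ≡⟨ trans (∑-cong λ j → l ((A ◂ v) j) ρ (v j)) (∑-+ _ _) ⟩
        T + ∑ (λ j → - ρ * (v j * v j))                       ≡⟨ cong₂ _+_ T≡ρN (sym (*-∑ (- ρ) _)) ⟩
        ρ * N + - ρ * N                                       ≡⟨ l₂ ρ N ⟩
        0ℚ                                                    ∎
        where
        open ≡-Reasoning
        l : ∀ x ρ y → (x - ρ * y) * y ≡ y * x + - ρ * (y * y)
        l = solve-∀ ℚ-ring
        l₂ : ∀ ρ N → ρ * N + - ρ * N ≡ 0ℚ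
        l₂ = solve-∀ ℚ-ring

    A′ : Fin (suc n) → Fin (suc n) → ℚ
    A′ i j = A i j + (v i * d j - d i * v j) * N⁻¹

    pairs′ : ∀ i j → A′ i j + A′ j i ≡ 2ℚ
    pairs′ i j = trans (l (A i j) (A j i) (v i) (d j) (d i) (v j) N⁻¹) (pairs i j)
      where
      l : ∀ a b x d′ d y i → (a + (x * d′ - d * y) * i) + (b + (y * d - d′ * x) * i) ≡ a + b
      l = solve-∀ ℚ-ring

    eigen′ : ∀ i → (A′ ◂ v) i ≡ ρ * v i
    eigen′ i = begin
      ∑ (λ j → A′ i j * v j)
        ≡⟨ trans (∑-cong λ j → l (A i j) (v i) (d j) (d i) (v j) N⁻¹) (trans (∑-+ _ _) (cong ((A ◂ v) i +_) (∑-+ _ _))) ⟩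
      (A ◂ v) i + (∑ (λ j → v i * N⁻¹ * (d j * v j)) + ∑ (λ j → - (d i * N⁻¹) * (v j * v j)))
        ≡⟨ cong ((A ◂ v) i +_) (cong₂ _+_ (trans (sym (*-∑ (v i * N⁻¹) _)) (cong (v i * N⁻¹ *_) d⊥v)) (sym (*-∑ (- (d i * N⁻¹)) _))) ⟩
      (A ◂ v) i + (v i * N⁻¹ * 0ℚ + - (d i * N⁻¹) * N)
        ≡⟨ l₂ ((A ◂ v) i) (v i) (d i) N⁻¹ N ⟩
      (A ◂ v) i - d i * (N * N⁻¹)
        ≡⟨ cong (λ t → (A ◂ v) i - d i * t) (*-inv 0<N) ⟩
      (A ◂ v) i - d i * 1ℚ
        ≡⟨ l₃ ((A ◂ v) i) (ρ * v i) ⟩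
      ρ * v i ∎
      where
      open ≡-Reasoning
      l : ∀ a x d′ d y i → (a + (x * d′ - d * y) * i) * y ≡ a * y + (x * i * (d′ * y) + - (d * i) * (y * y))
      l = solve-∀ ℚ-ring
      l₂ : ∀ a x d i N → a + (x * i * 0ℚ + - (d * i) * N) ≡ a - d * (N * i)
      l₂ = solve-∀ ℚ-ring
      l₃ : ∀ a b → a - (a - b) * 1ℚ ≡ b
      l₃ = solve-∀ ℚ-ring

    -- Each half of the skew correction is at most ηvᵢvⱼ/N in absolute value, and vᵢvⱼ ≤ N.
    A-2η≤A′ : ∀ i j → A i j - 2ℚ * η ≤ A′ i j
    A-2η≤A′ i j = +-monoʳ-≤ (A i j) (begin
      - (2ℚ * η)                                          ≡⟨ l₁ η (2ℚ) ⟩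
      - (2ℚ * η * 1ℚ)                                     ≡⟨ cong (λ t → - (2ℚ * η * t)) (*-inv 0<N) ⟨
      - (2ℚ * η * (N * N⁻¹))                              ≤⟨ neg-antimono-≤ (*-monoˡ-≤ (0≤p*q 0≤2 0≤η) (*-monoʳ-≤ (0≤inv 0<N) vv≤N)) ⟩
      - (2ℚ * η * (v i * v j * N⁻¹))                      ≡⟨ l₂ η (v i) (v j) N⁻¹ ⟩
      (v i * - (η * v j) - η * v i * v j) * N⁻¹           ≤⟨ *-monoʳ-≤ (0≤inv 0<N) (+-mono-≤ (*-monoˡ-≤ (0≤v i) (≤d j)) (neg-antimono-≤ (*-monoʳ-≤ (0≤v j) (d≤ i)))) ⟩
      (v i * d j - d i * v j) * N⁻¹                       ∎)
      where
      open ≤-Reasoning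
      l₁ : ∀ η t → - (t * η) ≡ - (t * η * 1ℚ)
      l₁ = solve-∀ ℚ-ring
      l₂ : ∀ η x y i → - ((1ℚ + 1ℚ) * η * (x * y * i)) ≡ (x * - (η * y) - η * x * y) * i
      l₂ = solve-∀ ℚ-ring
      vv≤N : v i * v j ≤ N
      vv≤N = *-cancelˡ-≤ 0<2 (≤-trans
        (p+d≡q⇒p≤q (0≤p² (v i - v j)) (l (v i) (v j)))
        (≤-trans (+-mono-≤ (term≤∑ (λ l → 0≤p² (v l)) i) (term≤∑ (λ l → 0≤p² (v l)) j)) (≤-reflexive (l′ N))))
        where
        l : ∀ x y → (1ℚ + 1ℚ) * (x * y) + (x - y) * (x - y) ≡ x * x + y * y
        l = solve-∀ ℚ-ring
        l′ : ∀ N → N + N ≡ (1ℚ + 1ℚ) * N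
        l′ = solve-∀ ℚ-ring

  -- The exact trace bound, by removing the perturbation

  tangent : ∀ {r x} → 0ℚ ≤ r → 0ℚ ≤ x → ∀ k →
            r ^ suc k + ι (suc k) * (r ^ k * (x - r)) ≤ x ^ suc k
  tangent {r} {x} 0≤r 0≤x zero = ≤-reflexive (l r x)
    where
    l : ∀ r x → r * 1ℚ + (1ℚ + 0ℚ) * (1ℚ * (x - r)) ≡ x * 1ℚ
    l = solve-∀ ℚ-ring
  tangent {r} {x} 0≤r 0≤x (suc k) = ≤-trans
    -- Multiplying the previous tangent line by x exceeds the next one by (k+1) r^k (x - r)².
    (p+d≡q⇒p≤q (0≤p*q (0≤p*q (0≤ι (suc k)) (0≤^ 0≤r k)) (0≤p² (x - r))) (l r x (r ^ k) (ι (suc k))))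
    (*-monoˡ-≤ 0≤x (tangent 0≤r 0≤x k))
    where
    l : ∀ r x p i → r * (r * p) + (1ℚ + i) * (r * p * (x - r)) + i * p * ((x - r) * (x - r))
                  ≡ x * (r * p + i * (p * (x - r)))
    l = solve-∀ ℚ-ring

  ^-decay : ∀ {x} → 0ℚ ≤ 1ℚ - x → ∀ k → 1ℚ - ι k * x ≤ (1ℚ - x) ^ k
  ^-decay {x} 0≤1-x zero    = ≤-reflexive (l x)
    where
    l : ∀ x → 1ℚ - 0ℚ * x ≡ 1ℚ
    l = solve-∀ ℚ-ring
  ^-decay {x} 0≤1-x (suc k) = ≤-trans
    (p+d≡q⇒p≤q (0≤p*q (0≤ι k) (0≤p² x)) (l x (ι k)))
    (*-monoˡ-≤ 0≤1-x (^-decay 0≤1-x k))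
    where
    l : ∀ x k → 1ℚ - (1ℚ + k) * x + k * (x * x) ≡ (1ℚ - x) * (1ℚ - k * x)
    l = solve-∀ ℚ-ring

  ^ᴹ-mono-≤ : ∀ {n} {A B : Mat n n} → NonNeg A → (∀ i j → A ⟨ i , j ⟩ ≤ B ⟨ i , j ⟩) →
              ∀ k i j → (A ^ᴹ k) ⟨ i , j ⟩ ≤ (B ^ᴹ k) ⟨ i , j ⟩
  ^ᴹ-mono-≤ 0≤A A≤B zero    i j = ≤-refl
  ^ᴹ-mono-≤ {A = A} {B} 0≤A A≤B (suc k) i j = subst₂ _≤_ (sym (·-entry _ A i j)) (sym (·-entry _ B i j))
    (∑-mono-≤ λ l → *-mono-≤ (NonNeg-^ᴹ 0≤A k i l) (^ᴹ-mono-≤ 0≤A A≤B k i l) (0≤A l j) (A≤B l j))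

  tr-mono-≤ : ∀ {n} {A B : Mat n n} → (∀ i j → A ⟨ i , j ⟩ ≤ B ⟨ i , j ⟩) → tr A ≤ tr B
  tr-mono-≤ {A = A} {B} A≤B = subst₂ _≤_ (sym (tr-def A)) (sym (tr-def B)) (∑-mono-≤ λ i → A≤B i i)

  module TraceBound {n : ℕ} (M : Mat (suc n) (suc n)) (0≤M : NonNeg M)
                    (pairs : ∀ i j → M ⟨ i , j ⟩ + M ⟨ j , i ⟩ ≡ 2ℚ)
                    (k : ℕ) (nf : NotFourfold (suc k)) where

    private
      ν T c : ℚ
      ν = ι (suc n)
      T = tr (M ^ᴹ suc k)
      -- The coefficient of θ in the total error: the T part pays for shrinking M by the factor 1 -
      -- θ, the other part for using the radius ρ(1+θ) in place of ρ. It is independent of θ.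
      c = ι (suc k) * (T + (2ℚ * ν) ^ k * ν)

      0≤ν = 0≤ι (suc n)

      0≤T : 0ℚ ≤ T
      0≤T = subst (0ℚ ≤_) (sym (tr-def _)) (0≤∑ λ i → NonNeg-^ᴹ 0≤M (suc k) i i)

      module _ (θ : ℚ) (0<θ : 0ℚ < θ) (θ≤1 : θ ≤ 1ℚ) where

        0≤1-θ : 0ℚ ≤ 1ℚ - θ
        0≤1-θ = p≤q⇒0≤q-p θ≤1

        -- Mixing M with the all-ones matrix preserves the sum 2J with the transpose and makes all
        -- entries at least θ, as the Collatz-Wielandt iteration requires.
        A : Fin (suc n) → Fin (suc n) → ℚ
        A i j = (1ℚ - θ) * M ⟨ i , j ⟩ + θ

        pairsA : ∀ i j → A i j + A j i ≡ 2ℚ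
        pairsA i j = trans (l₁ θ (M ⟨ i , j ⟩) (M ⟨ j , i ⟩)) (trans (cong (λ t → (1ℚ - θ) * t + (1ℚ + 1ℚ) * θ) (pairs i j)) (l₂ θ))
          where
          l₁ : ∀ θ a b → ((1ℚ - θ) * a + θ) + ((1ℚ - θ) * b + θ) ≡ (1ℚ - θ) * (a + b) + (1ℚ + 1ℚ) * θ
          l₁ = solve-∀ ℚ-ring
          l₂ : ∀ θ → (1ℚ - θ) * (1ℚ + 1ℚ) + (1ℚ + 1ℚ) * θ ≡ 1ℚ + 1ℚ
          l₂ = solve-∀ ℚ-ring

        θ≤A : ∀ i j → θ ≤ A i j
        θ≤A i j = p+d≡q⇒p≤q (0≤p*q 0≤1-θ (0≤M i j)) (+-comm θ _)

        A≤2 : ∀ i j → A i j ≤ 2ℚ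
        A≤2 i j = p+d≡q⇒p≤q (≤-trans (<⇒≤ 0<θ) (θ≤A j i)) (pairsA i j)

        -- The skew correction may lower an entry by 2η, which is exactly the θ that was added. The
        -- corrected matrix therefore still dominates (1-θ)M and stays nonnegative.
        η = ½ * θ

        0<η : 0ℚ < η
        0<η = 0<p*q (positive⁻¹ ½) 0<θ

        approx = Perron.approximate A θ 0<θ θ≤A A≤2 η 0<η
        v = proj₁ approx
        0<v = proj₁ (proj₂ (proj₂ approx))

        module E = Perturb A pairsA v 0<v (proj₁ (proj₂ approx)) η (<⇒≤ 0<η)
          (proj₁ (proj₂ (proj₂ (proj₂ approx)))) (proj₂ (proj₂ (proj₂ (proj₂ approx))))

        M′ : Mat (suc n) (suc n)
        M′ = mat E.A′

        entry′ : ∀ i j → M′ ⟨ i , j ⟩ ≡ E.A′ i j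
        entry′ = mat-entry E.A′

        scaled≤ : ∀ i j → ((1ℚ - θ) ⊙ M) ⟨ i , j ⟩ ≤ M′ ⟨ i , j ⟩
        scaled≤ i j = subst₂ _≤_ (sym (⊙-entry _ M i j)) (sym (entry′ i j))
          (subst (_≤ E.A′ i j) (l ((1ℚ - θ) * M ⟨ i , j ⟩)) (E.A-2η≤A′ i j))
          where
          l : ∀ x → x + θ - 2ℚ * (½ * θ) ≡ x
          l x = trans (cong (λ t → x + θ - t) (trans (sym (*-assoc 2ℚ ½ θ)) (*-identityˡ θ))) (l′ x θ)
            where
            l′ : ∀ x θ → x + θ - θ ≡ x
            l′ = solve-∀ ℚ-ring

        0≤scaled : NonNeg ((1ℚ - θ) ⊙ M)
        0≤scaled i j = subst (0ℚ ≤_) (sym (⊙-entry _ M i j)) (0≤p*q 0≤1-θ (0≤M i j))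

        open Rayleigh v 0<v using (ρ; 0≤ρ; ρ≤n)

        module D = Deflation v 0<v M′ (λ i j → ≤-trans (0≤scaled i j) (scaled≤ i j))
          (λ i j → trans (cong₂ _+_ (entry′ i j) (entry′ j i)) (E.pairs′ i j))
          (λ i → trans (∑-cong λ j → cong (_* v j) (entry′ i j)) (E.eigen′ i))

        r = D.r θ 0<θ

        ρ≤r : ρ ≤ r
        ρ≤r = p+d≡q⇒p≤q (0≤p*q 0≤ρ (<⇒≤ 0<θ)) (l ρ θ)
          where
          l : ∀ ρ θ → ρ + ρ * θ ≡ ρ * (1ℚ + θ)
          l = solve-∀ ℚ-ring

        0≤r : 0ℚ ≤ r
        0≤r = ≤-trans 0≤ρ ρ≤r

        r≤2ν : r ≤ 2ℚ * ν
        r≤2ν = ≤-trans (*-mono-≤ 0≤ρ ρ≤n (0≤p+q 0≤1 (<⇒≤ 0<θ)) (+-monoʳ-≤ 1ℚ θ≤1)) (≤-reflexive (*-comm ν 2ℚ))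

        approximate-bound : T ≤ ν ^ suc k + θ * c
        approximate-bound = 0≤q-p⇒p≤q (subst (0ℚ ≤_) (l₁ T (ν ^ suc k) θ (ι (suc k)) ((2ℚ * ν) ^ k * ν))
          (p≤q⇒0≤q-p chain))
          where
          l₁ : ∀ T p θ i w → p + i * (w * θ) - (1ℚ - i * θ) * T ≡ p + θ * (i * (T + w)) - T
          l₁ = solve-∀ ℚ-ring
          open ≤-Reasoning
          l₂ : ∀ q s i p n r ρ → q + i * (p * (n - ρ)) ≡ (q - s) + (s + i * (p * (n - r))) + i * (p * (r - ρ))
          l₂ = solve-∀ ℚ-ring
          l₃ : ∀ ρ θ → ρ * (1ℚ + θ) - ρ ≡ ρ * θ
          l₃ = solve-∀ ℚ-ring
          nonpos : ρ ^ suc k - r ^ suc k ≤ 0ℚ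
          nonpos = subst (ρ ^ suc k - r ^ suc k ≤_) (+-inverseʳ (r ^ suc k)) (+-monoˡ-≤ (- (r ^ suc k)) (^-mono-≤ 0≤ρ ρ≤r (suc k)))
          chain : (1ℚ - ι (suc k) * θ) * T ≤ ν ^ suc k + ι (suc k) * ((2ℚ * ν) ^ k * ν * θ)
          chain = begin
            (1ℚ - ι (suc k) * θ) * T
              ≤⟨ *-monoʳ-≤ 0≤T (^-decay 0≤1-θ (suc k)) ⟩
            (1ℚ - θ) ^ suc k * T
              ≡⟨ trans (sym (tr-⊙ _ (M ^ᴹ suc k))) (cong tr (sym (⊙-^ᴹ (1ℚ - θ) M (suc k)))) ⟩
            tr (((1ℚ - θ) ⊙ M) ^ᴹ suc k)
              ≤⟨ tr-mono-≤ (^ᴹ-mono-≤ 0≤scaled scaled≤ (suc k)) ⟩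
            tr (M′ ^ᴹ suc k)
              ≤⟨ D.tr-power-bound θ 0<θ k nf ⟩
            ρ ^ suc k + ι (suc k) * (r ^ k * (ν - ρ))
              -- The slope r^k belongs to the tangent at r. The base point is moved from ρ to r
              -- accordingly, at the price of the last summand, where r - ρ = ρθ.
              ≡⟨ l₂ (ρ ^ suc k) (r ^ suc k) (ι (suc k)) (r ^ k) ν r ρ ⟩
            (ρ ^ suc k - r ^ suc k) + (r ^ suc k + ι (suc k) * (r ^ k * (ν - r))) + ι (suc k) * (r ^ k * (r - ρ))
              ≤⟨ +-monoˡ-≤ (ι (suc k) * (r ^ k * (r - ρ))) (+-mono-≤ nonpos (tangent 0≤r 0≤ν k)) ⟩
            0ℚ + ν ^ suc k + ι (suc k) * (r ^ k * (r - ρ))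
              ≡⟨ cong₂ (λ x y → x + ι (suc k) * (r ^ k * y)) (+-identityˡ (ν ^ suc k)) (l₃ ρ θ) ⟩
            ν ^ suc k + ι (suc k) * (r ^ k * (ρ * θ))
              ≤⟨ +-monoʳ-≤ (ν ^ suc k) (*-monoˡ-≤ (0≤ι (suc k)) (*-mono-≤ (0≤^ 0≤r k) (^-mono-≤ 0≤r r≤2ν k)
                   (0≤p*q 0≤ρ (<⇒≤ 0<θ)) (*-monoʳ-≤ (<⇒≤ 0<θ) ρ≤n))) ⟩
            ν ^ suc k + ι (suc k) * ((2ℚ * ν) ^ k * (ν * θ))
              ≡⟨ cong (λ t → ν ^ suc k + ι (suc k) * t) (*-assoc ((2ℚ * ν) ^ k) ν θ) ⟨
            ν ^ suc k + ι (suc k) * ((2ℚ * ν) ^ k * ν * θ) ∎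

      0≤c : 0ℚ ≤ c
      0≤c = 0≤p*q (0≤ι (suc k)) (0≤p+q 0≤T (0≤p*q (0≤^ (0≤p*q 0≤2 0≤ν) k) 0≤ν))

    trace-bound : T ≤ ν ^ suc k
    trace-bound with T ≤? ν ^ suc k
    ... | yes T≤ = T≤
    ... | no T≰ = ⊥-elim (<-irrefl refl (<-≤-trans (0<p*q 0<θ 0<d) θd≤0))
      where
      d = T - ν ^ suc k
      0<d : 0ℚ < d
      0<d = p<q⇒0<q-p (≰⇒> T≰)
      0<c+d : 0ℚ < c + d
      0<c+d = +-mono-≤-< 0≤c 0<d
      -- An excess d > 0 would satisfy d ≤ θc for every admissible θ. This choice has θ(c+d) = d, so
      -- it would give θd ≤ 0.
      θ = d * inv 0<c+d
      θ[c+d]≡d : θ * (c + d) ≡ d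
      θ[c+d]≡d = *-inv-* d 0<c+d
      0<θ : 0ℚ < θ
      0<θ = 0<p*q 0<d (0<inv 0<c+d)
      θ≤1 : θ ≤ 1ℚ
      θ≤1 = *-cancelʳ-≤ 0<c+d (≤-trans (≤-reflexive θ[c+d]≡d) (p+d≡q⇒p≤q 0≤c (l d c)))
        where
        l : ∀ d c → d + c ≡ 1ℚ * (c + d)
        l = solve-∀ ℚ-ring
      θd≤0 : θ * d ≤ 0ℚ
      θd≤0 = 0≤q-p⇒p≤q (subst (0ℚ ≤_) (l₁ T (ν ^ suc k) θ c d θ[c+d]≡d refl) (p≤q⇒0≤q-p (approximate-bound θ 0<θ θ≤1)))
        where
        l₁ : ∀ T p θ c d → θ * (c + d) ≡ d → d ≡ T - p → p + θ * c - T ≡ 0ℚ - θ * d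
        l₁ T p θ c d eq eq′ = trans (l₂ T p θ c) (trans (cong (λ t → θ * c - t) (trans (sym eq′) (sym eq))) (l₃ θ c d))
          where
          l₂ : ∀ T p θ c → p + θ * c - T ≡ θ * c - (T - p)
          l₂ = solve-∀ ℚ-ring
          l₃ : ∀ θ c d → θ * c - θ * (c + d) ≡ 0ℚ - θ * d
          l₃ = solve-∀ ℚ-ring

-- Weighted cycles, rounding of orientations and falling factorials

module Counting where

  open import Defs
  open import Data.Bool using (Bool; true; false; not; _∧_; _∨_; _xor_; if_then_else_)
  open import Data.Bool.ListAction using (all; any)
  open import Data.Bool.Properties using (T?; T-≡)
  open import Data.Empty using (⊥; ⊥-elim)
  open import Data.Fin using (Fin; zero; suc)
  import Data.Fin as F
  open import Data.Fin.Properties using (suc-injective)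
  open import Data.List using (List; []; _∷_; [_]; map; concatMap; filterᵇ; foldr; length; zip; _++_; tabulate; allFin; cartesianProduct)
  open import Data.List.Membership.Propositional using (_∈_)
  open import Data.List.Membership.Propositional.Properties
    using (∈-allFin; ∈-cartesianProduct⁺; ∈-map⁺; ∈-concat⁺′; ∈-filter⁺; ∈-filter⁻)
  open import Data.List.Relation.Unary.All using (All; []; _∷_)
  open import Data.List.Relation.Unary.Any using (here; there)
  open import Data.Nat using (ℕ; zero; suc; _+_; _*_; _∸_; _^_; _⊔_; _!; _≤_; z≤n; s≤s; _≡ᵇ_)
  open import Data.Nat.Combinatorics using (_C_; nCk≡nPk/k!)
  open import Data.Nat.Combinatorics.Base using (_P_; _P′_)
  open import Data.Nat.Combinatorics.Specification using (k!∣nP′k)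
  open import Data.Nat.DivMod using (_/_; m/n*n≤m; m≡m%n+[m/n]*n; m%n<n; m/n*n≡m)
  open import Data.Nat.Properties hiding (suc-injective)
  open import Data.Nat.Tactic.RingSolver using (solve-∀)
  open import Data.Product using (_×_; _,_; proj₁; proj₂; ∃-syntax)
  open import Data.Sum using (_⊎_; inj₁; inj₂)
  open import Data.Vec using (Vec; toList)
  import Data.Vec as V
  open import Data.Vec.Properties using (length-toList; lookup∘tabulate)
  open import Function using (_∘_; id)
  open import Function.Bundles using (Equivalence)
  open import Relation.Binary.PropositionalEquality hiding ([_])
  open import Relation.Nullary using (¬_; Dec; yes; no)
  open import Relation.Nullary.Decidable using (⌊_⌋; _×-dec_; _⊎-dec_)

  -- Sums over lists

  ∑ₗ : {A : Set} → (A → ℕ) → List A → ℕ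
  ∑ₗ f []       = 0
  ∑ₗ f (x ∷ xs) = f x + ∑ₗ f xs

  𝟏 : Bool → ℕ
  𝟏 true  = 1
  𝟏 false = 0

  module _ {A : Set} where

    ∑ₗ-cong : {f g : A → ℕ} → (∀ x → f x ≡ g x) → ∀ xs → ∑ₗ f xs ≡ ∑ₗ g xs
    ∑ₗ-cong f≗g []       = refl
    ∑ₗ-cong f≗g (x ∷ xs) = cong₂ _+_ (f≗g x) (∑ₗ-cong f≗g xs)

    ∑ₗ-mono-≤ : {f g : A → ℕ} → (∀ x → f x ≤ g x) → ∀ xs → ∑ₗ f xs ≤ ∑ₗ g xs
    ∑ₗ-mono-≤ f≤g []       = z≤n
    ∑ₗ-mono-≤ f≤g (x ∷ xs) = +-mono-≤ (f≤g x) (∑ₗ-mono-≤ f≤g xs)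

    ∑ₗ-+ : ∀ (f g : A → ℕ) xs → ∑ₗ (λ x → f x + g x) xs ≡ ∑ₗ f xs + ∑ₗ g xs
    ∑ₗ-+ f g []       = refl
    ∑ₗ-+ f g (x ∷ xs) = trans (cong (f x + g x +_) (∑ₗ-+ f g xs)) (lemma (f x) (g x) (∑ₗ f xs) (∑ₗ g xs))
      where
      lemma : ∀ a b c d → a + b + (c + d) ≡ a + c + (b + d)
      lemma = solve-∀

    ∑ₗ-*ˡ : ∀ c (f : A → ℕ) xs → ∑ₗ (λ x → c * f x) xs ≡ c * ∑ₗ f xs
    ∑ₗ-*ˡ c f []       = sym (*-zeroʳ c)
    ∑ₗ-*ˡ c f (x ∷ xs) = trans (cong (c * f x +_) (∑ₗ-*ˡ c f xs)) (sym (*-distribˡ-+ c (f x) (∑ₗ f xs)))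

    ∑ₗ-++ : ∀ (f : A → ℕ) xs ys → ∑ₗ f (xs ++ ys) ≡ ∑ₗ f xs + ∑ₗ f ys
    ∑ₗ-++ f []       ys = refl
    ∑ₗ-++ f (x ∷ xs) ys = trans (cong (f x +_) (∑ₗ-++ f xs ys)) (sym (+-assoc (f x) _ _))

    ∑ₗ-map : ∀ {B : Set} (f : A → ℕ) (g : B → A) xs → ∑ₗ f (map g xs) ≡ ∑ₗ (f ∘ g) xs
    ∑ₗ-map f g []       = refl
    ∑ₗ-map f g (x ∷ xs) = cong (f (g x) +_) (∑ₗ-map f g xs)

    ∑ₗ-concatMap : ∀ {B : Set} (f : A → ℕ) (g : B → List A) xs →
                   ∑ₗ f (concatMap g xs) ≡ ∑ₗ (λ x → ∑ₗ f (g x)) xs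
    ∑ₗ-concatMap f g []       = refl
    ∑ₗ-concatMap f g (x ∷ xs) = trans (∑ₗ-++ f (g x) _) (cong (∑ₗ f (g x) +_) (∑ₗ-concatMap f g xs))

    ∑ₗ-zero : ∀ (xs : List A) → ∑ₗ (λ _ → 0) xs ≡ 0
    ∑ₗ-zero []       = refl
    ∑ₗ-zero (x ∷ xs) = ∑ₗ-zero xs

    length-filterᵇ : ∀ (p : A → Bool) xs → length (filterᵇ p xs) ≡ ∑ₗ (𝟏 ∘ p) xs
    length-filterᵇ p [] = refl
    length-filterᵇ p (x ∷ xs) with p x
    ... | true  = cong suc (length-filterᵇ p xs)
    ... | false = length-filterᵇ p xs

  ∑ₗ-swap : ∀ {A B : Set} (f : A → B → ℕ) xs ys →
            ∑ₗ (λ x → ∑ₗ (f x) ys) xs ≡ ∑ₗ (λ y → ∑ₗ (λ x → f x y) xs) ys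
  ∑ₗ-swap f []       ys = sym (∑ₗ-zero ys)
  ∑ₗ-swap f (x ∷ xs) ys = trans (cong (∑ₗ (f x) ys +_) (∑ₗ-swap f xs ys)) (sym (∑ₗ-+ (f x) _ ys))

  ∑ₗ-allVecs-suc : ∀ {A : Set} k (f : Vec A (suc k) → ℕ) xs →
    ∑ₗ f (allVecs (suc k) xs) ≡ ∑ₗ (λ x → ∑ₗ (λ v → f (x V.∷ v)) (allVecs k xs)) xs
  ∑ₗ-allVecs-suc k f xs = trans (∑ₗ-concatMap f _ xs) (∑ₗ-cong (λ x → ∑ₗ-map f (x V.∷_) (allVecs k xs)) xs)

  𝟏-∧ : ∀ a b → 𝟏 (a ∧ b) ≡ 𝟏 a * 𝟏 b
  𝟏-∧ true  b = sym (+-identityʳ (𝟏 b))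
  𝟏-∧ false b = refl

  ∧-true : ∀ {a b} → a ∧ b ≡ true → a ≡ true × b ≡ true
  ∧-true {true} {true} eq = refl , refl

  -- Weighted closed walks and cycles

  -- In the rounding argument `m i j` is twice the probability of the arc from i to j: undecided
  -- pairs have weight 1, decided ones 0 and 2. Expectations multiplied by 2^ℓ then stay in ℕ.
  Weight : ℕ → Set
  Weight n = Fin n → Fin n → ℕ

  module _ {n : ℕ} where

    walk : Weight n → Fin n → List (Fin n) → Fin n → ℕ
    walk m x []       y = m x y
    walk m x (z ∷ zs) y = m x z * walk m z zs y

    closedWalk : Weight n → List (Fin n) → ℕ
    closedWalk m []       = 1
    closedWalk m (x ∷ xs) = walk m x xs x

    cycleWeight : Weight n → List (Fin n) → ℕ
    cycleWeight m xs = 𝟏 (distinct xs) * closedWalk m xs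

    totalWeight : ℕ → Weight n → ℕ
    totalWeight ℓ m = ∑ₗ (cycleWeight m ∘ toList) (allVecs ℓ (allFin n))

    arcs : Digraph n → Weight n
    arcs A i j = 2 * 𝟏 (A i j)

    walk-arcs : ∀ (A : Digraph n) x xs y →
                walk (arcs A) x xs y ≡
                2 ^ suc (length xs) * 𝟏 (all (λ p → A (proj₁ p) (proj₂ p)) (zip (x ∷ xs) (xs ++ [ y ])))
    walk-arcs A x []       y = cong (2 *_) (sym (trans (𝟏-∧ (A x y) true) (*-identityʳ (𝟏 (A x y)))))
    walk-arcs A x (z ∷ zs) y = trans
      (cong (arcs A x z *_) (walk-arcs A z zs y))
      (trans (lemma (𝟏 (A x z)) (2 ^ suc (length zs)) (𝟏 rest)) (cong (2 * 2 ^ suc (length zs) *_) (sym (𝟏-∧ (A x z) rest))))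
      where
      rest = all (λ p → A (proj₁ p) (proj₂ p)) (zip (z ∷ zs) (zs ++ [ y ]))
      lemma : ∀ a b c → 2 * a * (b * c) ≡ 2 * b * (a * c)
      lemma = solve-∀

    cycleWeight-arcs : ∀ (A : Digraph n) xs → cycleWeight (arcs A) xs ≡ 2 ^ length xs * 𝟏 (isCycleSeq A xs)
    cycleWeight-arcs A []       = refl
    cycleWeight-arcs A (x ∷ xs) = begin
      𝟏 d * walk (arcs A) x xs x                ≡⟨ cong (𝟏 d *_) (walk-arcs A x xs x) ⟩
      𝟏 d * (2 ^ suc (length xs) * 𝟏 w)         ≡⟨ lemma (𝟏 d) (2 ^ suc (length xs)) (𝟏 w) ⟩
      2 ^ suc (length xs) * (𝟏 d * 𝟏 w)         ≡⟨ cong (2 ^ suc (length xs) *_) (𝟏-∧ d w) ⟨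
      2 ^ suc (length xs) * 𝟏 (d ∧ w)           ∎
      where
      open ≡-Reasoning
      d = distinct (x ∷ xs)
      w = all (λ p → A (proj₁ p) (proj₂ p)) (cyclicPairs (x ∷ xs))
      lemma : ∀ a b c → a * (b * c) ≡ b * (a * c)
      lemma = solve-∀

    totalWeight-arcs : ∀ ℓ (A : Digraph n) → totalWeight ℓ (arcs A) ≡ 2 ^ ℓ * cycleSeqCount ℓ A
    totalWeight-arcs ℓ A = begin
      ∑ₗ (cycleWeight (arcs A) ∘ toList) vs              ≡⟨ ∑ₗ-cong (λ v → trans (cycleWeight-arcs A (toList v)) (cong (λ k → 2 ^ k * 𝟏 (isCycleSeq A (toList v))) (length-toList v))) vs ⟩
      ∑ₗ (λ v → 2 ^ ℓ * 𝟏 (isCycleSeq A (toList v))) vs  ≡⟨ ∑ₗ-*ˡ (2 ^ ℓ) _ vs ⟩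
      2 ^ ℓ * ∑ₗ (λ v → 𝟏 (isCycleSeq A (toList v))) vs  ≡⟨ cong (2 ^ ℓ *_) (length-filterᵇ _ vs) ⟨
      2 ^ ℓ * cycleSeqCount ℓ A                          ∎
      where
      open ≡-Reasoning
      vs = allVecs ℓ (allFin n)

    walk-mono : ∀ {m m′ : Weight n} → (∀ i j → m i j ≤ m′ i j) → ∀ x xs y → walk m x xs y ≤ walk m′ x xs y
    walk-mono m≤m′ x []       y = m≤m′ x y
    walk-mono m≤m′ x (z ∷ zs) y = *-mono-≤ (m≤m′ x z) (walk-mono m≤m′ z zs y)

    closedWalk-mono : ∀ {m m′ : Weight n} → (∀ i j → m i j ≤ m′ i j) → ∀ xs → closedWalk m xs ≤ closedWalk m′ xs
    closedWalk-mono m≤m′ []       = ≤-refl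
    closedWalk-mono m≤m′ (x ∷ xs) = walk-mono m≤m′ x xs x

    totalWeight-mono : ∀ ℓ {m m′ : Weight n} → (∀ i j → m i j ≤ m′ i j) → totalWeight ℓ m ≤ totalWeight ℓ m′
    totalWeight-mono ℓ m≤m′ = ∑ₗ-mono-≤ (λ v → *-monoʳ-≤ (𝟏 (distinct (toList v))) (closedWalk-mono m≤m′ (toList v))) (allVecs ℓ (allFin n))

    totalWeight≤closedWalks : ∀ ℓ (m : Weight n) →
      totalWeight ℓ m ≤ ∑ₗ (closedWalk m ∘ toList) (allVecs ℓ (allFin n))
    totalWeight≤closedWalks ℓ m = ∑ₗ-mono-≤ (λ v → bound (distinct (toList v)) (closedWalk m (toList v))) (allVecs ℓ (allFin n))
      where
      bound : ∀ b k → 𝟏 b * k ≤ k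
      bound true  k = ≤-reflexive (*-identityˡ k)
      bound false k = z≤n

  -- Distinct sequences

    data Distinct : List (Fin n) → Set where
      []  : Distinct []
      _∷_ : ∀ {x xs} → All (x ≢_) xs → Distinct xs → Distinct (x ∷ xs)

    fresh : ∀ (x : Fin n) xs → not (any (λ y → ⌊ x F.≟ y ⌋) xs) ≡ true → All (x ≢_) xs
    fresh x []       eq = []
    fresh x (y ∷ xs) eq with x F.≟ y
    ... | no x≢y = x≢y ∷ fresh x xs eq
    fresh x (y ∷ xs) () | yes _

    distinct⇒Distinct : ∀ xs → distinct xs ≡ true → Distinct xs
    distinct⇒Distinct []       eq = []
    distinct⇒Distinct (x ∷ xs) eq with ∧-true {not (any (λ y → ⌊ x F.≟ y ⌋) xs)} eq
    ... | eq₁ , eq₂ = fresh x xs eq₁ ∷ distinct⇒Distinct xs eq₂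

    -- The uniformly random tournament: every pair is undecided and there are no loops.
    unit : Weight n
    unit i j = 𝟏 (not ⌊ i F.≟ j ⌋)

    unit-≢ : ∀ {i j} → i ≢ j → unit i j ≡ 1
    unit-≢ {i} {j} i≢j with i F.≟ j
    ... | yes i≡j = ⊥-elim (i≢j i≡j)
    ... | no _    = refl

    walk-unit : ∀ x xs y → Distinct (x ∷ xs) → y ≢ x → All (y ≢_) xs → walk unit x xs y ≡ 1
    walk-unit x []       y _ y≢x _ = unit-≢ (y≢x ∘ sym)
    walk-unit x (z ∷ zs) y ((x≢z ∷ _) ∷ d) _ (y≢z ∷ y∉zs) =
      cong₂ _*_ (unit-≢ x≢z) (walk-unit z zs y d y≢z y∉zs)

    distinctCount : ℕ → ℕ
    distinctCount k = ∑ₗ (𝟏 ∘ distinct ∘ toList) (allVecs k (allFin n))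

    -- With at least two vertices the closing arc is not a loop, so every arc of a distinct cyclic
    -- sequence has weight 1.
    totalWeight-unit : ∀ k → distinctCount (suc (suc k)) ≤ totalWeight (suc (suc k)) unit
    totalWeight-unit k = ∑ₗ-mono-≤ bound (allVecs (suc (suc k)) (allFin n))
      where
      bound : ∀ (v : Vec (Fin n) (suc (suc k))) → 𝟏 (distinct (toList v)) ≤ cycleWeight unit (toList v)
      bound (x V.∷ y V.∷ v) with distinct (x ∷ y ∷ toList v) in eq
      ... | false = z≤n
      ... | true with distinct⇒Distinct (x ∷ y ∷ toList v) eq
      ...   | (x≢y ∷ x∉v) ∷ d = ≤-reflexive (sym (trans (+-identityʳ _)
                (cong₂ _*_ (unit-≢ x≢y) (walk-unit y (toList v) x d x≢y x∉v))))

    occurrences≤1 : ∀ {k} (g : Fin k → Fin n) → (∀ {i j} → g i ≡ g j → i ≡ j) → ∀ y →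
                    ∑ₗ (λ x → 𝟏 ⌊ x F.≟ y ⌋) (tabulate g) ≤ 1
    occurrences≤1 {zero}  g inj y = z≤n
    occurrences≤1 {suc k} g inj y with g zero F.≟ y
    ... | no _     = occurrences≤1 (g ∘ suc) (suc-injective ∘ inj) y
    ... | yes refl = s≤s (≤-reflexive (absent (g ∘ suc) λ i eq → case-zero (inj eq)))
      where
      case-zero : ∀ {i : Fin k} → suc i ≡ zero → ⊥
      case-zero ()
      absent : ∀ {k} (h : Fin k → Fin n) → (∀ i → h i ≢ y) → ∑ₗ (λ x → 𝟏 ⌊ x F.≟ y ⌋) (tabulate h) ≡ 0
      absent {zero}  h h≢y = refl
      absent {suc k} h h≢y with h zero F.≟ y
      ... | yes eq = ⊥-elim (h≢y zero eq)
      ... | no _   = absent (h ∘ suc) (h≢y ∘ suc)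

    ∑ₗ-one : ∀ {k} (g : Fin k → Fin n) → ∑ₗ (λ _ → 1) (tabulate g) ≡ k
    ∑ₗ-one {zero}  g = refl
    ∑ₗ-one {suc k} g = cong suc (∑ₗ-one (g ∘ suc))

    fresh-count : ∀ ys → n ≤ ∑ₗ (λ x → 𝟏 (not (any (λ y → ⌊ x F.≟ y ⌋) ys))) (allFin n) + length ys
    fresh-count [] = ≤-reflexive (sym (trans (+-identityʳ _) (∑ₗ-one id)))
    fresh-count (y ∷ ys) = begin
      n
        ≤⟨ fresh-count ys ⟩
      ∑ₗ (λ x → 𝟏 (not (r x))) (allFin n) + length ys
        ≤⟨ +-monoˡ-≤ (length ys) (∑ₗ-mono-≤ (λ x → split ⌊ x F.≟ y ⌋ (r x)) (allFin n)) ⟩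
      ∑ₗ (λ x → 𝟏 (not (⌊ x F.≟ y ⌋ ∨ r x)) + 𝟏 ⌊ x F.≟ y ⌋) (allFin n) + length ys
        ≡⟨ cong (_+ length ys) (∑ₗ-+ _ _ (allFin n)) ⟩
      S + ∑ₗ (λ x → 𝟏 ⌊ x F.≟ y ⌋) (allFin n) + length ys
        ≤⟨ +-monoˡ-≤ (length ys) (+-monoʳ-≤ S (occurrences≤1 id id y)) ⟩
      S + 1 + length ys
        ≡⟨ +-assoc S 1 (length ys) ⟩
      S + suc (length ys) ∎
      where
      open ≤-Reasoning
      r : Fin n → Bool
      r x = any (λ y → ⌊ x F.≟ y ⌋) ys
      S = ∑ₗ (λ x → 𝟏 (not (⌊ x F.≟ y ⌋ ∨ r x))) (allFin n)
      split : ∀ a b → 𝟏 (not b) ≤ 𝟏 (not (a ∨ b)) + 𝟏 a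
      split true  true  = z≤n
      split true  false = s≤s z≤n
      split false true  = z≤n
      split false false = s≤s z≤n

    -- A sequence of length k excludes at most k choices for the vertex put in front, which leaves
    -- at least n ∸ k of them.
    P′≤distinctCount : ∀ k → n P′ k ≤ distinctCount k
    P′≤distinctCount zero = ≤-refl
    P′≤distinctCount (suc k) = begin
      (n ∸ k) * (n P′ k)
        ≤⟨ *-monoʳ-≤ (n ∸ k) (P′≤distinctCount k) ⟩
      (n ∸ k) * ∑ₗ (𝟏 ∘ distinct ∘ toList) vs
        ≡⟨ ∑ₗ-*ˡ (n ∸ k) _ vs ⟨
      ∑ₗ (λ v → (n ∸ k) * 𝟏 (distinct (toList v))) vs
        ≤⟨ ∑ₗ-mono-≤ (λ v → ≤-trans (*-monoˡ-≤ (𝟏 (distinct (toList v))) (enough v))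
             (≤-reflexive (trans (*-comm _ (𝟏 (distinct (toList v)))) (trans (sym (∑ₗ-*ˡ (𝟏 (distinct (toList v))) _ (allFin n)))
               (∑ₗ-cong (λ x → trans (*-comm (𝟏 (distinct (toList v))) _) (sym (𝟏-∧ (free v x) _))) (allFin n)))))) vs ⟩
      ∑ₗ (λ v → ∑ₗ (λ x → 𝟏 (distinct (x ∷ toList v))) (allFin n)) vs
        ≡⟨ ∑ₗ-swap (λ v x → 𝟏 (distinct (x ∷ toList v))) vs (allFin n) ⟩
      ∑ₗ (λ x → ∑ₗ (λ v → 𝟏 (distinct (x ∷ toList v))) vs) (allFin n)
        ≡⟨ ∑ₗ-allVecs-suc k (𝟏 ∘ distinct ∘ toList) (allFin n) ⟨
      distinctCount (suc k) ∎
      where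
      open ≤-Reasoning
      vs = allVecs k (allFin n)
      free : Vec (Fin n) k → Fin n → Bool
      free v x = not (any (λ y → ⌊ x F.≟ y ⌋) (toList v))
      enough : ∀ v → n ∸ k ≤ ∑ₗ (λ x → 𝟏 (free v x)) (allFin n)
      enough v = m≤n+o⇒m∸n≤o n k (subst (n ≤_) (trans (+-comm S (length (toList v))) (cong (_+ S) (length-toList v))) (fresh-count (toList v)))
        where S = ∑ₗ (λ x → 𝟏 (free v x)) (allFin n)

  -- Rounding half-oriented pairs: on a sequence of distinct vertices a pair {a,b} is used at most
  -- once, so the weight of a cycle is affine in the orientation of that pair.
  module Orient {n : ℕ} (m : Weight n) (a b : Fin n) (a≢b : a ≢ b) (mab≡1 : m a b ≡ 1) (mba≡1 : m b a ≡ 1) where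

    Pair : Fin n → Fin n → Set
    Pair i j = (i ≡ a × j ≡ b) ⊎ (i ≡ b × j ≡ a)

    set : ℕ → ℕ → Weight n
    set p q i j with i F.≟ a | j F.≟ b | i F.≟ b | j F.≟ a
    ... | yes _ | yes _ | _     | _     = p
    ... | yes _ | no  _ | yes _ | yes _ = q
    ... | yes _ | no  _ | yes _ | no  _ = m i j
    ... | yes _ | no  _ | no  _ | _     = m i j
    ... | no  _ | _     | yes _ | yes _ = q
    ... | no  _ | _     | yes _ | no  _ = m i j
    ... | no  _ | _     | no  _ | _     = m i j

    set-ab : ∀ p q → set p q a b ≡ p
    set-ab p q with a F.≟ a | b F.≟ b
    ... | yes _ | yes _ = refl
    ... | no ¬p | _     = ⊥-elim (¬p refl)
    ... | yes _ | no ¬p = ⊥-elim (¬p refl)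

    set-ba : ∀ p q → set p q b a ≡ q
    set-ba p q with b F.≟ a | a F.≟ b | b F.≟ b | a F.≟ a
    ... | yes b≡a | _ | _     | _     = ⊥-elim (a≢b (sym b≡a))
    ... | no _    | _ | yes _ | yes _ = refl
    ... | no _    | _ | no ¬p | _     = ⊥-elim (¬p refl)
    ... | no _    | _ | yes _ | no ¬p = ⊥-elim (¬p refl)

    set-other : ∀ p q {i j} → ¬ Pair i j → set p q i j ≡ m i j
    set-other p q {i} {j} ¬pair with i F.≟ a | j F.≟ b | i F.≟ b | j F.≟ a
    ... | yes i≡a | yes j≡b | _       | _       = ⊥-elim (¬pair (inj₁ (i≡a , j≡b)))
    ... | yes _   | no  _   | yes i≡b | yes j≡a = ⊥-elim (¬pair (inj₂ (i≡b , j≡a)))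
    ... | yes _   | no  _   | yes _   | no  _   = refl
    ... | yes _   | no  _   | no  _   | _       = refl
    ... | no  _   | _       | yes i≡b | yes j≡a = ⊥-elim (¬pair (inj₂ (i≡b , j≡a)))
    ... | no  _   | _       | yes _   | no  _   = refl
    ... | no  _   | _       | no  _   | _       = refl

    pair? : ∀ i j → Dec (Pair i j)
    pair? i j = (i F.≟ a ×-dec j F.≟ b) ⊎-dec (i F.≟ b ×-dec j F.≟ a)

    m⁺ m⁻ : Weight n
    m⁺ = set 2 0
    m⁻ = set 0 2

    -- The weight m is the midpoint of its two roundings `m⁺` and `m⁻`. Hence `Affine f` is the
    -- midpoint identity satisfied by any f that is affine in the orientation of the chosen pair.
    Const Affine : (Weight n → ℕ) → Set
    Const f  = f m⁺ ≡ f m × f m⁻ ≡ f m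
    Affine f = f m⁺ + f m⁻ ≡ 2 * f m

    const*const : ∀ {f g} → Const f → Const g → Const (λ w → f w * g w)
    const*const (f⁺ , f⁻) (g⁺ , g⁻) = cong₂ _*_ f⁺ g⁺ , cong₂ _*_ f⁻ g⁻

    const*affine : ∀ {f g} → Const f → Affine g → Affine (λ w → f w * g w)
    const*affine {f} {g} (f⁺ , f⁻) g-affine = begin
      f m⁺ * g m⁺ + f m⁻ * g m⁻   ≡⟨ cong₂ (λ x y → x * g m⁺ + y * g m⁻) f⁺ f⁻ ⟩
      f m * g m⁺ + f m * g m⁻     ≡⟨ *-distribˡ-+ (f m) (g m⁺) (g m⁻) ⟨
      f m * (g m⁺ + g m⁻)         ≡⟨ cong (f m *_) g-affine ⟩
      f m * (2 * g m)             ≡⟨ lemma (f m) (g m) ⟩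
      2 * (f m * g m)             ∎
      where
      open ≡-Reasoning
      lemma : ∀ x y → x * (2 * y) ≡ 2 * (x * y)
      lemma = solve-∀

    affine*const : ∀ {f g} → Affine f → Const g → Affine (λ w → f w * g w)
    affine*const {f} {g} f-affine g-const = trans
      (cong₂ _+_ (*-comm (f m⁺) (g m⁺)) (*-comm (f m⁻) (g m⁻)))
      (trans (const*affine {g} {f} g-const f-affine) (cong (2 *_) (*-comm (g m) (f m))))

    edge-const : ∀ {i j} → ¬ Pair i j → Const (λ w → w i j)
    edge-const ¬pair = set-other 2 0 ¬pair , set-other 0 2 ¬pair

    edge-affine : ∀ i j → Affine (λ w → w i j)
    edge-affine i j with pair? i j
    ... | yes (inj₁ (refl , refl)) = trans (cong₂ _+_ (set-ab 2 0) (set-ab 0 2)) (cong (2 *_) (sym mab≡1))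
    ... | yes (inj₂ (refl , refl)) = trans (cong₂ _+_ (set-ba 2 0) (set-ba 0 2)) (cong (2 *_) (sym mba≡1))
    ... | no ¬pair with edge-const ¬pair
    ...   | eq⁺ , eq⁻ = trans (cong₂ _+_ eq⁺ eq⁻) (cong (m i j +_) (sym (+-identityʳ (m i j))))

    Pair-meets : ∀ {c z i j} → Pair c z → Pair i j → c ≡ i ⊎ c ≡ j
    Pair-meets (inj₁ (refl , _)) (inj₁ (refl , _)) = inj₁ refl
    Pair-meets (inj₁ (refl , _)) (inj₂ (_ , refl)) = inj₂ refl
    Pair-meets (inj₂ (refl , _)) (inj₁ (_ , refl)) = inj₂ refl
    Pair-meets (inj₂ (refl , _)) (inj₂ (refl , _)) = inj₁ refl

    Pair-partner : ∀ {c z y} → Pair c z → Pair y c → y ≡ z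
    Pair-partner (inj₁ (refl , refl)) (inj₁ (_ , refl)) = ⊥-elim (a≢b refl)
    Pair-partner (inj₁ (_ , refl))    (inj₂ (refl , _)) = refl
    Pair-partner (inj₂ (_ , refl))    (inj₁ (refl , _)) = refl
    Pair-partner (inj₂ (refl , refl)) (inj₂ (_ , refl)) = ⊥-elim (a≢b refl)

    avoids : ∀ {c z i j} → Pair c z → c ≢ i → c ≢ j → ¬ Pair i j
    avoids pc c≢i c≢j pij with Pair-meets pc pij
    ... | inj₁ c≡i = c≢i c≡i
    ... | inj₂ c≡j = c≢j c≡j

    walk-const : ∀ {c z} → Pair c z → ∀ x xs y → c ≢ x → All (c ≢_) xs → c ≢ y →
                 Const (λ w → walk w x xs y)
    walk-const pc x []       y c≢x _             c≢y = edge-const (avoids pc c≢x c≢y)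
    walk-const pc x (v ∷ vs) y c≢x (c≢v ∷ c∉vs) c≢y =
      const*const {λ w → w x v} {λ w → walk w v vs y} (edge-const (avoids pc c≢x c≢v)) (walk-const pc v vs y c≢v c∉vs c≢y)

    -- If the first arc belongs to the pair, the rest of the walk never meets x again and is
    -- constant. Otherwise the first arc is the constant factor.
    walk-affine : ∀ x xs y → Distinct (x ∷ xs) → y ≢ x → All (y ≢_) xs → Affine (λ w → walk w x xs y)
    walk-affine x []       y _ _ _ = edge-affine x y
    walk-affine x (v ∷ vs) y ((x≢v ∷ x∉vs) ∷ d) y≢x (y≢v ∷ y∉vs) with pair? x v
    ... | yes pair = affine*const {λ w → w x v} {λ w → walk w v vs y} (edge-affine x v)
                       (walk-const pair v vs y x≢v x∉vs (y≢x ∘ sym))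
    ... | no ¬pair = const*affine {λ w → w x v} {λ w → walk w v vs y} (edge-const ¬pair)
                       (walk-affine v vs y d y≢v y∉vs)

    -- The walk does come back to c, but an arc of the pair that ends in c would have to start in z,
    -- which the walk avoids.
    return-const : ∀ {c z} → Pair c z → ∀ y ys → c ≢ y → All (c ≢_) ys → z ≢ y → All (z ≢_) ys →
                   Const (λ w → walk w y ys c)
    return-const pc y []       c≢y _ z≢y _ = edge-const (λ pyc → z≢y (sym (Pair-partner pc pyc)))
    return-const pc y (v ∷ vs) c≢y (c≢v ∷ c∉vs) z≢y (z≢v ∷ z∉vs) =
      const*const {λ w → w y v} {λ w → walk w v vs _} (edge-const (avoids pc c≢y c≢v)) (return-const pc v vs c≢v c∉vs z≢v z∉vs)

    -- A third vertex is essential: a closed walk of length two uses both directions of its pair, so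
    -- its weight is quadratic in that orientation.
    cycle-affine : ∀ x y z zs → Distinct (x ∷ y ∷ z ∷ zs) → Affine (λ w → closedWalk w (x ∷ y ∷ z ∷ zs))
    cycle-affine x y z zs ((x≢y ∷ x≢z ∷ x∉zs) ∷ (y≢z ∷ y∉zs) ∷ d) with pair? x y
    ... | no ¬pair = const*affine {λ w → w x y} {λ w → walk w y (z ∷ zs) x} (edge-const ¬pair)
                       (walk-affine y (z ∷ zs) x ((y≢z ∷ y∉zs) ∷ d) x≢y (x≢z ∷ x∉zs))
    ... | yes pair = affine*const {λ w → w x y} {λ w → walk w y (z ∷ zs) x} (edge-affine x y)
                       (const*const {λ w → w y z} {λ w → walk w z zs x} (edge-const (avoids pair x≢y x≢z))
                         (return-const pair z zs x≢z x∉zs y≢z y∉zs))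

    cycleWeight-affine : ∀ {ℓ} (v : Vec (Fin n) (3 + ℓ)) → Affine (λ w → cycleWeight w (toList v))
    cycleWeight-affine (x V.∷ y V.∷ z V.∷ v) with distinct (x ∷ y ∷ z ∷ toList v) in eq
    ... | false = refl
    ... | true  = const*affine {λ _ → 1} {λ w → closedWalk w (x ∷ y ∷ z ∷ toList v)} (refl , refl)
                    (cycle-affine x y z (toList v) (distinct⇒Distinct _ eq))

    totalWeight-affine : ∀ ℓ → Affine (totalWeight (3 + ℓ))
    totalWeight-affine ℓ = begin
      totalWeight (3 + ℓ) m⁺ + totalWeight (3 + ℓ) m⁻
        ≡⟨ ∑ₗ-+ (cycleWeight m⁺ ∘ toList) (cycleWeight m⁻ ∘ toList) vs ⟨
      ∑ₗ (λ v → cycleWeight m⁺ (toList v) + cycleWeight m⁻ (toList v)) vs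
        ≡⟨ ∑ₗ-cong cycleWeight-affine vs ⟩
      ∑ₗ (λ v → 2 * cycleWeight m (toList v)) vs
        ≡⟨ ∑ₗ-*ˡ 2 (cycleWeight m ∘ toList) vs ⟩
      2 * totalWeight (3 + ℓ) m ∎
      where
      open ≡-Reasoning
      vs = allVecs (3 + ℓ) (allFin n)

    -- The current value is the mean of the two rounded ones, so they cannot both be smaller.
    better : ∀ ℓ → totalWeight (3 + ℓ) m ≤ totalWeight (3 + ℓ) m⁺ ⊎ totalWeight (3 + ℓ) m ≤ totalWeight (3 + ℓ) m⁻
    better ℓ with ≤-total (W m) (W m⁺)
      where W = totalWeight (3 + ℓ)
    ... | inj₁ ≤⁺ = inj₁ ≤⁺
    ... | inj₂ ≥⁺ = inj₂ (+-cancelˡ-≤ (W m) _ _ (begin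
        W m + W m       ≡⟨ cong (W m +_) (+-identityʳ (W m)) ⟨
        2 * W m         ≡⟨ totalWeight-affine ℓ ⟨
        W m⁺ + W m⁻     ≤⟨ +-monoˡ-≤ (W m⁻) ≥⁺ ⟩
        W m + W m⁻      ∎))
      where
      open ≤-Reasoning
      W = totalWeight (3 + ℓ)

  -- From the random orientation to a tournament

  record Valid {n} (m : Weight n) : Set where
    field
      loopless : ∀ i → m i i ≡ 0
      pairs    : ∀ {i j} → i ≢ j → m i j + m j i ≡ 2

  module _ {n : ℕ} where

    unit-valid : Valid (unit {n})
    unit-valid = record { loopless = loop ; pairs = λ i≢j → cong₂ _+_ (unit-≢ i≢j) (unit-≢ (i≢j ∘ sym)) }
      where
      loop : ∀ i → unit i i ≡ 0
      loop i with i F.≟ i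
      ... | yes _  = refl
      ... | no i≢i = ⊥-elim (i≢i refl)

    -- Pairs that are already decided stay decided, so one pass over a list of pairs settles all of
    -- them.
    Extends : Weight n → Weight n → Set
    Extends m m′ = ∀ i j → m i j ≢ 1 → m′ i j ≢ 1

    module _ {m : Weight n} (valid : Valid m) {a b : Fin n} (a≢b : a ≢ b) (mab≡1 : m a b ≡ 1) where

      private
        mba≡1 : m b a ≡ 1
        mba≡1 = +-cancelˡ-≡ 1 _ _ (trans (cong (_+ m b a) (sym mab≡1)) (Valid.pairs valid a≢b))

      open Orient m a b a≢b mab≡1 mba≡1

      private
        Pair-swap : ∀ {i j} → Pair i j → Pair j i
        Pair-swap (inj₁ (i≡a , j≡b)) = inj₂ (j≡b , i≡a)
        Pair-swap (inj₂ (i≡b , j≡a)) = inj₁ (j≡a , i≡b)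

        set-valid : ∀ p q → p + q ≡ 2 → Valid (set p q)
        set-valid p q p+q≡2 = record { loopless = loop ; pairs = sums }
          where
          loop : ∀ i → set p q i i ≡ 0
          loop i = trans (set-other p q λ { (inj₁ (i≡a , i≡b)) → a≢b (trans (sym i≡a) i≡b)
                                          ; (inj₂ (i≡b , i≡a)) → a≢b (trans (sym i≡a) i≡b) })
                         (Valid.loopless valid i)
          sums : ∀ {i j} → i ≢ j → set p q i j + set p q j i ≡ 2
          sums {i} {j} i≢j with pair? i j
          ... | yes (inj₁ (refl , refl)) = trans (cong₂ _+_ (set-ab p q) (set-ba p q)) p+q≡2
          ... | yes (inj₂ (refl , refl)) = trans (cong₂ _+_ (set-ba p q) (set-ab p q)) (trans (+-comm q p) p+q≡2)
          ... | no ¬pair = trans (cong₂ _+_ (set-other p q ¬pair) (set-other p q (¬pair ∘ Pair-swap))) (Valid.pairs valid i≢j)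

        set-extends : ∀ p q → p ≢ 1 → q ≢ 1 → Extends m (set p q)
        set-extends p q p≢1 q≢1 i j mij≢1 with pair? i j
        ... | yes (inj₁ (refl , refl)) = ⊥-elim (mij≢1 mab≡1)
        ... | yes (inj₂ (refl , refl)) = ⊥-elim (mij≢1 mba≡1)
        ... | no ¬pair = mij≢1 ∘ trans (sym (set-other p q ¬pair))

      orient : ∀ ℓ → ∃[ m′ ] (Valid m′ × totalWeight (3 + ℓ) m ≤ totalWeight (3 + ℓ) m′ × m′ a b ≢ 1 × Extends m m′)
      orient ℓ with better ℓ
      ... | inj₁ ≤⁺ = m⁺ , set-valid 2 0 refl , ≤⁺ , (λ eq → 2≢1 (trans (sym (set-ab 2 0)) eq)) , set-extends 2 0 (λ ()) (λ ())
        where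
        2≢1 : 2 ≢ 1
        2≢1 ()
      ... | inj₂ ≤⁻ = m⁻ , set-valid 0 2 refl , ≤⁻ , (λ eq → 0≢1 (trans (sym (set-ab 0 2)) eq)) , set-extends 0 2 (λ ()) (λ ())
        where
        0≢1 : 0 ≢ 1
        0≢1 ()

    orientAll : ∀ ℓ (L : List (Fin n × Fin n)) (m : Weight n) → Valid m →
      ∃[ m′ ] (Valid m′ × totalWeight (3 + ℓ) m ≤ totalWeight (3 + ℓ) m′ ×
               (∀ {i j} → (i , j) ∈ L → m′ i j ≢ 1) × Extends m m′)
    orientAll ℓ [] m valid = m , valid , ≤-refl , (λ ()) , λ i j → id
    orientAll ℓ ((a , b) ∷ L) m valid with m a b ≟ 1
    ... | no mab≢1 with orientAll ℓ L m valid
    ...   | m′ , valid′ , W≤ , done , ext =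
            m′ , valid′ , W≤ , (λ { (here refl) → ext a b mab≢1 ; (there e) → done e }) , ext
    orientAll ℓ ((a , b) ∷ L) m valid | yes mab≡1 with orient valid a≢b mab≡1 ℓ
      where
      a≢b : a ≢ b
      a≢b refl with trans (sym mab≡1) (Valid.loopless valid a)
      ... | ()
    ...   | m₁ , valid₁ , W≤₁ , ab≢1 , ext₁ with orientAll ℓ L m₁ valid₁
    ...     | m′ , valid′ , W≤ , done , ext =
              m′ , valid′ , ≤-trans W≤₁ W≤ , (λ { (here refl) → ext a b ab≢1 ; (there e) → done e })
                 , λ i j → ext i j ∘ ext₁ i j

    IsTournament : Digraph n → Set
    IsTournament A = (∀ i → A i i ≡ false) × (∀ {i j} → i ≢ j → A i j xor A j i ≡ true)

    manyCycles : ∀ ℓ → ∃[ A ] (IsTournament A × n P′ (3 + ℓ) ≤ 2 ^ (3 + ℓ) * cycleSeqCount (3 + ℓ) A)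
    manyCycles ℓ with orientAll ℓ (cartesianProduct (allFin n) (allFin n)) unit unit-valid
    ... | m , valid , W≤ , done , _ = A , (loop , arc) , (begin
        n P′ (3 + ℓ)                            ≤⟨ P′≤distinctCount {n} (3 + ℓ) ⟩
        distinctCount {n} (3 + ℓ)               ≤⟨ totalWeight-unit {n} (1 + ℓ) ⟩
        totalWeight (3 + ℓ) (unit {n})          ≤⟨ W≤ ⟩
        totalWeight (3 + ℓ) m                   ≤⟨ totalWeight-mono (3 + ℓ) m≤arcs ⟩
        totalWeight (3 + ℓ) (arcs A)            ≡⟨ totalWeight-arcs (3 + ℓ) A ⟩
        2 ^ (3 + ℓ) * cycleSeqCount (3 + ℓ) A   ∎)
      where
      open ≤-Reasoning
      A : Digraph n
      -- No weight 1 survives the rounding and every pair sums to 2, so off the diagonal m takes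
      -- only the values 0 and 2. It is therefore the doubled adjacency matrix of this A.
      A i j = m i j ≡ᵇ 2
      m≢1 : ∀ i j → m i j ≢ 1
      m≢1 i j = done (∈-cartesianProduct⁺ (∈-allFin i) (∈-allFin j))
      loop : ∀ i → A i i ≡ false
      loop i = cong (_≡ᵇ 2) (Valid.loopless valid i)
      arc : ∀ {i j} → i ≢ j → A i j xor A j i ≡ true
      arc {i} {j} i≢j = values (m i j) (m j i) (m≢1 i j) (Valid.pairs valid i≢j)
        where
        values : ∀ x y → x ≢ 1 → x + y ≡ 2 → ((x ≡ᵇ 2) xor (y ≡ᵇ 2)) ≡ true
        values 0 .2 x≢1 refl = refl
        values 1 y  x≢1 eq   = ⊥-elim (x≢1 refl)
        values 2 0  x≢1 refl = refl
      m≤2 : ∀ i j → m i j ≤ 2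
      m≤2 i j with i F.≟ j
      ... | yes refl = subst (_≤ 2) (sym (Valid.loopless valid i)) z≤n
      ... | no i≢j   = subst (m i j ≤_) (Valid.pairs valid i≢j) (m≤m+n (m i j) (m j i))
      m≤arcs : ∀ i j → m i j ≤ arcs A i j
      m≤arcs i j = values (m i j) (m≢1 i j) (m≤2 i j)
        where
        values : ∀ x → x ≢ 1 → x ≤ 2 → x ≤ 2 * 𝟏 (x ≡ᵇ 2)
        values 0 _ _ = z≤n
        values 1 x≢1 _ = ⊥-elim (x≢1 refl)
        values 2 _ _ = ≤-refl
        values (suc (suc (suc _))) _ (s≤s (s≤s ()))

  -- The maximum over the enumerated tournaments

  module _ {A : Set} (p : A → Bool) where

    all-tabulate⁺ : ∀ {k} (g : Fin k → A) → (∀ i → p (g i) ≡ true) → all p (tabulate g) ≡ true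
    all-tabulate⁺ {zero}  g h = refl
    all-tabulate⁺ {suc k} g h = cong₂ _∧_ (h zero) (all-tabulate⁺ (g ∘ suc) (h ∘ suc))

    all-tabulate⁻ : ∀ {k} (g : Fin k → A) → all p (tabulate g) ≡ true → ∀ i → p (g i) ≡ true
    all-tabulate⁻ g h zero    = proj₁ (∧-true h)
    all-tabulate⁻ g h (suc i) = all-tabulate⁻ (g ∘ suc) (proj₂ (∧-true {p (g zero)} h)) i

  ∈-allVecs : ∀ {A : Set} {xs : List A} → (∀ x → x ∈ xs) → ∀ {k} (v : Vec A k) → v ∈ allVecs k xs
  ∈-allVecs total V.[]      = here refl
  ∈-allVecs {xs = xs} total (x V.∷ v) =
    ∈-concat⁺′ (∈-map⁺ (x V.∷_) (∈-allVecs total v)) (∈-map⁺ (λ x → map (x V.∷_) (allVecs _ xs)) (total x))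

  foldr-⊔-preserves : ∀ {A : Set} (Q : ℕ → Set) (f : A → ℕ) xs → Q 0 → (∀ {x} → x ∈ xs → Q (f x)) → Q (foldr _⊔_ 0 (map f xs))
  foldr-⊔-preserves Q f []       p₀ ps = p₀
  foldr-⊔-preserves Q f (x ∷ xs) p₀ ps with ⊔-sel (f x) (foldr _⊔_ 0 (map f xs))
  ... | inj₁ eq = subst Q (sym eq) (ps (here refl))
  ... | inj₂ eq = subst Q (sym eq) (foldr-⊔-preserves Q f xs p₀ (ps ∘ there))

  ≤-foldr-⊔ : ∀ {A : Set} (f : A → ℕ) {x} xs → x ∈ xs → f x ≤ foldr _⊔_ 0 (map f xs)
  ≤-foldr-⊔ f (x ∷ xs) (here refl) = m≤m⊔n (f x) _
  ≤-foldr-⊔ f (x ∷ xs) (there x∈)  = ≤-trans (≤-foldr-⊔ f xs x∈) (m≤n⊔m (f x) _)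

  module _ {n : ℕ} where

    private
      entry : Digraph n → Fin n → Fin n → Bool
      entry A i j = if ⌊ i F.≟ j ⌋ then not (A i j) else (A i j xor A j i)

    isTournament⁺ : ∀ (A : Digraph n) → IsTournament A → isTournament A ≡ true
    isTournament⁺ A (loop , arc) = all-tabulate⁺ _ id λ i → all-tabulate⁺ _ id λ j → go i j
      where
      go : ∀ i j → entry A i j ≡ true
      go i j with i F.≟ j
      ... | yes refl = cong not (loop i)
      ... | no i≢j   = arc i≢j

    isTournament⁻ : ∀ (A : Digraph n) → isTournament A ≡ true → IsTournament A
    isTournament⁻ A h = loop , arc
      where
      entries : ∀ i j → entry A i j ≡ true
      entries i j = all-tabulate⁻ _ id (all-tabulate⁻ _ id h i) j
      loop : ∀ i → A i i ≡ false
      loop i with A i i | i F.≟ i | entries i i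
      ... | false | _       | _ = refl
      ... | true  | no i≢i  | _ = ⊥-elim (i≢i refl)
      arc : ∀ {i j} → i ≢ j → A i j xor A j i ≡ true
      arc {i} {j} i≢j with i F.≟ j | entries i j
      ... | yes i≡j | _ = ⊥-elim (i≢j i≡j)
      ... | no _    | h = h

    ∈-tournaments⁻ : ∀ {A : Digraph n} → A ∈ tournaments n → IsTournament A
    ∈-tournaments⁻ {A} A∈ = isTournament⁻ A (Equivalence.to T-≡ (proj₂ (∈-filter⁻ (T? ∘ isTournament) {xs = allDigraphs n} A∈)))

    -- The list contains a pointwise equal copy of A rather than A itself.
    ∈-tournaments⁺ : ∀ (A : Digraph n) → IsTournament A → ∃[ A′ ] (A′ ∈ tournaments n × (∀ i j → A′ i j ≡ A i j))
    ∈-tournaments⁺ A (loop , arc) = A′ , ∈-filter⁺ (T? ∘ isTournament) A′∈ (Equivalence.from T-≡ (isTournament⁺ A′ tour)) , A′≗A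
      where
      M : Vec (Vec Bool n) n
      M = V.tabulate λ i → V.tabulate (A i)
      A′ : Digraph n
      A′ i j = V.lookup (V.lookup M i) j
      A′≗A : ∀ i j → A′ i j ≡ A i j
      A′≗A i j = trans (cong (λ r → V.lookup r j) (lookup∘tabulate _ i)) (lookup∘tabulate (A i) j)
      bools : ∀ b → b ∈ true ∷ false ∷ []
      bools true  = here refl
      bools false = there (here refl)
      A′∈ : A′ ∈ allDigraphs n
      A′∈ = ∈-map⁺ (λ M i j → V.lookup (V.lookup M i) j) (∈-allVecs (∈-allVecs bools) M)
      tour : IsTournament A′
      tour = (λ i → trans (A′≗A i i) (loop i))
           , λ {i} {j} i≢j → trans (cong₂ _xor_ (A′≗A i j) (A′≗A j i)) (arc i≢j)

    -- The maximum is either the default 0 or the value of some listed tournament, and rounding down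
    -- in `numCycles` works in the favour of an upper bound.
    maxCycles-upper : ∀ k b → (∀ A → IsTournament {n} A → 2 ^ suc k * cycleSeqCount (suc k) A ≤ b) →
                      2 ^ suc k * (maxCycles n (suc k) * suc k) ≤ b
    maxCycles-upper k b bound = foldr-⊔-preserves (λ c → 2 ^ suc k * (c * suc k) ≤ b) (numCycles (suc k)) (tournaments n)
      (subst (_≤ b) (sym (*-zeroʳ (2 ^ suc k))) z≤n)
      (λ {A} A∈ → ≤-trans (*-monoʳ-≤ (2 ^ suc k) (m/n*n≤m (cycleSeqCount (suc k) A) (suc k))) (bound A (∈-tournaments⁻ A∈)))

    -- The additive term covers the remainder, smaller than ℓ, of the division in `numCycles`. It
    -- does not depend on n and so is negligible in the limit.
    maxCycles-lower : ∀ k → let ℓ = 3 + k in n P′ ℓ ≤ 2 ^ ℓ * (maxCycles n ℓ * ℓ) + 2 ^ ℓ * ℓ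
    maxCycles-lower k with manyCycles {n} k
    ... | A , tour , many with ∈-tournaments⁺ A tour
    ...   | A′ , A′∈ , A′≗A = begin
        n P′ ℓ                                        ≤⟨ many ⟩
        2 ^ ℓ * cycleSeqCount ℓ A                     ≡⟨ totalWeight-arcs ℓ A ⟨
        totalWeight ℓ (arcs A)                        ≤⟨ totalWeight-mono ℓ (λ i j → ≤-reflexive (cong (λ b → 2 * 𝟏 b) (sym (A′≗A i j)))) ⟩
        totalWeight ℓ (arcs A′)                       ≡⟨ totalWeight-arcs ℓ A′ ⟩
        2 ^ ℓ * c                                     ≤⟨ *-monoʳ-≤ (2 ^ ℓ) c≤ ⟩
        2 ^ ℓ * (maxCycles n ℓ * ℓ + ℓ)               ≡⟨ *-distribˡ-+ (2 ^ ℓ) (maxCycles n ℓ * ℓ) ℓ ⟩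
        2 ^ ℓ * (maxCycles n ℓ * ℓ) + 2 ^ ℓ * ℓ       ∎
      where
      open ≤-Reasoning
      ℓ = 3 + k
      c = cycleSeqCount ℓ A′
      c≤ : c ≤ maxCycles n ℓ * ℓ + ℓ
      c≤ = ≤-trans (≤-reflexive (trans (m≡m%n+[m/n]*n c ℓ) (+-comm _ (numCycles ℓ A′ * ℓ))))
        (+-mono-≤ (*-monoˡ-≤ ℓ (≤-foldr-⊔ (numCycles ℓ) (tournaments n) A′∈)) (<⇒≤ (m%n<n c ℓ)))

  -- Falling factorials

  P′≤^ : ∀ n k → n P′ k ≤ n ^ k
  P′≤^ n zero    = ≤-refl
  P′≤^ n (suc k) = *-mono-≤ (m∸n≤m n k) (P′≤^ n k)

  -- Multiplied through by n so that no predecessor of the exponent occurs.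
  ^≤P′ : ∀ n k → n * n ^ k ≤ n * (n P′ k) + k * k * n ^ k
  ^≤P′ n zero    = ≤-reflexive (sym (+-identityʳ _))
  ^≤P′ n (suc k) = begin
    n * (n * n ^ k)
      ≤⟨ *-monoʳ-≤ n (^≤P′ n k) ⟩
    n * (n * p + k * k * n ^ k)
      ≤⟨ *-monoʳ-≤ n (+-monoˡ-≤ (k * k * n ^ k) split) ⟩
    n * ((n ∸ k) * p + k * n ^ k + k * k * n ^ k)
      -- The slack k + 1 completes k² + k to (k+1)².
      ≤⟨ m≤m+n _ (suc k * (n * n ^ k)) ⟩
    n * ((n ∸ k) * p + k * n ^ k + k * k * n ^ k) + suc k * (n * n ^ k)
      ≡⟨ lemma n k ((n ∸ k) * p) (n ^ k) ⟩
    n * ((n ∸ k) * p) + suc k * suc k * (n * n ^ k) ∎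
    where
    open ≤-Reasoning
    p = n P′ k
    split : n * p ≤ (n ∸ k) * p + k * n ^ k
    split = begin
      n * p                     ≤⟨ *-monoˡ-≤ p (m≤n+m∸n n k) ⟩
      (k + (n ∸ k)) * p         ≡⟨ trans (*-distribʳ-+ p k (n ∸ k)) (+-comm (k * p) _) ⟩
      (n ∸ k) * p + k * p       ≤⟨ +-monoʳ-≤ ((n ∸ k) * p) (*-monoʳ-≤ k (P′≤^ n k)) ⟩
      (n ∸ k) * p + k * n ^ k   ∎
    lemma : ∀ n k q e → n * (q + k * e + k * k * e) + suc k * (n * e) ≡ n * q + suc k * suc k * (n * e)
    lemma = solve-∀

  -- With ℓ = k + 1, the numerator (ℓ-1)! (n C ℓ) of `R` counts cyclic arrangements, and each of
  -- them comes from ℓ sequences of distinct vertices.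
  factorial-C : ∀ {n k} → suc k ≤ n → suc k * (k ! * (n C suc k)) ≡ n P′ suc k
  factorial-C {n} {k} k<n = begin
    suc k * (k ! * (n C suc k))         ≡⟨ *-assoc (suc k) (k !) _ ⟨
    suc k ! * (n C suc k)               ≡⟨ cong (suc k ! *_) (nCk≡nPk/k! k<n) ⟩
    suc k ! * ((n P suc k) / suc k !)   ≡⟨ *-comm (suc k !) _ ⟩
    (n P suc k) / suc k ! * suc k !     ≡⟨ cong (λ p → p / suc k ! * suc k !) P≡P′ ⟩
    (n P′ suc k) / suc k ! * suc k !    ≡⟨ m/n*n≡m (k!∣nP′k k<n) ⟩
    n P′ suc k                          ∎
    where
    open ≡-Reasoning
    instance _ = suc k !≢0
    P≡P′ : n P suc k ≡ n P′ suc k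
    P≡P′ = cong (λ b → if b then n P′ suc k else 0) (Equivalence.to T-≡ (≤⇒≤ᵇ k<n))

-- Closed walks as traces, and the limit

module Asymptotics where

  open import Defs
  open Spectral
  open Counting
  open import Data.Bool using (true; false; _xor_)
  open import Data.Empty using (⊥-elim)
  open import Data.Fin using (Fin; zero; suc)
  import Data.Fin as F
  import Data.Integer as ℤ
  import Data.Integer.Properties as ℤ
  open import Data.List using (allFin)
  import Data.List as List
  import Data.Nat as ℕ
  open ℕ using (ℕ; zero; suc; _!)
  open import Data.Nat.Combinatorics using (_C_)
  open import Data.Nat.Combinatorics.Base using (_P′_)
  open import Data.Nat.Divisibility using (_∣_; divides)
  import Data.Nat.Properties as ℕ
  import Data.Nat.Tactic.RingSolver as ℕ-Solver
  open import Data.Product using (_,_; proj₁; proj₂; ∃-syntax)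
  open import Data.Rational hiding (_⊔_; _⊓_; floor)
  open import Data.Rational.Properties
  import Data.Rational.Unnormalised as ℚᵘ
  import Data.Rational.Unnormalised.Properties as ℚᵘ
  open import Data.Sum using (inj₁; inj₂)
  open import Data.Vec using (toList)
  open import Function using (_∘_; id)
  open import Relation.Binary.PropositionalEquality
  open import Relation.Nullary using (¬_; yes; no)
  open import Relation.Nullary.Decidable using (⌊_⌋)
  open import Tactic.RingSolver using (solve-∀)
  open import Algebra.Bundles using (CommutativeRing)
  open CommutativeRing +-*-commutativeRing using (semiring)
  open import Algebra.Properties.Semiring.Exp semiring using (_^_)

  -- Closed walks and traces

  ∑-tabulate : ∀ {A : Set} {n} (f : A → ℕ) (g : Fin n → A) → ι (∑ₗ f (List.tabulate g)) ≡ ∑ λ i → ι (f (g i))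
  ∑-tabulate {n = zero}  f g = sym (∑-empty _)
  ∑-tabulate {n = suc n} f g = begin
    ι (f (g zero) ℕ.+ ∑ₗ f (List.tabulate (g ∘ suc)))       ≡⟨ ι-+ (f (g zero)) _ ⟩
    ι (f (g zero)) + ι (∑ₗ f (List.tabulate (g ∘ suc)))     ≡⟨ cong (ι (f (g zero)) +_) (∑-tabulate f (g ∘ suc)) ⟩
    ι (f (g zero)) + ∑ (λ i → ι (f (g (suc i))))            ≡⟨ ∑-suc (λ i → ι (f (g i))) ⟨
    ∑ (λ i → ι (f (g i)))                                   ∎
    where open ≡-Reasoning

  module _ {n : ℕ} (m : Weight n) where

    weightMatrix : Mat n n
    weightMatrix = mat λ i j → ι (m i j)

    private
      M = weightMatrix

    walks : ∀ k x y → ι (∑ₗ (λ v → walk m x (toList v) y) (allVecs k (allFin n))) ≡ (M ^ᴹ suc k) ⟨ x , y ⟩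
    walks zero x y = begin
      ι (m x y ℕ.+ 0)             ≡⟨ cong ι (ℕ.+-identityʳ (m x y)) ⟩
      ι (m x y)                   ≡⟨ mat-entry (λ i j → ι (m i j)) x y ⟨
      M ⟨ x , y ⟩                 ≡⟨ cong (_⟨ x , y ⟩) (·-identityˡ M) ⟨
      (M ^ᴹ 1) ⟨ x , y ⟩          ∎
      where open ≡-Reasoning
    walks (suc k) x y = begin
      ι (∑ₗ (λ v → walk m x (toList v) y) (allVecs (suc k) (allFin n)))
        ≡⟨ cong ι (trans (∑ₗ-allVecs-suc k (λ v → walk m x (toList v) y) (allFin n))
             (∑ₗ-cong (λ z → ∑ₗ-*ˡ (m x z) (λ v → walk m z (toList v) y) (allVecs k (allFin n))) (allFin n))) ⟩
      ι (∑ₗ (λ z → m x z ℕ.* W z) (allFin n))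
        ≡⟨ ∑-tabulate (λ z → m x z ℕ.* W z) id ⟩
      ∑ (λ z → ι (m x z ℕ.* W z))
        ≡⟨ ∑-cong (λ z → trans (ι-* (m x z) (W z)) (cong₂ _*_ (sym (mat-entry (λ i j → ι (m i j)) x z)) (walks k z y))) ⟩
      ∑ (λ z → M ⟨ x , z ⟩ * (M ^ᴹ suc k) ⟨ z , y ⟩)
        ≡⟨ ·-entry M (M ^ᴹ suc k) x y ⟨
      (M · M ^ᴹ suc k) ⟨ x , y ⟩
        -- Walks unfold at their first vertex, whereas matrix powers grow on the right; writing M as
        -- its first power lets `^ᴹ-+` reconcile the two.
        ≡⟨ cong (λ A → (A · M ^ᴹ suc k) ⟨ x , y ⟩) (·-identityˡ M) ⟨
      (M ^ᴹ 1 · M ^ᴹ suc k) ⟨ x , y ⟩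
        ≡⟨ cong (_⟨ x , y ⟩) (trans (sym (^ᴹ-+ M 1 (suc k))) (cong (M ^ᴹ_) (ℕ.+-comm (suc k) 1))) ⟩
      (M ^ᴹ suc (suc k)) ⟨ x , y ⟩ ∎
      where
      open ≡-Reasoning
      W : Fin n → ℕ
      W z = ∑ₗ (λ v → walk m z (toList v) y) (allVecs k (allFin n))

    closedWalks : ∀ k → ι (∑ₗ (closedWalk m ∘ toList) (allVecs (suc k) (allFin n))) ≡ tr (M ^ᴹ suc k)
    closedWalks k = begin
      ι (∑ₗ (closedWalk m ∘ toList) (allVecs (suc k) (allFin n)))
        ≡⟨ cong ι (∑ₗ-allVecs-suc k (closedWalk m ∘ toList) (allFin n)) ⟩
      ι (∑ₗ (λ x → ∑ₗ (λ v → walk m x (toList v) x) (allVecs k (allFin n))) (allFin n))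
        ≡⟨ ∑-tabulate _ id ⟩
      ∑ (λ x → ι (∑ₗ (λ v → walk m x (toList v) x) (allVecs k (allFin n))))
        ≡⟨ ∑-cong (λ x → walks k x x) ⟩
      ∑ (λ x → (M ^ᴹ suc k) ⟨ x , x ⟩)
        ≡⟨ tr-def (M ^ᴹ suc k) ⟨
      tr (M ^ᴹ suc k) ∎
      where open ≡-Reasoning

  ι-^ : ∀ n k → ι (n ℕ.^ k) ≡ ι n ^ k
  ι-^ n zero    = +-identityʳ 1ℚ
  ι-^ n (suc k) = trans (ι-* n (n ℕ.^ k)) (cong (ι n *_) (ι-^ n k))

  ι-cancel-≤ : ∀ {m n} → ι m ≤ ι n → m ℕ.≤ n
  ι-cancel-≤ {m} {n} ιm≤ιn with m ℕ.≤? n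
  ... | yes m≤n = m≤n
  ... | no m≰n  = ⊥-elim (<-irrefl refl (<-≤-trans
      (<-≤-trans (subst (_< 1ℚ + ι n) (+-identityˡ (ι n)) (+-monoˡ-< (ι n) 0<1)) (ι-mono (ℕ.≰⇒> m≰n))) ιm≤ιn))

  fewCycles : ∀ {n k} → NotFourfold (suc k) → (A : Digraph n) → IsTournament A →
              2 ℕ.^ suc k ℕ.* cycleSeqCount (suc k) A ℕ.≤ n ℕ.^ suc k
  fewCycles {zero}  {k} nf A tour = ℕ.≤-reflexive (ℕ.*-zeroʳ (2 ℕ.^ suc k))
  fewCycles {suc n} {k} nf A (loop , arc) = begin
    2 ℕ.^ suc k ℕ.* cycleSeqCount (suc k) A                    ≡⟨ totalWeight-arcs (suc k) A ⟨
    totalWeight (suc k) (arcs A)                               ≤⟨ totalWeight-mono (suc k) {arcs A} {m} (λ i j → ℕ.m≤m+n (arcs A i j) (𝟏 ⌊ i F.≟ j ⌋)) ⟩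
    totalWeight (suc k) m                                      ≤⟨ totalWeight≤closedWalks (suc k) m ⟩
    ∑ₗ (closedWalk m ∘ toList) (allVecs (suc k) (allFin (suc n)))  ≤⟨ ι-cancel-≤ (subst₂ _≤_ (sym (closedWalks m k)) (sym (ι-^ (suc n) (suc k))) bound) ⟩
    suc n ℕ.^ suc k                                            ∎
    where
    open ℕ.≤-Reasoning
    m : Weight (suc n)
    m i j = arcs A i j ℕ.+ 𝟏 ⌊ i F.≟ j ⌋
    M = weightMatrix m
    entry : ∀ i j → M ⟨ i , j ⟩ ≡ ι (m i j)
    entry = mat-entry (λ i j → ι (m i j))
    xor-sum : ∀ a b → a xor b ≡ true → 2 ℕ.* 𝟏 a ℕ.+ 0 ℕ.+ (2 ℕ.* 𝟏 b ℕ.+ 0) ≡ 2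
    xor-sum true  false refl = refl
    xor-sum false true  refl = refl
    sum≡2 : ∀ i j → m i j ℕ.+ m j i ≡ 2
    sum≡2 i j with i F.≟ j | j F.≟ i
    ... | yes refl | yes _   rewrite loop i = refl
    ... | no i≢j   | no _    = xor-sum (A i j) (A j i) (arc i≢j)
    ... | yes refl | no ¬p   = ⊥-elim (¬p refl)
    ... | no ¬p    | yes refl = ⊥-elim (¬p refl)
    bound : tr (M ^ᴹ suc k) ≤ ι (suc n) ^ suc k
    bound = TraceBound.trace-bound M (λ i j → subst (0ℚ ≤_) (sym (entry i j)) (0≤ι (m i j)))
      (λ i j → trans (cong₂ _+_ (entry i j) (entry j i)) (trans (sym (ι-+ (m i j) (m j i))) (trans (cong ι (sum≡2 i j)) 2≡)))
      k nf
      where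
      2≡ : ι 2 ≡ 2ℚ
      2≡ = refl

  notFourfold : ∀ ℓ → ¬ (4 ∣ ℓ) → NotFourfold ℓ
  notFourfold 0 4∤ℓ = ⊥-elim (4∤ℓ (divides 0 refl))
  notFourfold 1 4∤ℓ = 0 , inj₁ refl
  notFourfold 2 4∤ℓ = 0 , inj₂ refl
  notFourfold 3 4∤ℓ = 1 , inj₁ refl
  notFourfold (suc (suc (suc (suc ℓ)))) 4∤ℓ with notFourfold ℓ (λ { (divides q eq) → 4∤ℓ (divides (suc q) (cong (4 ℕ.+_) eq)) })
  ... | m , inj₁ refl = suc (suc m) , inj₁ (lemma m)
    where
    lemma : ∀ m → 4 ℕ.+ suc (m ℕ.+ m) ≡ suc (suc (suc m) ℕ.+ suc (suc m))
    lemma = ℕ-Solver.solve-∀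
  ... | m , inj₂ refl = suc m , inj₂ (lemma m)
    where
    lemma : ∀ m → 4 ℕ.+ (suc (m ℕ.+ m) ℕ.+ suc (m ℕ.+ m)) ≡ suc (suc m ℕ.+ suc m) ℕ.+ suc (suc m ℕ.+ suc m)
    lemma = ℕ-Solver.solve-∀

  -- The limit

  /-*-ι : ∀ a b .{{_ : ℕ.NonZero b}} → ((ℤ.+ a) / b) * ι b ≡ ι a
  /-*-ι a b@(suc b-1) = trans (cong ((ℤ.+ a / b) *_) (ι≡/1 b)) (trans (toℚᵘ-injective (begin
    toℚᵘ ((ℤ.+ a / b) * (ℤ.+ b / 1))              ≈⟨ toℚᵘ-homo-* (ℤ.+ a / b) (ℤ.+ b / 1) ⟩
    toℚᵘ (ℤ.+ a / b) ℚᵘ.* toℚᵘ (ℤ.+ b / 1)        ≈⟨ ℚᵘ.*-cong (toℚᵘ-fromℚᵘ (ℚᵘ.mkℚᵘ (ℤ.+ a) b-1)) (toℚᵘ-fromℚᵘ (ℚᵘ.mkℚᵘ (ℤ.+ b) 0)) ⟩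
    ℚᵘ.mkℚᵘ (ℤ.+ a) b-1 ℚᵘ.* ℚᵘ.mkℚᵘ (ℤ.+ b) 0    ≈⟨ ℚᵘ.*≡* (trans (ℤ.*-identityʳ _) (cong (ℤ.+ a ℤ.*_) (cong ℤ.+_ (sym (ℕ.*-identityʳ b))))) ⟩
    ℚᵘ.mkℚᵘ (ℤ.+ a) 0                             ≈⟨ toℚᵘ-fromℚᵘ (ℚᵘ.mkℚᵘ (ℤ.+ a) 0) ⟨
    toℚᵘ (ℤ.+ a / 1)                              ∎)) (sym (ι≡/1 a)))
    where open ℚᵘ.≃-Reasoning

  safeDiv-* : ∀ p {q} → 0ℚ < q → safeDiv p q * q ≡ p
  safeDiv-* p {q} 0<q with q ≟ 0ℚ
  ... | yes refl = ⊥-elim (<-irrefl refl 0<q)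
  ... | no q≢0   = trans (*-assoc p _ q) (trans (cong (p *_) (*-inverseˡ q {{≢-nonZero q≢0}})) (*-identityʳ p))

  ∣∣<-intro : ∀ {x ε} → - ε < x → x < ε → ∣ x ∣ < ε
  ∣∣<-intro {x} {ε} -ε<x x<ε with ∣p∣≡p∨∣p∣≡-p x
  ... | inj₁ eq = subst (_< ε) (sym eq) x<ε
  ... | inj₂ eq = subst₂ _<_ (sym eq) (neg-involutive ε) (neg-antimono-< -ε<x)
    where
    neg-involutive : ∀ x → - (- x) ≡ x
    neg-involutive = solve-∀ ℚ-ring

  module Limit (k : ℕ) (nf : NotFourfold (3 ℕ.+ k)) (ε : ℚ) (0<ε : 0ℚ < ε) where

    private
      ℓ = 3 ℕ.+ k
      D E q N : ℕ
      -- For n ≥ ℓ ≥ 3, D times `R n ℓ` is the falling factorial, so the ratio compares D times the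
      -- maximum with `n P′ ℓ`. After multiplication by n, the error is at most ℓ² n^ℓ from above
      -- and D n^ℓ from below; E bounds both coefficients.
      D = 2 ℕ.^ ℓ ℕ.* ℓ
      E = ℓ ℕ.* ℓ ℕ.+ D
      q = suc (proj₁ (archimedean (ι E * inv 0<ε)))
      -- The part ℓ² absorbs the gap between n^ℓ and the falling factorial, which leaves q n^ℓ ≤ n ·
      -- (n P′ ℓ). The choice of q with E < εq then makes the error smaller than ε.
      N = ℓ ℕ.* ℓ ℕ.+ q

      E<εq : ι E < ε * ι q
      E<εq = begin-strict
        ι E                                          ≡⟨ *-inv-* (ι E) 0<ε ⟨
        ι E * inv 0<ε * ε                            ≤⟨ *-monoʳ-≤ (<⇒≤ 0<ε) (proj₂ (archimedean (ι E * inv 0<ε))) ⟩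
        ι q-1 * ε                                    ≡⟨ +-identityˡ _ ⟨
        0ℚ + ι q-1 * ε                               <⟨ +-monoˡ-< (ι q-1 * ε) 0<ε ⟩
        ε + ι q-1 * ε                                ≡⟨ l ε (ι q-1) ⟩
        ε * ι q                                      ∎
        where
        open ≤-Reasoning
        q-1 = proj₁ (archimedean (ι E * inv 0<ε))
        l : ∀ ε q → ε + q * ε ≡ ε * (1ℚ + q)
        l = solve-∀ ℚ-ring

      module _ (n : ℕ) (N≤n : N ℕ.≤ n) where

        c F G X : ℕ
        c = maxCycles n ℓ
        F = n P′ ℓ
        G = (2 ℕ.+ k) ! ℕ.* (n C ℓ)
        X = n ℕ.^ ℓ

        q≤n : q ℕ.≤ n
        q≤n = ℕ.≤-trans (ℕ.m≤n+m q (ℓ ℕ.* ℓ)) N≤n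

        1≤n : 1 ℕ.≤ n
        1≤n = ℕ.≤-trans (ℕ.s≤s ℕ.z≤n) q≤n

        ℓ≤n : ℓ ℕ.≤ n
        ℓ≤n = ℕ.≤-trans (ℕ.m≤m*n ℓ ℓ) (ℕ.≤-trans (ℕ.m≤m+n (ℓ ℕ.* ℓ) q) N≤n)

        ℓG≡F : ℓ ℕ.* G ≡ F
        ℓG≡F = factorial-C ℓ≤n

        upper : n ℕ.* (D ℕ.* c) ℕ.≤ n ℕ.* F ℕ.+ ℓ ℕ.* ℓ ℕ.* X
        upper = ℕ.≤-trans (ℕ.*-monoʳ-≤ n (ℕ.≤-trans (ℕ.≤-reflexive (l (2 ℕ.^ ℓ) ℓ c)) (maxCycles-upper {n} (2 ℕ.+ k) X (fewCycles nf)))) (^≤P′ n ℓ)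
          where
          l : ∀ a ℓ c → a ℕ.* ℓ ℕ.* c ≡ a ℕ.* (c ℕ.* ℓ)
          l = ℕ-Solver.solve-∀

        lower : n ℕ.* F ℕ.≤ n ℕ.* (D ℕ.* c) ℕ.+ D ℕ.* X
        lower = begin
          n ℕ.* F                                     ≤⟨ ℕ.*-monoʳ-≤ n (maxCycles-lower {n} k) ⟩
          n ℕ.* (2 ℕ.^ ℓ ℕ.* (c ℕ.* ℓ) ℕ.+ D)         ≡⟨ l n (2 ℕ.^ ℓ) ℓ c ⟩
          n ℕ.* (D ℕ.* c) ℕ.+ D ℕ.* (n ℕ.* 1)         ≤⟨ ℕ.+-monoʳ-≤ (n ℕ.* (D ℕ.* c)) (ℕ.*-monoʳ-≤ D (ℕ.*-monoʳ-≤ n 1≤^)) ⟩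
          n ℕ.* (D ℕ.* c) ℕ.+ D ℕ.* X                 ∎
          where
          open ℕ.≤-Reasoning
          1≤^ : 1 ℕ.≤ n ℕ.^ (2 ℕ.+ k)
          1≤^ = ℕ.≤-trans (ℕ.≤-reflexive (sym (ℕ.^-zeroˡ (2 ℕ.+ k)))) (ℕ.^-monoˡ-≤ (2 ℕ.+ k) 1≤n)
          l : ∀ n a ℓ c → n ℕ.* (a ℕ.* (c ℕ.* ℓ) ℕ.+ a ℕ.* ℓ) ≡ n ℕ.* (a ℕ.* ℓ ℕ.* c) ℕ.+ a ℕ.* ℓ ℕ.* (n ℕ.* 1)
          l = ℕ-Solver.solve-∀

        qX≤nF : q ℕ.* X ℕ.≤ n ℕ.* F
        qX≤nF = ℕ.+-cancelʳ-≤ (ℓ ℕ.* ℓ ℕ.* X) _ _ (begin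
          q ℕ.* X ℕ.+ ℓ ℕ.* ℓ ℕ.* X      ≡⟨ trans (ℕ.+-comm (q ℕ.* X) _) (sym (ℕ.*-distribʳ-+ X (ℓ ℕ.* ℓ) q)) ⟩
          N ℕ.* X                        ≤⟨ ℕ.*-monoˡ-≤ X N≤n ⟩
          n ℕ.* X                        ≤⟨ ^≤P′ n ℓ ⟩
          n ℕ.* F ℕ.+ ℓ ℕ.* ℓ ℕ.* X      ∎)
          where open ℕ.≤-Reasoning

        0<X : 0ℚ < ι X
        0<X = <-≤-trans 0<1 (≤-trans (≤-reflexive (sym (+-identityʳ 1ℚ))) (ι-mono {1} (ℕ.≤-trans (ℕ.≤-reflexive (sym (ℕ.^-zeroˡ ℓ))) (ℕ.^-monoˡ-≤ ℓ 1≤n))))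

        K = ι (n ℕ.* F)

        EX<εK : ι (E ℕ.* X) < ε * K
        EX<εK = begin-strict
          ι (E ℕ.* X)          ≡⟨ ι-* E X ⟩
          ι E * ι X            <⟨ *-monoˡ-<-pos (ι X) {{positive 0<X}} E<εq ⟩
          ε * ι q * ι X        ≡⟨ trans (*-assoc ε (ι q) (ι X)) (cong (ε *_) (sym (ι-* q X))) ⟩
          ε * ι (q ℕ.* X)      ≤⟨ *-monoˡ-≤ (<⇒≤ 0<ε) (ι-mono qX≤nF) ⟩
          ε * K                ∎
          where open ≤-Reasoning

        0<K : 0ℚ < K
        0<K = <-≤-trans (0<p*q (0<ι (proj₁ (archimedean (ι E * inv 0<ε)))) 0<X) (≤-trans (≤-reflexive (sym (ι-* q X))) (ι-mono qX≤nF))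

        Rn = R n ℓ

        R-eq : Rn * ι (2 ℕ.^ ℓ) ≡ ι G
        R-eq = /-*-ι G (2 ℕ.^ ℓ) {{ℕ.m^n≢0 2 ℓ}}

        nDR≡K : ι (n ℕ.* D) * Rn ≡ K
        nDR≡K = begin
          ι (n ℕ.* D) * Rn                         ≡⟨ cong (λ t → ι t * Rn) (l n (2 ℕ.^ ℓ) ℓ) ⟩
          ι (n ℕ.* ℓ ℕ.* 2 ℕ.^ ℓ) * Rn             ≡⟨ cong (_* Rn) (ι-* (n ℕ.* ℓ) (2 ℕ.^ ℓ)) ⟩
          ι (n ℕ.* ℓ) * ι (2 ℕ.^ ℓ) * Rn           ≡⟨ trans (*-assoc (ι (n ℕ.* ℓ)) _ _) (cong (ι (n ℕ.* ℓ) *_) (trans (*-comm (ι (2 ℕ.^ ℓ)) Rn) R-eq)) ⟩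
          ι (n ℕ.* ℓ) * ι G                        ≡⟨ ι-* (n ℕ.* ℓ) G ⟨
          ι (n ℕ.* ℓ ℕ.* G)                        ≡⟨ cong ι (trans (ℕ.*-assoc n ℓ G) (cong (n ℕ.*_) ℓG≡F)) ⟩
          K                                        ∎
          where
          open ≡-Reasoning
          l : ∀ n a ℓ → n ℕ.* (a ℕ.* ℓ) ≡ n ℕ.* ℓ ℕ.* a
          l = ℕ-Solver.solve-∀

        0<R : 0ℚ < Rn
        0<R = *-cancelˡ-<-nonNeg (ι (n ℕ.* D)) {{nonNegative (0≤ι (n ℕ.* D))}} (subst₂ _<_ (sym (*-zeroʳ (ι (n ℕ.* D)))) (sym nDR≡K) 0<K)

        x : ℚ
        x = ratio ℓ n - 1ℚ

        -- Multiplication by `K = nD · R`, which is also n times the falling factorial, clears all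
        -- denominators. The natural-number estimates `upper` and `lower` then apply directly.
        xK≡ : x * K ≡ ι (n ℕ.* (D ℕ.* c)) - K
        xK≡ = begin
          (r - 1ℚ) * K                             ≡⟨ cong ((r - 1ℚ) *_) (sym nDR≡K) ⟩
          (r - 1ℚ) * (ι (n ℕ.* D) * Rn)            ≡⟨ l r (ι (n ℕ.* D)) Rn ⟩
          ι (n ℕ.* D) * (r * Rn) - ι (n ℕ.* D) * Rn  ≡⟨ cong₂ (λ s t → ι (n ℕ.* D) * s - t) (trans (safeDiv-* _ 0<R) (sym (ι≡/1 c))) nDR≡K ⟩
          ι (n ℕ.* D) * ι c - K                    ≡⟨ cong (_- K) (trans (sym (ι-* (n ℕ.* D) c)) (cong ι (ℕ.*-assoc n D c))) ⟩
          ι (n ℕ.* (D ℕ.* c)) - K                  ∎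
          where
          open ≡-Reasoning
          r = ratio ℓ n
          l : ∀ r d R → (r - 1ℚ) * (d * R) ≡ d * (r * R) - d * R
          l = solve-∀ ℚ-ring

        x<ε : x < ε
        x<ε = *-cancelʳ-<-nonNeg K {{nonNegative (<⇒≤ 0<K)}} (begin-strict
          x * K                                              ≡⟨ xK≡ ⟩
          ι (n ℕ.* (D ℕ.* c)) - K                            ≤⟨ +-monoˡ-≤ (- K) (ι-mono upper) ⟩
          ι (n ℕ.* F ℕ.+ ℓ ℕ.* ℓ ℕ.* X) - K                  ≡⟨ cong (_- K) (ι-+ (n ℕ.* F) _) ⟩
          K + ι (ℓ ℕ.* ℓ ℕ.* X) - K                          ≡⟨ l K (ι (ℓ ℕ.* ℓ ℕ.* X)) ⟩
          ι (ℓ ℕ.* ℓ ℕ.* X)                                  ≤⟨ ι-mono (ℕ.*-monoˡ-≤ X (ℕ.m≤m+n (ℓ ℕ.* ℓ) D)) ⟩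
          ι (E ℕ.* X)                                        <⟨ EX<εK ⟩
          ε * K                                              ∎)
          where
          open ≤-Reasoning
          l : ∀ K y → K + y - K ≡ y
          l = solve-∀ ℚ-ring

        -ε<x : - ε < x
        -ε<x = *-cancelʳ-<-nonNeg K {{nonNegative (<⇒≤ 0<K)}} (begin-strict
          - ε * K                                            ≡⟨ neg-distribˡ-* ε K ⟨
          - (ε * K)                                          <⟨ neg-antimono-< EX<εK ⟩
          - ι (E ℕ.* X)                                      ≤⟨ neg-antimono-≤ (ι-mono (ℕ.*-monoˡ-≤ X (ℕ.m≤n+m D (ℓ ℕ.* ℓ)))) ⟩
          - ι (D ℕ.* X)                                      ≡⟨ l (ι (n ℕ.* (D ℕ.* c))) (ι (D ℕ.* X)) ⟩
          ι (n ℕ.* (D ℕ.* c)) - (ι (n ℕ.* (D ℕ.* c)) + ι (D ℕ.* X))   ≡⟨ cong (λ t → ι (n ℕ.* (D ℕ.* c)) - t) (ι-+ (n ℕ.* (D ℕ.* c)) (D ℕ.* X)) ⟨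
          ι (n ℕ.* (D ℕ.* c)) - ι (n ℕ.* (D ℕ.* c) ℕ.+ D ℕ.* X)       ≤⟨ +-monoʳ-≤ (ι (n ℕ.* (D ℕ.* c))) (neg-antimono-≤ (ι-mono lower)) ⟩
          ι (n ℕ.* (D ℕ.* c)) - K                            ≡⟨ xK≡ ⟨
          x * K                                              ∎)
          where
          open ≤-Reasoning
          l : ∀ a y → - y ≡ a - (a + y)
          l = solve-∀ ℚ-ring

    converges : ∃[ N ] (∀ n → N ℕ.≤ n → ∣ ratio ℓ n - 1ℚ ∣ < ε)
    converges = N , λ n N≤n → ∣∣<-intro (-ε<x n N≤n) (x<ε n N≤n)

open import Defs
open import Data.Nat using (ℕ; _≤_)
open import Data.Nat.Divisibility using (_∣_)
open import Relation.Nullary using (¬_)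
open import Data.Rational using (1ℚ)
open Data.Nat using (suc; s≤s)

theorem2 : (ℓ : ℕ) → 3 ≤ ℓ → ¬ (4 ∣ ℓ) → ConvergesTo (ratio ℓ) 1ℚ
theorem2 ℓ@(suc (suc (suc k))) (s≤s (s≤s (s≤s _))) 4∤ℓ ε 0<ε =
  Asymptotics.Limit.converges k (Asymptotics.notFourfold ℓ 4∤ℓ) ε 0<ε
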